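{- For every prime power $q\ge 4$ there exists a set of $q^2-q$ points of $\mathrm{AG}(5,q)$ that is both a $4$-general set and a $(5,3)$-set.
   Context: For integers $r,s$, an $(r,s)$-set of $\mathrm{PG}(n,q)$ is a set $\mathcal X$ of points such that: (i) every $s$-dimensional projective subspace contains at most $r$ points of $\mathcal X$; (ii) $\mathcal X$ spans $\mathrm{PG}(n,q)$; (iii) some $(s+1)$-dimensional projective subspace contains $r+2$ points of $\mathcal X$. A $k$-general set is a $(k-1,k-2)$-set (so a $4$-general set is a $(3,2)$-set). A set of points of $\mathrm{AG}(n,q)$ is called an $(r,s)$-set (resp. $k$-general set) of $\mathrm{AG}(n,q)$ if, regarded as a subset of $\mathrm{PG}(n,q)=\mathrm{AG}(n,q)\cup H_\infty$ ($H_\infty$ the hyperplane at infinity), it is an $(r,s)$-set (resp. $k$-general set) of $\mathrm{PG}(n,q)$. -}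

module Defs where

open import Algebra.Apartness.Bundles using (HeytingField; HeytingCommutativeRing)
import Algebra.Apartness.Properties.HeytingCommutativeRing as HeytingProperties
open import Algebra.Bundles using (CommutativeRing)
import Algebra.Properties.Monoid.Sum as MonoidSum
import Data.Vec.Functional.Relation.Binary.Equality.Setoid as VectorEquality
open import Data.Fin.Base using (Fin; zero)
open import Data.Nat.Base using (ℕ; suc; _∸_; _^_; _≤_)
open import Data.Nat.Primality using (Prime)
open import Data.Product.Base using (Σ-syntax; ∃-syntax; _×_)
open import Data.Vec.Functional using (Vector; _∷_)
open import Function.Base using (_∘_)
open import Function.Bundles using (Inverse)
open import Function.Definitions using (Injective)
open import Level using (_⊔_)
open import Relation.Binary.Core using (Rel)
open import Relation.Binary.PropositionalEquality as ≡ using (_≡_)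
open import Relation.Nullary.Negation using (¬_)
open import Relation.Unary using (Pred; _∈_; _∩_)

IsPrimePower : ℕ → Set
IsPrimePower q = ∃[ p ] ∃[ h ] (Prime p × 1 ≤ h × q ≡ p ^ h)

-- Sizes of subsets of A, counted up to the given equality on A.
module Counting {a e} {A : Set a} (_≈_ : Rel A e) where

  AtLeast : ∀ {p} → ℕ → Pred A p → Set (a ⊔ e ⊔ p)
  AtLeast m Y = Σ[ f ∈ (Fin m → A) ] (Injective _≡_ _≈_ f × (∀ i → f i ∈ Y))

  AtMost : ∀ {p} → ℕ → Pred A p → Set (a ⊔ e ⊔ p)
  AtMost r Y = ∀ m → AtLeast m Y → m ≤ r

  HasSize : ∀ {p} → ℕ → Pred A p → Set (a ⊔ e ⊔ p)
  HasSize N Y = Σ[ f ∈ (Fin N → A) ]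
    (Injective _≡_ _≈_ f × (∀ i → f i ∈ Y) × (∀ y → y ∈ Y → ∃[ i ] (y ≈ f i)))

-- A Heyting field with finitely many elements is a finite field in the usual
-- sense: equality is then decidable, and x # y holds exactly when ¬ (x ≈ y).
module Geometry {c ℓ₁ ℓ₂} (K : HeytingField c ℓ₁ ℓ₂) where

  open HeytingField K using (Carrier; _≈_; _#_; _*_; 0#; 1#; #-irrefl; heytingCommutativeRing)
  open CommutativeRing (HeytingCommutativeRing.commutativeRing heytingCommutativeRing)
    using (setoid; +-monoid)
  open HeytingProperties heytingCommutativeRing using (1#0)
  open MonoidSum +-monoid using (sum)
  open VectorEquality setoid public using (_≋_)

  HasOrder : ℕ → Set (c ⊔ ℓ₁)
  HasOrder q = Inverse setoid (≡.setoid (Fin q))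

  𝟎 : ∀ {n} → Vector Carrier n
  𝟎 _ = 0#

  infixr 7 _•_
  _•_ : ∀ {n} → Carrier → Vector Carrier n → Vector Carrier n
  (a • v) j = a * v j

  combination : ∀ {m n} → Vector Carrier m → Vector (Vector Carrier n) m → Vector Carrier n
  combination a b j = sum (λ i → (a i • b i) j)

  LinearlyIndependent : ∀ {m n} → Vector (Vector Carrier n) m → Set (c ⊔ ℓ₁)
  LinearlyIndependent b = ∀ a → combination a b ≋ 𝟎 → ∀ i → a i ≈ 0#

  InSpan : ∀ {m n} → Vector (Vector Carrier n) m → Pred (Vector Carrier n) (c ⊔ ℓ₁)
  InSpan b v = ∃[ a ] (v ≋ combination a b)

  -- A point of PG(n,q), as a vector of homogeneous coordinates X₀,…,Xₙ.
  record Point (n : ℕ) : Set (c ⊔ ℓ₁) where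
    constructor point
    field
      coords  : Vector Carrier (suc n)
      nonzero : ¬ (coords ≋ 𝟎)

  open Point public

  infix 4 _≈ₚ_
  _≈ₚ_ : ∀ {n} → Rel (Point n) (c ⊔ ℓ₁ ⊔ ℓ₂)
  P ≈ₚ Q = ∃[ a ] (a # 0# × coords P ≋ a • coords Q)

  -- An s-dimensional projective subspace is a vector subspace of dimension
  -- s + 1, presented by a basis.
  record Subspace (n s : ℕ) : Set (c ⊔ ℓ₁) where
    field
      basis       : Vector (Vector Carrier (suc n)) (suc s)
      independent : LinearlyIndependent basis

  ⟦_⟧ : ∀ {n s} → Subspace n s → Pred (Point n) (c ⊔ ℓ₁)
  ⟦ U ⟧ P = InSpan (Subspace.basis U) (coords P)

  Spans : ∀ {n p} → Pred (Point n) p → Set (c ⊔ ℓ₁ ⊔ p)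
  Spans {n} X = ∀ (P : Point n) →
    ∃[ m ] Σ[ Q ∈ Vector (Point n) m ] ((∀ i → Q i ∈ X) × InSpan (coords ∘ Q) (coords P))

  -- The condition "contains r + 2 points" is read as "at least r + 2".
  record Is⟨_,_⟩-Set (r s : ℕ) {n p} (X : Pred (Point n) p) : Set (c ⊔ ℓ₁ ⊔ ℓ₂ ⊔ p) where
    open Counting (_≈ₚ_ {n})
    field
      atMost  : (U : Subspace n s) → AtMost r (X ∩ ⟦ U ⟧)
      spans   : Spans X
      attains : Σ[ U ∈ Subspace n (suc s) ] AtLeast (suc (suc r)) (X ∩ ⟦ U ⟧)

  -- Meaningful for k ≥ 2, where the truncated subtractions are exact.
  IsGeneral : (k : ℕ) → ∀ {n p} → Pred (Point n) p → Set (c ⊔ ℓ₁ ⊔ ℓ₂ ⊔ p)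
  IsGeneral k = Is⟨ k ∸ 1 , k ∸ 2 ⟩-Set

  -- AG(n,q) is the complement of the hyperplane H∞ : X₀ = 0.
  AffinePoint : ℕ → Set c
  AffinePoint n = Vector Carrier n

  embed : ∀ {n} → AffinePoint n → Point n
  embed x = point (1# ∷ x) (λ 1∷x≋𝟎 → #-irrefl (1∷x≋𝟎 zero) 1#0)

  inPG : ∀ {n p} → Pred (AffinePoint n) p → Pred (Point n) (c ⊔ ℓ₁ ⊔ ℓ₂ ⊔ p)
  inPG 𝒳 P = ∃[ x ] (x ∈ 𝒳 × P ≈ₚ embed x)

{-# OPTIONS --safe #-}

-- The points are (1 : τ : x : n : F₁ : F₂) with τ n = x² + x + b and τ ≠ 0: an elliptic
-- quadric minus a conic, embedded by the quadrics through three conjugate points of that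
-- conic, the roots of an irreducible cubic c (a quintic del Pezzo surface minus its only
-- rational line).  For a linear relation Σ aᵢ Pᵢ = 0 among the points, and w = (τ, x, 1, n),
-- the matrix Σ aᵢ wᵢ wᵢᵀ is, up to a zero row and column, a Hankel matrix obeying the
-- recurrence of c; it is zero or nonsingular because K[x]/(c) is a field.  Hence any four
-- points are independent.  A solid puts its points on two more quadrics of PG(3,q); two
-- linear syzygies provide another two, and six points in general position cannot lie on
-- five independent quadrics.  For suitable c some five points are dependent, and one of
-- the q + 1 hyperplanes through their solid contains two of the other q² - q - 5 points.
module Submission where

open import Defs
open import Algebra.Apartness.Bundles using (HeytingField; HeytingCommutativeRing)
open import Algebra.Bundles using (CommutativeRing)
import Algebra.Apartness.Properties.HeytingCommutativeRing as HeytingProperties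
import Algebra.Properties.AbelianGroup as AbelianGroupProperties
import Algebra.Properties.CommutativeMonoid.Sum as CommutativeMonoidSum
import Algebra.Properties.Ring as RingProperties
import Algebra.Properties.Semiring.Mult.TCOptimised as MultProperties
import Algebra.Properties.Semiring.Sum as SemiringSum
import Algebra.Solver.Ring as RingSolver
open import Algebra.Solver.Ring.AlmostCommutativeRing
  using (fromCommutativeRing; _-Raw-AlmostCommutative⟶_)
open import Data.Empty using (⊥; ⊥-elim)
open import Data.Fin.Base
  using (Fin; zero; suc; toℕ; cast; combine; remQuot; inject≤; join; splitAt;
         punchIn; punchOut; funToFin; finToFun; _↑ˡ_; _↑ʳ_)
open import Data.Fin.Patterns using (0F; 1F; 2F; 3F; 4F; 5F; 6F; 7F; 8F; 9F)
open import Data.Fin.Properties as Fin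
  using (any?; ¬∀⟶∃¬; pigeonhole; injective⇒≤; punchIn-punchOut; punchOut-injective;
         punchInᵢ≢i; punchIn-injective; funToFin-finToFin; finToFun-funToFin)
open import Data.Integer.Base as ℤ using (ℤ; +_; -[1+_])
import Data.Integer.Properties as ℤ
open import Data.Maybe.Base using (Maybe; just; nothing; map; maybe′)
open import Data.Nat.Base as ℕ using (ℕ; zero; suc; _∸_; _^_; _≤_; _<_; s≤s; z≤n)
import Data.Nat.Properties as ℕ
import Data.Nat.Tactic.RingSolver as ℕ-Solver
open import Data.Product.Base using (Σ-syntax; ∃-syntax; _×_; _,_; proj₁; proj₂)
open import Data.Sign.Base as Sign using (Sign)
open import Data.Sum.Base using (_⊎_; inj₁; inj₂)
open import Data.Sum.Properties using (inj₁-injective; inj₂-injective)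
open import Data.Vec.Base as Vec using (Vec)
open import Data.Vec.Functional using (Vector; []; _∷_; head; tail)
open import Function.Base using (_∘_)
open import Function.Bundles using (Inverse)
open import Function.Definitions using (Injective)
open import Level using (Level; _⊔_)
open import Relation.Binary.Definitions using (_Respects_)
import Relation.Binary.Reasoning.Setoid as SetoidReasoning
open import Relation.Binary.PropositionalEquality as ≡ using (_≡_; _≢_)
open import Relation.Nullary.Decidable.Core
  using (Dec; yes; no; map′; dec⇒maybe; True; toWitness; ¬?; _×-dec_; _→-dec_)
open import Relation.Nullary.Negation using (¬_; contradiction)
open import Relation.Unary using (Pred; _∩_)

-- Two demands compete: the cubic `c` must have no root, yet some five points must be dependent. The
-- order of the choices settles this. Five explicit points are fixed; their images `w` satisfy a
-- relation with computable moments, and the cubics whose recurrence these moments obey form a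
-- pencil in a parameter `k`. A count of values then yields a member without roots. The matrix
-- decides independence as follows. A plane through the images of all points but one also contains
-- the last image if its coefficient is nonzero, so it yields a kernel vector. The matrix is then
-- zero, hence every quadratic form has weighted sum zero over the points, and a product of two
-- planes that together contain all points but one isolates the coefficient of that one. All
-- arguments are uniform in the characteristic: the norm form is x² + x y + b y², and quadratic
-- forms are handled by their values, without a division by 2. Inverses, linear relations and
-- polynomials without roots all come from counting in `Fin`.

injective⇒surjective : ∀ {n} {f : Fin n → Fin n} → Injective _≡_ _≡_ f → ∀ y → ∃[ x ] f x ≡ y
injective⇒surjective {suc n} {f} f-inj y with any? (λ x → f x Fin.≟ y)
... | yes hit = hit
... | no miss = contradiction (injective⇒≤ g-inj) ℕ.1+n≰n
  where
  y≢f : ∀ x → y ≢ f x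
  y≢f x y≡fx = miss (x , ≡.sym y≡fx)

  g-inj : Injective _≡_ _≡_ (λ x → punchOut (y≢f x))
  g-inj eq = f-inj (punchOut-injective (y≢f _) (y≢f _) eq)

-- If every value were hit, a choice of preimages would be an injective section, hence a bijection,
-- and `f` would be injective. This is the source of both rootless polynomials.
collision⇒missed : ∀ {n} (f : Fin n → Fin n) {a b} → a ≢ b → f a ≡ f b → ∃[ y ] (∀ x → f x ≢ y)
collision⇒missed {n} f {a} {b} a≢b fa≡fb =
  let y , miss = ¬∀⟶∃¬ n _ (λ y → any? (λ x → f x Fin.≟ y)) ¬surjective
  in y , λ x fx≡y → miss (x , fx≡y)
  where
  ¬surjective : ¬ (∀ y → ∃[ x ] f x ≡ y)
  ¬surjective hit = a≢b (≡.trans (retract a) (≡.trans (≡.cong section fa≡fb) (≡.sym (retract b))))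
    where
    section : Fin n → Fin n
    section = proj₁ ∘ hit

    f∘section : ∀ y → f (section y) ≡ y
    f∘section = proj₂ ∘ hit

    section-inj : Injective _≡_ _≡_ section
    section-inj {x} {y} eq = ≡.trans (≡.sym (f∘section x)) (≡.trans (≡.cong f eq) (f∘section y))

    retract : ∀ x → x ≡ section (f x)
    retract x with injective⇒surjective section-inj x
    ... | y , ≡.refl = ≡.cong section (≡.sym (f∘section y))

injective-by-decision : ∀ {m n} (f : Fin m → Fin n) →
  {True (Fin.all? (λ i → Fin.all? (λ j → (f i Fin.≟ f j) →-dec (i Fin.≟ j))))} → Injective _≡_ _≡_ f
injective-by-decision f {check} {i} {j} = toWitness check i j

-- Counting and indexing the q² - q points

square-minus : ∀ r → suc r ^ 2 ∸ suc r ≡ r ℕ.* suc r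
square-minus r = ≡.trans (≡.cong (λ m → suc r ℕ.* m ∸ suc r) (ℕ.*-identityʳ (suc r))) (ℕ.m+n∸m≡n (suc r) (r ℕ.* suc r))

-- The left side counts the classes of the final pigeonhole: five dependent points and the q + 1
-- hyperplanes through their solid. With q = 4 + m the difference of the two sides is m² + 6 m + 2.
enough-points : ∀ {q} → 4 ≤ q → 5 ℕ.+ suc q < q ^ 2 ∸ q
enough-points {q} 4≤q = ≡.subst (λ q → 5 ℕ.+ suc q < q ^ 2 ∸ q) (ℕ.m+[n∸m]≡n 4≤q) (bound (q ∸ 4))
  where
  bound : ∀ m → 5 ℕ.+ suc (4 ℕ.+ m) < (4 ℕ.+ m) ^ 2 ∸ (4 ℕ.+ m)
  bound m = ≡.subst (5 ℕ.+ suc (4 ℕ.+ m) <_) (≡.sym (square-minus (3 ℕ.+ m)))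
    (≡.subst (11 ℕ.+ m ≤_) (expand m) (ℕ.m≤m+n (11 ℕ.+ m) (1 ℕ.+ 6 ℕ.* m ℕ.+ m ℕ.* m)))
    where
    expand : ∀ m → 11 ℕ.+ m ℕ.+ (1 ℕ.+ 6 ℕ.* m ℕ.+ m ℕ.* m) ≡ (3 ℕ.+ m) ℕ.* (4 ℕ.+ m)
    expand = ℕ-Solver.solve-∀

-- Index set of the points: with `z` the code of zero, a pair stands for (τ, x) with τ nonzero, and
-- the quadric then determines n.
record PairsOff {q} (z : Fin q) : Set where
  field
    first second    : Fin (q ^ 2 ∸ q) → Fin q
    first≢          : ∀ i → first i ≢ z
    pairs-injective : ∀ {i j} → first i ≡ first j → second i ≡ second j → i ≡ j
    pairs-complete  : ∀ a b → a ≢ z → ∃[ i ] (first i ≡ a × second i ≡ b)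

pairs-off : ∀ {q} (z : Fin q) → PairsOff z
pairs-off {suc r} z = record
  { first           = λ i → punchIn z (proj₁ (pair i))
  ; second          = λ i → proj₂ (pair i)
  ; first≢          = λ i → punchInᵢ≢i z _
  ; pairs-injective = λ {i} {j} eq₁ eq₂ → unpair-injective i j (≡.cong₂ _,_ (punchIn-injective z _ _ eq₁) eq₂)
  ; pairs-complete  = λ a b a≢z → let k , eq = pair-complete (punchOut (a≢z ∘ ≡.sym)) b in
      k , ≡.trans (≡.cong (punchIn z ∘ proj₁) eq) (punchIn-punchOut (a≢z ∘ ≡.sym)) , ≡.cong proj₂ eq
  }
  where
  pair : Fin (suc r ^ 2 ∸ suc r) → Fin r × Fin (suc r)
  pair i = remQuot (suc r) (cast (square-minus r) i)

  unpair-injective : ∀ i j → pair i ≡ pair j → i ≡ j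
  unpair-injective i j eq = Fin.toℕ-injective (≡.trans (≡.sym (Fin.toℕ-cast (square-minus r) i)) (≡.trans
    (≡.cong toℕ (≡.trans (≡.sym (Fin.combine-remQuot {r} (suc r) (cast (square-minus r) i)))
      (≡.trans (≡.cong (λ (a , b) → combine a b) eq) (Fin.combine-remQuot {r} (suc r) (cast (square-minus r) j)))))
    (Fin.toℕ-cast (square-minus r) j)))

  pair-complete : ∀ a b → ∃[ i ] pair i ≡ (a , b)
  pair-complete a b = cast (≡.sym (square-minus r)) (combine a b) ,
    ≡.trans (≡.cong (remQuot (suc r)) (Fin.cast-involutive (square-minus r) (≡.sym (square-minus r)) (combine a b))) (Fin.remQuot-combine a b)

-- Polynomial identities with integer coefficients, proved by normalisation

infixl 6 _:+_ _:-_
infixl 7 _:*_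
infix  8 :-_
infix  4 _:=_

-- The expressions carry neither the ring nor the number of variables, which
-- keeps the elaborated identities small.
data Expr : Set where
  var            : ℕ → Expr
  con            : ℤ → Expr
  _:+_ _:*_ _:-_ : Expr → Expr → Expr
  :-_            : Expr → Expr

record Equation : Set where
  constructor _:=_
  field lhs rhs : Expr

Schema : ℕ → Set
Schema zero    = Equation
Schema (suc n) = Expr → Schema n

instantiate : ∀ n → ℕ → Schema n → Equation
instantiate zero    k f = f
instantiate (suc n) k f = instantiate n (suc k) (f (var k))

module IntegerSolver {c ℓ} (R : CommutativeRing c ℓ) where

  open CommutativeRing R hiding (zero)
  open AbelianGroupProperties +-abelianGroup using (⁻¹-∙-comm)
  open RingProperties ring
    using (-‿distribˡ-*; -‿distribʳ-*; -‿involutive; -0#≈0#)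
  open MultProperties semiring renaming (_×_ to _·_) using (1+×; ×-homo-+; ×1-homo-*)
  open SetoidReasoning setoid

  fromℤ : ℤ → Carrier
  fromℤ (+ n)    = n · 1#
  fromℤ -[1+ n ] = - (suc n · 1#)

  fromℤ-neg : ∀ i → fromℤ (ℤ.- i) ≈ - fromℤ i
  fromℤ-neg (+ zero)  = sym -0#≈0#
  fromℤ-neg (+ suc n) = refl
  fromℤ-neg -[1+ n ]  = sym (-‿involutive _)

  fromℤ-⊖ : ∀ m n → fromℤ (m ℤ.⊖ n) ≈ m · 1# - n · 1#
  fromℤ-⊖ m       zero    = sym (trans (+-congˡ -0#≈0#) (+-identityʳ _))
  fromℤ-⊖ zero    (suc n) = sym (+-identityˡ _)
  fromℤ-⊖ (suc m) (suc n) = begin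
    fromℤ (suc m ℤ.⊖ suc n)             ≡⟨ ≡.cong fromℤ (ℤ.[1+m]⊖[1+n]≡m⊖n m n) ⟩
    fromℤ (m ℤ.⊖ n)                     ≈⟨ fromℤ-⊖ m n ⟩
    m · 1# - n · 1#                     ≈⟨ +-congˡ (+-identityˡ _) ⟨
    m · 1# + (0# - n · 1#)              ≈⟨ +-congˡ (+-congʳ (-‿inverseʳ 1#)) ⟨
    m · 1# + (1# - 1# - n · 1#)         ≈⟨ +-congˡ (+-assoc _ _ _) ⟩
    m · 1# + (1# + (- 1# - n · 1#))     ≈⟨ +-assoc _ _ _ ⟨
    m · 1# + 1# + (- 1# - n · 1#)       ≈⟨ +-cong (+-comm _ _) (⁻¹-∙-comm _ _) ⟩
    1# + m · 1# - (1# + n · 1#)         ≈⟨ +-cong (1+× m 1#) (-‿cong (1+× n 1#)) ⟨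
    suc m · 1# - suc n · 1#             ∎

  fromℤ-+ : ∀ i j → fromℤ (i ℤ.+ j) ≈ fromℤ i + fromℤ j
  fromℤ-+ (+ m)    (+ n)    = ×-homo-+ 1# m n
  fromℤ-+ (+ m)    -[1+ n ] = fromℤ-⊖ m (suc n)
  fromℤ-+ -[1+ m ] (+ n)    = trans (fromℤ-⊖ n (suc m)) (+-comm _ _)
  fromℤ-+ -[1+ m ] -[1+ n ] = begin
    - (suc (suc (m ℕ.+ n)) · 1#)       ≡⟨ ≡.cong (λ k → - (k · 1#)) (≡.cong suc (ℕ.+-suc m n)) ⟨
    - ((suc m ℕ.+ suc n) · 1#)         ≈⟨ -‿cong (×-homo-+ 1# (suc m) (suc n)) ⟩
    - (suc m · 1# + suc n · 1#)        ≈⟨ ⁻¹-∙-comm _ _ ⟨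
    - (suc m · 1#) - suc n · 1#        ∎

  fromℤ-neg-◃ : ∀ n → fromℤ (Sign.- ℤ.◃ n) ≈ - (n · 1#)
  fromℤ-neg-◃ zero    = sym -0#≈0#
  fromℤ-neg-◃ (suc n) = refl

  fromℤ-* : ∀ i j → fromℤ (i ℤ.* j) ≈ fromℤ i * fromℤ j
  fromℤ-* (+ m)    (+ n)    = trans (reflexive (≡.cong fromℤ (ℤ.+◃n≡+n (m ℕ.* n)))) (×1-homo-* m n)
  fromℤ-* (+ m)    -[1+ n ] = begin
    fromℤ (Sign.- ℤ.◃ m ℕ.* suc n)  ≈⟨ fromℤ-neg-◃ (m ℕ.* suc n) ⟩
    - ((m ℕ.* suc n) · 1#)            ≈⟨ -‿cong (×1-homo-* m (suc n)) ⟩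
    - (m · 1# * (suc n · 1#))         ≈⟨ -‿distribʳ-* _ _ ⟩
    m · 1# * - (suc n · 1#)           ∎
  fromℤ-* -[1+ m ] (+ n)    = begin
    fromℤ (Sign.- ℤ.◃ suc m ℕ.* n)  ≈⟨ fromℤ-neg-◃ (suc m ℕ.* n) ⟩
    - ((suc m ℕ.* n) · 1#)            ≈⟨ -‿cong (×1-homo-* (suc m) n) ⟩
    - (suc m · 1# * (n · 1#))         ≈⟨ -‿distribˡ-* _ _ ⟩
    - (suc m · 1#) * (n · 1#)         ∎
  fromℤ-* -[1+ m ] -[1+ n ] = begin
    (suc m ℕ.* suc n) · 1#            ≈⟨ ×1-homo-* (suc m) (suc n) ⟩
    suc m · 1# * (suc n · 1#)         ≈⟨ -‿involutive _ ⟨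
    - - (suc m · 1# * (suc n · 1#))   ≈⟨ -‿cong (-‿distribʳ-* _ _) ⟩
    - (suc m · 1# * - (suc n · 1#))   ≈⟨ -‿distribˡ-* _ _ ⟩
    - (suc m · 1#) * - (suc n · 1#)   ∎

  morphism : ℤ.+-*-rawRing -Raw-AlmostCommutative⟶ fromCommutativeRing R
  morphism = record
    { ⟦_⟧    = fromℤ
    ; +-homo = fromℤ-+
    ; *-homo = fromℤ-*
    ; -‿homo = fromℤ-neg
    ; 0-homo = refl
    ; 1-homo = refl
    }

  private
    module S = RingSolver ℤ.+-*-rawRing (fromCommutativeRing R) morphism
      (λ i j → map (λ i≡j → reflexive (≡.cong fromℤ i≡j)) (dec⇒maybe (i ℤ.≟ j)))

  lookup : ∀ {n} → Vec Carrier n → ℕ → Carrier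
  -- An index outside the environment reads as zero. `polynomial` makes the same choice, so
  -- `polynomial-correct` needs no scoping condition.
  lookup Vec.[]      i       = 0#
  lookup (x Vec.∷ ρ) zero    = x
  lookup (x Vec.∷ ρ) (suc i) = lookup ρ i

  eval : ∀ {n} → Vec Carrier n → Expr → Carrier
  eval ρ (var i)  = lookup ρ i
  eval ρ (con i)  = fromℤ i
  eval ρ (e :+ f) = eval ρ e + eval ρ f
  eval ρ (e :* f) = eval ρ e * eval ρ f
  eval ρ (e :- f) = eval ρ e - eval ρ f
  eval ρ (:- e)   = - eval ρ e

  index : ∀ n → ℕ → Maybe (Fin n)
  index zero    i       = nothing
  index (suc n) zero    = just zero
  index (suc n) (suc i) = map suc (index n i)

  polynomial : ∀ n → Expr → S.Polynomial n
  polynomial n (var i)  = maybe′ S.var (S.con (+ 0)) (index n i)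
  polynomial n (con i)  = S.con i
  polynomial n (e :+ f) = polynomial n e S.:+ polynomial n f
  polynomial n (e :* f) = polynomial n e S.:* polynomial n f
  polynomial n (e :- f) = polynomial n e S.:- polynomial n f
  polynomial n (:- e)   = S.:- polynomial n e

  polynomial-correct : ∀ {n} (ρ : Vec Carrier n) e → S.⟦ polynomial n e ⟧ ρ ≡ eval ρ e
  polynomial-correct ρ (var i)  = variable-correct ρ i
    where
    variable-correct : ∀ {n} (ρ : Vec Carrier n) i → S.⟦ maybe′ S.var (S.con (+ 0)) (index n i) ⟧ ρ ≡ lookup ρ i
    variable-correct Vec.[]      i       = ≡.refl
    variable-correct (x Vec.∷ ρ) zero    = ≡.refl
    variable-correct {suc n} (x Vec.∷ ρ) (suc i) with index n i | variable-correct ρ i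
    ... | just _  | eq = eq
    ... | nothing | eq = eq
  polynomial-correct ρ (con i)  = ≡.refl
  polynomial-correct ρ (e :+ f) = ≡.cong₂ _+_ (polynomial-correct ρ e) (polynomial-correct ρ f)
  polynomial-correct ρ (e :* f) = ≡.cong₂ _*_ (polynomial-correct ρ e) (polynomial-correct ρ f)
  polynomial-correct ρ (e :- f) = ≡.cong₂ _-_ (polynomial-correct ρ e) (polynomial-correct ρ f)
  polynomial-correct ρ (:- e)   = ≡.cong -_ (polynomial-correct ρ e)

  level : ℕ → Level
  level zero    = ℓ
  level (suc n) = c ⊔ level n

  Closure : ∀ n → (Vec Carrier n → Set ℓ) → Set (level n)
  Closure zero    P = P Vec.[]
  Closure (suc n) P = ∀ x → Closure n (λ ρ → P (x Vec.∷ ρ))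

  close : ∀ n {P : Vec Carrier n → Set ℓ} → (∀ ρ → P ρ) → Closure n P
  close zero    p = p Vec.[]
  close (suc n) p = λ x → close n (λ ρ → p (x Vec.∷ ρ))

  -- The premise compares two normal forms with integer coefficients, so it holds by computation and
  -- is given as `≡.refl`. `Closure` makes the result a function of the variables one at a time.
  solve : ∀ n (f : Schema n) → let l := r = instantiate n 0 f in
    S.normalise (polynomial n l) ≡ S.normalise (polynomial n r) → Closure n (λ ρ → eval ρ l ≈ eval ρ r)
  solve n f eq = let l := r = instantiate n 0 f in close n λ ρ → begin
    eval ρ l                                  ≡⟨ polynomial-correct ρ l ⟨
    S.⟦ polynomial n l ⟧ ρ                    ≈⟨ S.correct (polynomial n l) ρ ⟨
    S.⟦ S.normalise (polynomial n l) ⟧N ρ     ≡⟨ ≡.cong (λ p → S.⟦ p ⟧N ρ) eq ⟩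
    S.⟦ S.normalise (polynomial n r) ⟧N ρ     ≈⟨ S.correct (polynomial n r) ρ ⟩
    S.⟦ polynomial n r ⟧ ρ                    ≡⟨ polynomial-correct ρ r ⟩
    eval ρ r                                  ∎

-- Arithmetic of a finite field

module FiniteField
  {c ℓ₁ ℓ₂} (K : HeytingField c ℓ₁ ℓ₂) {q : ℕ} (4≤q : 4 ≤ q)
  (order : Geometry.HasOrder K q) where

  open HeytingField K using (Carrier; _≈_; _#_; heytingCommutativeRing; #⇒invertible; tight) public
  open CommutativeRing (HeytingCommutativeRing.commutativeRing heytingCommutativeRing) public
    hiding (Carrier; _≈_; zero)
  open HeytingProperties heytingCommutativeRing using (1#0; x-0≈x; invertibleˡ⇒#) public
  open IntegerSolver (HeytingCommutativeRing.commutativeRing heytingCommutativeRing) public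
    using (solve)
  open Inverse order public
    using () renaming (to to code; from to element; to-cong to code-cong;
                       strictlyInverseˡ to code-element; strictlyInverseʳ to element-code)
  open Geometry K public
  open SemiringSum semiring using (sum; *-distribˡ-sum)
  open CommutativeMonoidSum +-commutativeMonoid using (sum-cong-≋; ∑-comm; sum-remove)
  open SetoidReasoning setoid

  infix 4 _≟_

  code-injective : ∀ {x y} → code x ≡ code y → x ≈ y
  code-injective {x} {y} eq =
    trans (sym (element-code x)) (trans (reflexive (≡.cong element eq)) (element-code y))

  element-injective : ∀ {i j} → element i ≈ element j → i ≡ j
  element-injective {i} {j} eq =
    ≡.trans (≡.sym (code-element i)) (≡.trans (code-cong eq) (code-element j))

  _≟_ : ∀ x y → Dec (x ≈ y)
  x ≟ y = map′ code-injective code-cong (code x Fin.≟ code y)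

  1≉0 : 1# ≉ 0#
  1≉0 1≈0 = proj₂ (tight _ _) 1≈0 1#0

  cancelˡ : ∀ {x y} → x ≉ 0# → x * y ≈ 0# → y ≈ 0#
  cancelˡ {x} {y} x≉0 xy≈0 = proj₁ (tight _ _) λ y#0 →
    let z , _ , yz≈1 = #⇒invertible y#0 in x≉0 (begin
      x                  ≈⟨ *-identityʳ x ⟨
      x * 1#             ≈⟨ *-congˡ yz≈1 ⟨
      x * ((y - 0#) * z) ≈⟨ *-congˡ (*-congʳ (x-0≈x y)) ⟩
      x * (y * z)        ≈⟨ *-assoc x y z ⟨
      x * y * z          ≈⟨ *-congʳ xy≈0 ⟩
      0# * z             ≈⟨ zeroˡ z ⟩
      0#                 ∎)

  *≉0 : ∀ {x y} → x ≉ 0# → y ≉ 0# → x * y ≉ 0#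
  *≉0 x≉0 y≉0 xy≈0 = y≉0 (cancelˡ x≉0 xy≈0)

  x≈y⇒x-y≈0 : ∀ {x y} → x ≈ y → x - y ≈ 0#
  x≈y⇒x-y≈0 {x} {y} x≈y = trans (+-congʳ x≈y) (-‿inverseʳ y)

  x-y≈0⇒x≈y : ∀ {x y} → x - y ≈ 0# → x ≈ y
  x-y≈0⇒x≈y {x} {y} eq = begin
    x           ≈⟨ solve 2 (λ x y → x := x :- y :+ y) ≡.refl x y ⟩
    x - y + y   ≈⟨ +-congʳ eq ⟩
    0# + y      ≈⟨ +-identityˡ y ⟩
    y           ∎

  x≉y⇒x-y≉0 : ∀ {x y} → x ≉ y → x - y ≉ 0#
  x≉y⇒x-y≉0 x≉y eq = x≉y (x-y≈0⇒x≈y eq)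

  -- `by₁` to `by₄` express ideal membership: an identity, usually from `solve`, writes a quantity
  -- as a combination of others, and these are then known to vanish. Most of the algebra consists of
  -- such certificates.
  by₁ : ∀ {x k e} → x ≈ k * e → e ≈ 0# → x ≈ 0#
  by₁ {k = k} eq e≈0 = trans eq (trans (*-congˡ e≈0) (zeroʳ k))

  by₂ : ∀ {x k₁ e₁ k₂ e₂} → x ≈ k₁ * e₁ + k₂ * e₂ → e₁ ≈ 0# → e₂ ≈ 0# → x ≈ 0#
  by₂ eq e₁≈0 e₂≈0 = trans eq (trans (+-cong (by₁ refl e₁≈0) (by₁ refl e₂≈0)) (+-identityˡ 0#))

  by₃ : ∀ {x k₁ e₁ k₂ e₂ k₃ e₃} → x ≈ k₁ * e₁ + k₂ * e₂ + k₃ * e₃ →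
    e₁ ≈ 0# → e₂ ≈ 0# → e₃ ≈ 0# → x ≈ 0#
  by₃ eq e₁≈0 e₂≈0 e₃≈0 = trans eq (trans (+-cong (by₂ refl e₁≈0 e₂≈0) (by₁ refl e₃≈0)) (+-identityˡ 0#))

  by₄ : ∀ {x k₁ e₁ k₂ e₂ k₃ e₃ k₄ e₄} → x ≈ k₁ * e₁ + k₂ * e₂ + k₃ * e₃ + k₄ * e₄ →
    e₁ ≈ 0# → e₂ ≈ 0# → e₃ ≈ 0# → e₄ ≈ 0# → x ≈ 0#
  by₄ eq e₁≈0 e₂≈0 e₃≈0 e₄≈0 = trans eq (trans (+-cong (by₃ refl e₁≈0 e₂≈0 e₃≈0) (by₁ refl e₄≈0)) (+-identityˡ 0#))

  -- Multiplication by `x` is injective on a finite set, hence onto, so it reaches `1#`. The field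
  -- axioms invert only elements apart from zero; `≉0⇒#0` recovers apartness from this inverse.
  inverse : ∀ {x} → x ≉ 0# → ∃[ y ] x * y ≈ 1#
  inverse {x} x≉0 =
    let i , eq = injective⇒surjective mult-inj (code 1#) in element i , code-injective eq
    where
    mult-inj : Injective _≡_ _≡_ (λ i → code (x * element i))
    mult-inj {i} {j} eq = element-injective (x-y≈0⇒x≈y (cancelˡ x≉0 (begin
      x * (element i - element j)      ≈⟨ solve 3 (λ x u v → x :* (u :- v) := x :* u :- x :* v) ≡.refl x _ _ ⟩
      x * element i - x * element j    ≈⟨ x≈y⇒x-y≈0 (code-injective eq) ⟩
      0#                               ∎)))

  ≉0⇒#0 : ∀ {x} → x ≉ 0# → x # 0#
  ≉0⇒#0 {x} x≉0 = let y , xy≈1 = inverse x≉0 in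
    invertibleˡ⇒# (y , trans (*-congˡ (x-0≈x x)) (trans (*-comm y x) xy≈1))

  missedValue : (f : Carrier → Carrier) → (∀ {x y} → x ≈ y → f x ≈ f y) →
    ∀ {a b} → a ≉ b → f a ≈ f b → ∃[ v ] (∀ x → f x ≉ v)
  missedValue f f-cong {a} {b} a≉b fa≈fb =
    let v , missed = collision⇒missed (code ∘ f ∘ element) (a≉b ∘ code-injective)
                       (code-cong (trans (f-cong (element-code a)) (trans fa≈fb (sym (f-cong (element-code b))))))
    in element v , λ x fx≈v → missed (code x)
         (≡.trans (code-cong (trans (f-cong (element-code x)) fx≈v)) (code-element v))

  avoid : ∀ {k} → k < q → (l : Vector Carrier k) → ∃[ x ] (∀ i → x ≉ l i)
  avoid {k} k<q l =
    let v , new = ¬∀⟶∃¬ q _ (λ v → any? (λ i → element v ≟ l i)) ¬covered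
    in element v , λ i eq → new (i , eq)
    where
    ¬covered : ¬ (∀ v → ∃[ i ] element v ≈ l i)
    ¬covered cover = ℕ.<⇒≱ k<q (injective⇒≤ {f = proj₁ ∘ cover} (λ {v} {w} eq →
      element-injective (trans (proj₂ (cover v))
        (trans (reflexive (≡.cong l eq)) (sym (proj₂ (cover w)))))))

  -- Linear algebra

  Nonzero : ∀ {n} → Vector Carrier n → Set ℓ₁
  Nonzero a = ∃[ i ] a i ≉ 0#

  dot : ∀ {n} → Vector Carrier n → Vector Carrier n → Carrier
  dot a v = sum (λ j → a j * v j)

  dot-cong : ∀ {n} {a b v w : Vector Carrier n} → a ≋ b → v ≋ w → dot a v ≈ dot b w
  dot-cong a≋b v≋w = sum-cong-≋ (λ j → *-cong (a≋b j) (v≋w j))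

  dot-comm : ∀ {n} (a v : Vector Carrier n) → dot a v ≈ dot v a
  dot-comm a v = sum-cong-≋ (λ j → *-comm (a j) (v j))

  dot-zero : ∀ {n} (a v : Vector Carrier n) → (∀ i → a i * v i ≈ 0#) → dot a v ≈ 0#
  dot-zero {zero}  a v av≈0 = refl
  dot-zero {suc n} a v av≈0 =
    trans (+-cong (av≈0 zero) (dot-zero (tail a) (tail v) (av≈0 ∘ suc))) (+-identityˡ 0#)

  dot-zeroʳ : ∀ {n} (a : Vector Carrier n) {v} → v ≋ 𝟎 → dot a v ≈ 0#
  dot-zeroʳ a {v} v≋0 = dot-zero a v (λ i → trans (*-congˡ (v≋0 i)) (zeroʳ (a i)))

  dot-zeroˡ : ∀ {n} {a : Vector Carrier n} v → a ≋ 𝟎 → dot a v ≈ 0#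
  dot-zeroˡ {a = a} v a≋0 = dot-zero a v (λ i → trans (*-congʳ (a≋0 i)) (zeroˡ (v i)))

  dot-subˡ : ∀ {n} (a b v : Vector Carrier n) → dot (λ i → a i - b i) v ≈ dot a v - dot b v
  dot-subˡ {zero}  a b v = solve 0 (con (+ 0) := con (+ 0) :- con (+ 0)) ≡.refl
  dot-subˡ {suc n} a b v = trans (+-congˡ (dot-subˡ (tail a) (tail b) (tail v)))
    (solve 5 (λ a b v s t → (a :- b) :* v :+ (s :- t) := a :* v :+ s :- (b :* v :+ t)) ≡.refl _ _ _ _ _)

  dot-scaleˡ : ∀ {n} k (a v : Vector Carrier n) → dot (k • a) v ≈ k * dot a v
  dot-scaleˡ {zero}  k a v = sym (zeroʳ k)
  dot-scaleˡ {suc n} k a v = trans (+-congˡ (dot-scaleˡ k (tail a) (tail v)))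
    (solve 4 (λ k a v s → k :* a :* v :+ k :* s := k :* (a :* v :+ s)) ≡.refl _ _ _ _)

  dot-single : ∀ {n} (a v : Vector Carrier n) k → (∀ i → i ≢ k → a i * v i ≈ 0#) → dot a v ≈ a k * v k
  dot-single {suc n} a v k others = begin
    dot a v                                                   ≈⟨ sum-remove {i = k} (λ j → a j * v j) ⟩
    a k * v k + sum (λ j → a (punchIn k j) * v (punchIn k j)) ≈⟨ +-congˡ (sum-cong-≋ rest≋0) ⟩
    a k * v k + sum (λ (j : Fin n) → 0# * 0#)                 ≈⟨ +-congˡ (dot-zeroʳ {n} 𝟎 (λ _ → refl)) ⟩
    a k * v k + 0#                                            ≈⟨ +-identityʳ _ ⟩
    a k * v k                                                 ∎
    where
    rest≋0 : ∀ j → a (punchIn k j) * v (punchIn k j) ≈ 0# * 0#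
    rest≋0 j = trans (others _ (punchInᵢ≢i k j)) (sym (zeroˡ 0#))

  dot-combination : ∀ {m n} (l : Vector Carrier n) a (v : Vector (Vector Carrier n) m) →
    dot l (combination a v) ≈ dot a (λ i → dot l (v i))
  dot-combination l a v = begin
    sum (λ j → l j * sum (λ i → a i * v i j))     ≈⟨ sum-cong-≋ (λ j → *-distribˡ-sum (l j) (λ i → a i * v i j)) ⟩
    sum (λ j → sum (λ i → l j * (a i * v i j)))   ≈⟨ ∑-comm (λ j i → l j * (a i * v i j)) ⟩
    sum (λ i → sum (λ j → l j * (a i * v i j)))   ≈⟨ sum-cong-≋ (λ i → sum-cong-≋ (λ j →
        solve 3 (λ l a v → l :* (a :* v) := a :* (l :* v)) ≡.refl (l j) (a i) (v i j))) ⟩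
    sum (λ i → sum (λ j → a i * (l j * v i j)))   ≈⟨ sum-cong-≋ (λ i → *-distribˡ-sum (a i) (λ j → l j * v i j)) ⟨
    sum (λ i → a i * sum (λ j → l j * v i j))     ∎

  combination-combination : ∀ {k m n} (a : Vector Carrier m) {v : Vector (Vector Carrier n) m}
    (B : Vector (Vector Carrier k) m) (w : Vector (Vector Carrier n) k) →
    (∀ i → v i ≋ combination (B i) w) → combination a v ≋ combination (combination a B) w
  combination-combination a {v} B w v≋ j = begin
    dot a (λ i → v i j)                        ≈⟨ dot-cong (λ _ → refl) (λ i → trans (v≋ i j) (dot-comm (B i) (λ k → w k j))) ⟩
    dot a (λ i → dot (λ k → w k j) (B i))      ≈⟨ dot-combination (λ k → w k j) a B ⟨
    dot (λ k → w k j) (combination a B)        ≈⟨ dot-comm (λ k → w k j) (combination a B) ⟩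
    dot (combination a B) (λ k → w k j)        ∎

  combination-cong : ∀ {m n} {a b} {v w : Vector (Vector Carrier n) m} →
    a ≋ b → (∀ i → v i ≋ w i) → combination a v ≋ combination b w
  combination-cong a≋b v≋w j = dot-cong a≋b (λ i → v≋w i j)

  -- Counting replaces elimination: `q ^ m` coefficient vectors have at most `q ^ n` values, so two
  -- of them give the same combination, and their difference is a relation.
  dependent : ∀ {m n} → n < m → (v : Vector (Vector Carrier n) m) →
    ∃[ a ] (Nonzero a × combination a v ≋ 𝟎)
  dependent {m} {n} n<m v =
    let k , l , k<l , same = pigeonhole (ℕ.^-monoʳ-< q (ℕ.≤-trans (s≤s (s≤s ℕ.z≤n)) 4≤q) n<m)
                               (λ k → funToFin (code ∘ combination (decode k) v))
        a = λ i → decode k i - decode l i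
        i , a≉0 = ¬∀⟶∃¬ m _ (λ i → a i ≟ 0#) (λ a≋0 → Fin.<⇒≢ k<l (decode-injective (x-y≈0⇒x≈y ∘ a≋0)))
    in a , (i , a≉0) , λ j →
         trans (dot-subˡ (decode k) (decode l) (λ i → v i j)) (x≈y⇒x-y≈0 (encode-injective same j))
    where
    decode : Fin (q ^ m) → Vector Carrier m
    decode k = element ∘ finToFun k

    encode-injective : ∀ {u w : Vector Carrier n} →
      funToFin (code ∘ u) ≡ funToFin (code ∘ w) → u ≋ w
    encode-injective {u} {w} eq j = code-injective (≡.trans (≡.sym (finToFun-funToFin (code ∘ u) j))
      (≡.trans (≡.cong (λ k → finToFun k j) eq) (finToFun-funToFin (code ∘ w) j)))

    funToFin-cong : ∀ {m n} {f g : Fin m → Fin n} → (∀ i → f i ≡ g i) → funToFin f ≡ funToFin g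
    funToFin-cong {zero}  f≗g = ≡.refl
    funToFin-cong {suc m} f≗g = ≡.cong₂ combine (f≗g zero) (funToFin-cong (f≗g ∘ suc))

    decode-injective : ∀ {k l} → decode k ≋ decode l → k ≡ l
    decode-injective {k} {l} eq = ≡.trans (≡.sym (funToFin-finToFin {m} {q} k))
      (≡.trans (funToFin-cong (element-injective ∘ eq)) (funToFin-finToFin {m} {q} l))

  -- A linear form killing all `v i` is a relation among the columns of the matrix `v`, which
  -- outnumber its rows.
  annihilator : ∀ {m n} → m < n → (v : Vector (Vector Carrier n) m) →
    ∃[ l ] (Nonzero l × ∀ i → dot l (v i) ≈ 0#)
  annihilator m<n v = dependent m<n (λ j i → v i j)

  span-dependent : ∀ {k m n} → k < m → (w : Vector (Vector Carrier n) k) (v : Vector (Vector Carrier n) m) →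
    (∀ i → InSpan w (v i)) → ∃[ a ] (Nonzero a × combination a v ≋ 𝟎)
  span-dependent k<m w v inSpan =
    let B = proj₁ ∘ inSpan
        a , a≉0 , aB≋0 = dependent k<m B
    in a , a≉0 , λ j → trans (combination-combination a B w (proj₂ ∘ inSpan) j)
                             (dot-zeroˡ (λ k → w k j) aB≋0)

  isolate : ∀ {m n} a (w : Vector Carrier n) (v : Vector (Vector Carrier n) m) →
    combination a (w ∷ v) ≋ 𝟎 → head a ≉ 0# → InSpan v w
  isolate a w v eq a₀≉0 = let r , ar≈1 = inverse a₀≉0 in
    (- r) • tail a , λ j → begin
      w j                                                     ≈⟨ *-identityˡ _ ⟨
      1# * w j                                                ≈⟨ *-congʳ ar≈1 ⟨
      head a * r * w j                                        ≈⟨ solve 4 (λ a r w s → a :* r :* w := :- r :* s :+ r :* (a :* w :+ s)) ≡.refl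
                                                                   (head a) r (w j) (combination (tail a) v j) ⟩
      - r * combination (tail a) v j + r * combination a (w ∷ v) j  ≈⟨ +-cong (sym (dot-scaleˡ (- r) (tail a) (λ i → v i j))) (*-congˡ (eq j)) ⟩
      combination ((- r) • tail a) v j + r * 0#               ≈⟨ solve 2 (λ s r → s :+ r :* con (+ 0) := s) ≡.refl _ r ⟩
      combination ((- r) • tail a) v j                        ∎

  tail-relation : ∀ {m n} a (w : Vector Carrier n) (v : Vector (Vector Carrier n) m) →
    combination a (w ∷ v) ≋ 𝟎 → head a ≈ 0# → combination (tail a) v ≋ 𝟎
  tail-relation a w v eq a₀≈0 j = begin
    combination (tail a) v j                    ≈⟨ solve 2 (λ w s → s := con (+ 0) :* w :+ s) ≡.refl (w j) _ ⟩
    0# * w j + combination (tail a) v j         ≈⟨ +-congʳ (*-congʳ a₀≈0) ⟨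
    head a * w j + combination (tail a) v j     ≈⟨ eq j ⟩
    0#                                          ∎

  independent-cong : ∀ {m n} (v w : Vector (Vector Carrier n) m) → (∀ i → v i ≋ w i) →
    LinearlyIndependent v → LinearlyIndependent w
  independent-cong v w v≋w ind a aw≋0 = ind a (λ j → trans (combination-cong {a = a} {a} {v} {w} (λ _ → refl) v≋w j) (aw≋0 j))

  independent-∷ : ∀ {m n} (w : Vector Carrier n) (v : Vector (Vector Carrier n) m) →
    LinearlyIndependent v → ¬ InSpan v w → LinearlyIndependent (w ∷ v)
  independent-∷ w v ind w∉v a eq with head a ≟ 0#
  ... | no a₀≉0  = contradiction (isolate a w v eq a₀≉0) w∉v
  ... | yes a₀≈0 = λ where
    zero    → a₀≈0
    (suc i) → ind (tail a) (tail-relation a w v eq a₀≈0) i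

  basis-spans : ∀ {n} {v : Vector (Vector Carrier n) n} → LinearlyIndependent v → ∀ w → InSpan v w
  basis-spans {n} {v} ind w =
    let a , (i , aᵢ≉0) , eq = dependent (ℕ.n<1+n n) (w ∷ v)
        a₀≉0 = λ a₀≈0 → aᵢ≉0 (all-zero a eq a₀≈0 i)
    in isolate a w v eq a₀≉0
    where
    all-zero : ∀ a → combination a (w ∷ v) ≋ 𝟎 → head a ≈ 0# → a ≋ 𝟎
    all-zero a eq a₀≈0 zero    = a₀≈0
    all-zero a eq a₀≈0 (suc i) = ind (tail a) (tail-relation a w v eq a₀≈0) i

  annihilates-span : ∀ {m n} (l : Vector Carrier n) {v : Vector (Vector Carrier n) m} →
    (∀ i → dot l (v i) ≈ 0#) → ∀ {w} → InSpan v w → dot l w ≈ 0#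
  annihilates-span l {v} lv≈0 {w} (a , w≋) = begin
    dot l w                     ≈⟨ dot-cong {a = l} {l} (λ _ → refl) w≋ ⟩
    dot l (combination a v)     ≈⟨ dot-combination l a v ⟩
    dot a (λ i → dot l (v i))   ≈⟨ dot-zeroʳ a lv≈0 ⟩
    0#                          ∎

  unit : ∀ {n} → Fin n → Vector Carrier n
  unit k i with i Fin.≟ k
  ... | yes _ = 1#
  ... | no _  = 0#

  recurrence-dot : ∀ c₂ c₁ c₀ m₃ m₂ m₁ m₀ →
    m₃ + c₂ * m₂ + c₁ * m₁ + c₀ * m₀ ≈ dot (1# ∷ c₂ ∷ c₁ ∷ c₀ ∷ []) (m₃ ∷ m₂ ∷ m₁ ∷ m₀ ∷ [])
  recurrence-dot = solve 7 (λ c₂ c₁ c₀ m₃ m₂ m₁ m₀ → m₃ :+ c₂ :* m₂ :+ c₁ :* m₁ :+ c₀ :* m₀ :=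
    con (+ 1) :* m₃ :+ (c₂ :* m₂ :+ (c₁ :* m₁ :+ (c₀ :* m₀ :+ con (+ 0))))) ≡.refl

  dot-unit : ∀ {n} (l : Vector Carrier n) k → dot l (unit k) ≈ l k
  dot-unit l k = trans (dot-single l (unit k) k off-diagonal) diagonal
    where
    off-diagonal : ∀ i → i ≢ k → l i * unit k i ≈ 0#
    off-diagonal i i≢k with i Fin.≟ k
    ... | yes i≡k = contradiction i≡k i≢k
    ... | no _    = zeroʳ _

    diagonal : l k * unit k k ≈ l k
    diagonal with k Fin.≟ k
    ... | yes _  = *-identityʳ _
    ... | no k≢k = contradiction ≡.refl k≢k

  annihilates-basis : ∀ {n} {v : Vector (Vector Carrier n) n} → LinearlyIndependent v →
    ∀ {l} → (∀ i → dot l (v i) ≈ 0#) → l ≋ 𝟎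
  annihilates-basis {v = v} ind {l} lv≈0 k =
    trans (sym (dot-unit l k)) (annihilates-span l {v = v} lv≈0 (basis-spans ind (unit k)))

  -- A nonzero form that kills the chosen vectors cannot kill all of `f`, by `total`; a vector that
  -- it does not kill lies outside their span.
  extend-independent : ∀ {N k n} (f : Vector (Vector Carrier n) N) → (∀ l → (∀ i → dot l (f i) ≈ 0#) → l ≋ 𝟎) →
    k < n → (ι : Vector (Fin N) k) → LinearlyIndependent (f ∘ ι) →
    ∃[ i ] LinearlyIndependent (f ∘ (i ∷ ι))
  extend-independent {N} f total k<n ι ind =
    let l , (j , lⱼ≉0) , lι≈0 = annihilator k<n (f ∘ ι)
        i , lfᵢ≉0 = ¬∀⟶∃¬ N _ (λ i → dot l (f i) ≟ 0#) (λ lf≈0 → lⱼ≉0 (total l lf≈0 j))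
        new = λ inSpan → lfᵢ≉0 (annihilates-span l {v = f ∘ ι} lι≈0 inSpan)
    in i , independent-cong (f i ∷ f ∘ ι) (f ∘ (i ∷ ι)) (λ where zero _ → refl ; (suc _) _ → refl)
         (independent-∷ (f i) (f ∘ ι) ind new)

  -- Quadratic forms in four variables

  infixl 6 _⊕_
  _⊕_ : ∀ {n} → Vector Carrier n → Vector Carrier n → Vector Carrier n
  (x ⊕ y) j = x j + y j

  record Linear (f : Vector Carrier 4 → Carrier) : Set (c ⊔ ℓ₁) where
    field
      cong-lin : ∀ {x y} → x ≋ y → f x ≈ f y
      additive : ∀ x y → f (x ⊕ y) ≈ f x + f y
      on-combination : ∀ u (v : Vector (Vector Carrier 4) 4) → f (combination u v) ≈ dot u (f ∘ v)

  open Linear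

  coordinate : ∀ j → Linear (λ x → x j)
  coordinate j = record { cong-lin = λ x≋y → x≋y j ; additive = λ _ _ → refl ; on-combination = λ _ _ → refl }

  dot-⊕ : ∀ {n} (l x y : Vector Carrier n) → dot l (x ⊕ y) ≈ dot l x + dot l y
  dot-⊕ {zero}  l x y = sym (+-identityˡ 0#)
  dot-⊕ {suc n} l x y = trans (+-congˡ (dot-⊕ (tail l) (tail x) (tail y)))
    (solve 5 (λ l x y s t → l :* (x :+ y) :+ (s :+ t) := l :* x :+ s :+ (l :* y :+ t)) ≡.refl _ _ _ _ _)

  dot-is-linear : ∀ l → Linear (dot l)
  dot-is-linear l = record
    { cong-lin = dot-cong {a = l} (λ _ → refl) ; additive = dot-⊕ l ; on-combination = dot-combination l }

  infixl 6 _+ₗ_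
  _+ₗ_ : ∀ {f g} → Linear f → Linear g → Linear (λ x → f x + g x)
  _+ₗ_ {f} {g} F G = record
    { cong-lin       = λ x≋y → +-cong (cong-lin F x≋y) (cong-lin G x≋y)
    ; additive       = λ x y → trans (+-cong (additive F x y) (additive G x y))
        (solve 4 (λ a b c d → a :+ b :+ (c :+ d) := a :+ c :+ (b :+ d)) ≡.refl _ _ _ _)
    ; on-combination = λ u v → trans (+-cong (on-combination F u v) (on-combination G u v))
        (sym (dot-⊕ u (f ∘ v) (g ∘ v)))
    }

  infixr 7 _*ₗ_
  _*ₗ_ : ∀ k {f} → Linear f → Linear (λ x → k * f x)
  _*ₗ_ k {f} F = record
    { cong-lin       = λ x≋y → *-congˡ (cong-lin F x≋y)
    ; additive       = λ x y → trans (*-congˡ (additive F x y)) (distribˡ k _ _)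
    ; on-combination = λ u v → trans (*-congˡ (on-combination F u v))
        (trans (*-congˡ (dot-comm u (f ∘ v))) (trans (sym (dot-scaleˡ k (f ∘ v) u)) (dot-comm (k • (f ∘ v)) u)))
    }

  -- A quadratic form in four variables has ten coefficients, determined in every characteristic by
  -- its values at a basis and at the pairwise sums of the basis. `weights` results from writing
  -- each polar term as G(vᵢ + vⱼ) - G(vᵢ) - G(vⱼ).
  nodes : Vector (Vector Carrier 4) 4 → Vector (Vector Carrier 4) 10
  nodes v = v 0F ∷ v 1F ∷ v 2F ∷ v 3F ∷ v 0F ⊕ v 1F ∷ v 0F ⊕ v 2F ∷ v 0F ⊕ v 3F ∷
            v 1F ⊕ v 2F ∷ v 1F ⊕ v 3F ∷ v 2F ⊕ v 3F ∷ []

  weights : Vector Carrier 4 → Vector Carrier 10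
  weights u =
    u 0F * (u 0F - u 1F - u 2F - u 3F) ∷ u 1F * (u 1F - u 0F - u 2F - u 3F) ∷
    u 2F * (u 2F - u 0F - u 1F - u 3F) ∷ u 3F * (u 3F - u 0F - u 1F - u 2F) ∷
    u 0F * u 1F ∷ u 0F * u 2F ∷ u 0F * u 3F ∷ u 1F * u 2F ∷ u 1F * u 3F ∷ u 2F * u 3F ∷ []

  -- Being a quadratic form is expressed by interpolation, which needs no division by 2.
  record Quadratic (G : Vector Carrier 4 → Carrier) : Set (c ⊔ ℓ₁) where
    field
      cong-quad   : ∀ {x y} → x ≋ y → G x ≈ G y
      interpolate : ∀ u v → G (combination u v) ≈ dot (weights u) (G ∘ nodes v)

  open Quadratic

  infixr 7 _*₂_
  _*₂_ : ∀ {f g} → Linear f → Linear g → Quadratic (λ x → f x * g x)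
  _*₂_ {f} {g} F G = record
    { cong-quad   = λ x≋y → *-cong (cong-lin F x≋y) (cong-lin G x≋y)
    ; interpolate = λ u v → begin
        f (combination u v) * g (combination u v)
          ≈⟨ *-cong (on-combination F u v) (on-combination G u v) ⟩
        dot u (f ∘ v) * dot u (g ∘ v)
          ≈⟨ solve 12 (λ u₀ u₁ u₂ u₃ f₀ f₁ f₂ f₃ g₀ g₁ g₂ g₃ →
               (u₀ :* f₀ :+ (u₁ :* f₁ :+ (u₂ :* f₂ :+ (u₃ :* f₃ :+ con (+ 0)))))
               :* (u₀ :* g₀ :+ (u₁ :* g₁ :+ (u₂ :* g₂ :+ (u₃ :* g₃ :+ con (+ 0))))) :=
               u₀ :* (u₀ :- u₁ :- u₂ :- u₃) :* (f₀ :* g₀) :+ (u₁ :* (u₁ :- u₀ :- u₂ :- u₃) :* (f₁ :* g₁) :+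
               (u₂ :* (u₂ :- u₀ :- u₁ :- u₃) :* (f₂ :* g₂) :+ (u₃ :* (u₃ :- u₀ :- u₁ :- u₂) :* (f₃ :* g₃) :+
               (u₀ :* u₁ :* ((f₀ :+ f₁) :* (g₀ :+ g₁)) :+ (u₀ :* u₂ :* ((f₀ :+ f₂) :* (g₀ :+ g₂)) :+
               (u₀ :* u₃ :* ((f₀ :+ f₃) :* (g₀ :+ g₃)) :+ (u₁ :* u₂ :* ((f₁ :+ f₂) :* (g₁ :+ g₂)) :+
               (u₁ :* u₃ :* ((f₁ :+ f₃) :* (g₁ :+ g₃)) :+ (u₂ :* u₃ :* ((f₂ :+ f₃) :* (g₂ :+ g₃)) :+ con (+ 0)))))))))))
             ≡.refl (u 0F) (u 1F) (u 2F) (u 3F) (f (v 0F)) (f (v 1F)) (f (v 2F)) (f (v 3F))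
                  (g (v 0F)) (g (v 1F)) (g (v 2F)) (g (v 3F)) ⟩
        dot (weights u) (expanded v)
          ≈⟨ dot-cong {a = weights u} (λ _ → refl) (values v) ⟨
        dot (weights u) (λ r → f (nodes v r) * g (nodes v r)) ∎
    }
    where
    pair : ∀ x y → f (x ⊕ y) * g (x ⊕ y) ≈ (f x + f y) * (g x + g y)
    pair x y = *-cong (additive F x y) (additive G x y)

    expanded : Vector (Vector Carrier 4) 4 → Vector Carrier 10
    expanded v =
      f (v 0F) * g (v 0F) ∷ f (v 1F) * g (v 1F) ∷ f (v 2F) * g (v 2F) ∷ f (v 3F) * g (v 3F) ∷
      (f (v 0F) + f (v 1F)) * (g (v 0F) + g (v 1F)) ∷ (f (v 0F) + f (v 2F)) * (g (v 0F) + g (v 2F)) ∷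
      (f (v 0F) + f (v 3F)) * (g (v 0F) + g (v 3F)) ∷ (f (v 1F) + f (v 2F)) * (g (v 1F) + g (v 2F)) ∷
      (f (v 1F) + f (v 3F)) * (g (v 1F) + g (v 3F)) ∷ (f (v 2F) + f (v 3F)) * (g (v 2F) + g (v 3F)) ∷ []

    values : ∀ v r → f (nodes v r) * g (nodes v r) ≈ expanded v r
    values v 0F = refl
    values v 1F = refl
    values v 2F = refl
    values v 3F = refl
    values v 4F = pair _ _
    values v 5F = pair _ _
    values v 6F = pair _ _
    values v 7F = pair _ _
    values v 8F = pair _ _
    values v 9F = pair _ _

  dot-quadratic : ∀ {m} (ε : Vector Carrier m) {G : Vector Carrier 4 → Vector Carrier m} →
    (∀ k → Quadratic (λ x → G x k)) → Quadratic (λ x → dot ε (G x))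
  dot-quadratic ε {G} Gq = record
    { cong-quad   = λ x≋y → dot-cong {a = ε} (λ _ → refl) (λ k → cong-quad (Gq k) x≋y)
    ; interpolate = λ u v → begin
        dot ε (G (combination u v))                             ≈⟨ dot-cong {a = ε} (λ _ → refl) (λ k → interpolate (Gq k) u v) ⟩
        dot ε (combination (weights u) (G ∘ nodes v))           ≈⟨ dot-combination ε (weights u) (G ∘ nodes v) ⟩
        dot (weights u) (λ r → dot ε (G (nodes v r)))           ∎
    }

  quadratic-cong : ∀ {G H} → (∀ x → H x ≈ G x) → Quadratic G → Quadratic H
  quadratic-cong eq Gq = record
    { cong-quad   = λ x≋y → trans (eq _) (trans (cong-quad Gq x≋y) (sym (eq _)))
    ; interpolate = λ u v → trans (eq _) (trans (interpolate Gq u v)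
        (dot-cong {a = weights u} (λ _ → refl) (λ r → sym (eq (nodes v r)))))
    }

  infixl 6 _+₂_
  _+₂_ : ∀ {G H} → Quadratic G → Quadratic H → Quadratic (λ x → G x + H x)
  _+₂_ {G} {H} Gq Hq = record
    { cong-quad   = λ x≋y → +-cong (cong-quad Gq x≋y) (cong-quad Hq x≋y)
    ; interpolate = λ u v → trans (+-cong (interpolate Gq u v) (interpolate Hq u v))
        (sym (dot-⊕ (weights u) (G ∘ nodes v) (H ∘ nodes v)))
    }

  infixr 7 _•₂_
  _•₂_ : ∀ k {G} → Quadratic G → Quadratic (λ x → k * G x)
  _•₂_ k {G} Gq = record
    { cong-quad   = λ x≋y → *-congˡ (cong-quad Gq x≋y)
    ; interpolate = λ u v → trans (*-congˡ (interpolate Gq u v))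
        (trans (*-congˡ (dot-comm (weights u) (G ∘ nodes v)))
          (trans (sym (dot-scaleˡ k (G ∘ nodes v) (weights u))) (dot-comm (k • (G ∘ nodes v)) (weights u))))
    }

  infixl 6 _-₂_
  _-₂_ : ∀ {G H} → Quadratic G → Quadratic H → Quadratic (λ x → G x - H x)
  _-₂_ {G} {H} Gq Hq = quadratic-cong
    (λ x → solve 2 (λ g h → g :- h := g :+ :- con (+ 1) :* h) ≡.refl (G x) (H x)) (Gq +₂ - 1# •₂ Hq)

  -- The points in terms of two irreducible polynomials
  module Surface (b : Carrier) (b-rootless : ∀ x → x * x + x + b ≉ 0#)
    (c₀ c₁ c₂ : Carrier) (c-rootless : ∀ x → x * x * x + c₂ * (x * x) + c₁ * x + c₀ ≉ 0#) where

    private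
      -- The moments form a geometric progression with ratio r = - s / p, so the recurrence reads
      -- c(r) m₀ = 0, and c has no root.
      linear-factor : ∀ {m₀ m₁ m₂ m₃ s p} → p ≉ 0# → m₃ + c₂ * m₂ + c₁ * m₁ + c₀ * m₀ ≈ 0# →
        s * m₀ + p * m₁ ≈ 0# → s * m₁ + p * m₂ ≈ 0# → s * m₂ + p * m₃ ≈ 0# →
        m₀ ≈ 0# × m₁ ≈ 0# × m₂ ≈ 0#
      linear-factor {m₀} {m₁} {m₂} {m₃} {s} {p} p≉0 rec e₀ e₁ e₂ =
        m₀≈0 , cancelˡ p≉0 (descend e₀ m₀≈0) , cancelˡ p≉0 (descend e₁ (cancelˡ p≉0 (descend e₀ m₀≈0)))
        where
        descend : ∀ {u v} → s * u + p * v ≈ 0# → u ≈ 0# → p * v ≈ 0#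
        descend {u} {v} e u≈0 = by₂ (solve 4 (λ s p u v → p :* v := con (+ 1) :* (s :* u :+ p :* v) :+ :- s :* u) ≡.refl s p u v) e u≈0

        t : Carrier
        t = proj₁ (inverse p≉0)

        1-pt≈0 : 1# - p * t ≈ 0#
        1-pt≈0 = x≈y⇒x-y≈0 (sym (proj₂ (inverse p≉0)))

        r : Carrier
        r = - (t * s)

        step : ∀ {u v} → s * u + p * v ≈ 0# → v - r * u ≈ 0#
        step {u} {v} e = by₂ (solve 5 (λ s p t u v → v :- (:- (t :* s)) :* u :=
          t :* (s :* u :+ p :* v) :+ v :* (con (+ 1) :- p :* t)) ≡.refl s p t u v) e 1-pt≈0

        m₀≈0 : m₀ ≈ 0#
        m₀≈0 = cancelˡ (c-rootless r) (by₄ (solve 8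
          (λ m₀ m₁ m₂ m₃ r c₀ c₁ c₂ → (r :* r :* r :+ c₂ :* (r :* r) :+ c₁ :* r :+ c₀) :* m₀ :=
            con (+ 1) :* (m₃ :+ c₂ :* m₂ :+ c₁ :* m₁ :+ c₀ :* m₀)
            :+ :- (r :* r :+ c₂ :* r :+ c₁) :* (m₁ :- r :* m₀)
            :+ :- (r :+ c₂) :* (m₂ :- r :* m₁)
            :+ :- con (+ 1) :* (m₃ :- r :* m₂))
          ≡.refl m₀ m₁ m₂ m₃ r c₀ c₁ c₂) rec (step e₀) (step e₁) (step e₂))

      -- Dividing the cubic by x² + p x + s leaves the remainder ρ₁ x + ρ₀.
      monic-quadratic-factor : ∀ {m₀ m₁ m₂ m₃ m₄ s p} →
        m₃ + c₂ * m₂ + c₁ * m₁ + c₀ * m₀ ≈ 0# → m₄ + c₂ * m₃ + c₁ * m₂ + c₀ * m₁ ≈ 0# →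
        s * m₀ + p * m₁ + m₂ ≈ 0# → s * m₁ + p * m₂ + m₃ ≈ 0# → s * m₂ + p * m₃ + m₄ ≈ 0# →
        m₀ ≈ 0# × m₁ ≈ 0# × m₂ ≈ 0#
      monic-quadratic-factor {m₀} {m₁} {m₂} {m₃} {m₄} {s} {p} rec₃ rec₄ e₀ e₁ e₂ = by-remainder (ρ₁ ≟ 0#) (ρ₀ ≟ 0#)
        where
        ρ₁ ρ₀ : Carrier
        ρ₁ = c₁ - s - p * (c₂ - p)
        ρ₀ = c₀ - s * (c₂ - p)

        f₀ : ρ₀ * m₀ + ρ₁ * m₁ ≈ 0#
        f₀ = by₃ (solve 9 (λ m₀ m₁ m₂ m₃ s p c₀ c₁ c₂ →
          (c₀ :- s :* (c₂ :- p)) :* m₀ :+ (c₁ :- s :- p :* (c₂ :- p)) :* m₁ :=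
          con (+ 1) :* (m₃ :+ c₂ :* m₂ :+ c₁ :* m₁ :+ c₀ :* m₀)
          :+ :- (c₂ :- p) :* (s :* m₀ :+ p :* m₁ :+ m₂) :+ :- con (+ 1) :* (s :* m₁ :+ p :* m₂ :+ m₃))
          ≡.refl m₀ m₁ m₂ m₃ s p c₀ c₁ c₂) rec₃ e₀ e₁

        f₁ : ρ₀ * m₁ + ρ₁ * m₂ ≈ 0#
        f₁ = by₃ (solve 9 (λ m₀ m₁ m₂ m₃ s p c₀ c₁ c₂ →
          (c₀ :- s :* (c₂ :- p)) :* m₀ :+ (c₁ :- s :- p :* (c₂ :- p)) :* m₁ :=
          con (+ 1) :* (m₃ :+ c₂ :* m₂ :+ c₁ :* m₁ :+ c₀ :* m₀)
          :+ :- (c₂ :- p) :* (s :* m₀ :+ p :* m₁ :+ m₂) :+ :- con (+ 1) :* (s :* m₁ :+ p :* m₂ :+ m₃))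
          ≡.refl m₁ m₂ m₃ m₄ s p c₀ c₁ c₂) rec₄ e₁ e₂

        -- The recurrences of the cubic stop one index short of this relation; the recurrence of the
        -- quadratic carries `f₀` and `f₁` on to it.
        f₂ : ρ₀ * m₂ + ρ₁ * m₃ ≈ 0#
        f₂ = by₄ (solve 8 (λ m₀ m₁ m₂ m₃ s p ρ₀ ρ₁ → ρ₀ :* m₂ :+ ρ₁ :* m₃ :=
          :- p :* (ρ₀ :* m₁ :+ ρ₁ :* m₂) :+ :- s :* (ρ₀ :* m₀ :+ ρ₁ :* m₁)
          :+ ρ₀ :* (s :* m₀ :+ p :* m₁ :+ m₂) :+ ρ₁ :* (s :* m₁ :+ p :* m₂ :+ m₃))
          ≡.refl m₀ m₁ m₂ m₃ s p ρ₀ ρ₁) f₁ f₀ e₀ e₁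

        drop : ∀ {u v} → ρ₁ ≈ 0# → ρ₀ * u + ρ₁ * v ≈ 0# → ρ₀ * u ≈ 0#
        drop {u} {v} ρ₁≈0 f = by₂ (solve 4 (λ ρ₀ ρ₁ u v → ρ₀ :* u :=
          con (+ 1) :* (ρ₀ :* u :+ ρ₁ :* v) :+ :- v :* ρ₁) ≡.refl ρ₀ ρ₁ u v) f ρ₁≈0

        by-remainder : Dec (ρ₁ ≈ 0#) → Dec (ρ₀ ≈ 0#) → m₀ ≈ 0# × m₁ ≈ 0# × m₂ ≈ 0#
        by-remainder (no ρ₁≉0)  _           = linear-factor ρ₁≉0 rec₃ f₀ f₁ f₂
        by-remainder (yes ρ₁≈0) (no ρ₀≉0)  = m₀≈0 , m₁≈0 ,
          by₃ (solve 5 (λ m₀ m₁ m₂ s p → m₂ := con (+ 1) :* (s :* m₀ :+ p :* m₁ :+ m₂) :+ :- s :* m₀ :+ :- p :* m₁)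
            ≡.refl m₀ m₁ m₂ s p) e₀ m₀≈0 m₁≈0
          where
          m₀≈0 : m₀ ≈ 0#
          m₀≈0 = cancelˡ ρ₀≉0 (drop ρ₁≈0 f₀)

          m₁≈0 : m₁ ≈ 0#
          m₁≈0 = cancelˡ ρ₀≉0 (drop ρ₁≈0 f₁)
        -- The quadratic now divides the cubic, with cofactor x + (c₂ - p), whose root is p - c₂.
        by-remainder (yes ρ₁≈0) (yes ρ₀≈0) = contradiction
          (by₂ (solve 5 (λ s p c₀ c₁ c₂ → let x = p :- c₂ in x :* x :* x :+ c₂ :* (x :* x) :+ c₁ :* x :+ c₀ :=
            x :* (c₁ :- s :- p :* (c₂ :- p)) :+ con (+ 1) :* (c₀ :- s :* (c₂ :- p))) ≡.refl s p c₀ c₁ c₂) ρ₁≈0 ρ₀≈0)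
          (c-rootless (p - c₂))

    -- The Hankel matrix (mᵢ₊ⱼ) is the Gram matrix of (f, g) ↦ φ(f g) on the
    -- field K[x]/(c), where φ(xⁱ) = mᵢ; it is singular only if φ = 0.
    hankel-nonsingular : ∀ {m₀ m₁ m₂ m₃ m₄ l₀ l₁ l₂} →
      m₃ + c₂ * m₂ + c₁ * m₁ + c₀ * m₀ ≈ 0# → m₄ + c₂ * m₃ + c₁ * m₂ + c₀ * m₁ ≈ 0# →
      l₀ * m₀ + l₁ * m₁ + l₂ * m₂ ≈ 0# → l₀ * m₁ + l₁ * m₂ + l₂ * m₃ ≈ 0# → l₀ * m₂ + l₁ * m₃ + l₂ * m₄ ≈ 0# →
      ¬ (l₀ ≈ 0# × l₁ ≈ 0# × l₂ ≈ 0#) →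
      m₀ ≈ 0# × m₁ ≈ 0# × m₂ ≈ 0# × m₃ ≈ 0# × m₄ ≈ 0#
    hankel-nonsingular {m₀} {m₁} {m₂} {m₃} {m₄} {l₀} {l₁} {l₂} rec₃ rec₄ e₀ e₁ e₂ l≉0 =
      let m₀≈0 , m₁≈0 , m₂≈0 = first-three (l₂ ≟ 0#) (l₁ ≟ 0#)
          m₃≈0 = next rec₃ m₀≈0 m₁≈0 m₂≈0
      in m₀≈0 , m₁≈0 , m₂≈0 , m₃≈0 , next rec₄ m₁≈0 m₂≈0 m₃≈0
      where
      next : ∀ {u v w x} → x + c₂ * w + c₁ * v + c₀ * u ≈ 0# → u ≈ 0# → v ≈ 0# → w ≈ 0# → x ≈ 0#
      next {u} {v} {w} {x} = by₄ (solve 7 (λ u v w x c₀ c₁ c₂ → x :=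
        con (+ 1) :* (x :+ c₂ :* w :+ c₁ :* v :+ c₀ :* u) :+ :- c₀ :* u :+ :- c₁ :* v :+ :- c₂ :* w) ≡.refl u v w x c₀ c₁ c₂)

      first-three : Dec (l₂ ≈ 0#) → Dec (l₁ ≈ 0#) → m₀ ≈ 0# × m₁ ≈ 0# × m₂ ≈ 0#
      first-three (no l₂≉0) _ = monic-quadratic-factor rec₃ rec₄ (normalise e₀) (normalise e₁) (normalise e₂)
        where
        t : Carrier
        t = proj₁ (inverse l₂≉0)

        normalise : ∀ {u v w} → l₀ * u + l₁ * v + l₂ * w ≈ 0# → t * l₀ * u + t * l₁ * v + w ≈ 0#
        normalise {u} {v} {w} e = by₂ (solve 7 (λ l₀ l₁ l₂ t u v w → t :* l₀ :* u :+ t :* l₁ :* v :+ w :=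
          t :* (l₀ :* u :+ l₁ :* v :+ l₂ :* w) :+ w :* (con (+ 1) :- l₂ :* t)) ≡.refl l₀ l₁ l₂ t u v w)
          e (x≈y⇒x-y≈0 (sym (proj₂ (inverse l₂≉0))))
      first-three (yes l₂≈0) (no l₁≉0) = linear-factor l₁≉0 rec₃ (drop e₀) (drop e₁) (drop e₂)
        where
        drop : ∀ {u v w} → l₀ * u + l₁ * v + l₂ * w ≈ 0# → l₀ * u + l₁ * v ≈ 0#
        drop {u} {v} {w} e = by₂ (solve 6 (λ l₀ l₁ l₂ u v w → l₀ :* u :+ l₁ :* v :=
          con (+ 1) :* (l₀ :* u :+ l₁ :* v :+ l₂ :* w) :+ :- w :* l₂) ≡.refl l₀ l₁ l₂ u v w) e l₂≈0
      first-three (yes l₂≈0) (yes l₁≈0) = drop e₀ , drop e₁ , drop e₂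
        where
        drop : ∀ {u v w} → l₀ * u + l₁ * v + l₂ * w ≈ 0# → u ≈ 0#
        drop {u} {v} {w} e = cancelˡ (λ l₀≈0 → l≉0 (l₀≈0 , l₁≈0 , l₂≈0))
          (by₃ (solve 6 (λ l₀ l₁ l₂ u v w → l₀ :* u :=
            con (+ 1) :* (l₀ :* u :+ l₁ :* v :+ l₂ :* w) :+ :- v :* l₁ :+ :- w :* l₂) ≡.refl l₀ l₁ l₂ u v w) e l₁≈0 l₂≈0)

    -- Five independent quadrics attached to a solid

    open Quadratic

    -- `L` and `M` describe a solid by the equations F₁ + L(w) = 0 and F₂ + M(w) = 0; homogenised
    -- with y they become the quadrics `h₁` and `h₂`. The coordinates of `v` are (τ, x, y, n).
    module FiveQuadrics (L M : Vector Carrier 4) where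

      Q h₁ h₂ g₁ g₂ : Vector Carrier 4 → Carrier
      Q  v = v 0F * v 3F - v 1F * v 1F - v 1F * v 2F - b * (v 2F * v 2F)
      h₁ v = v 1F * v 3F + c₂ * (v 0F * v 3F) + c₁ * (v 0F * v 1F) + c₀ * (v 0F * v 0F) + v 2F * dot L v
      h₂ v = v 3F * v 3F + c₂ * (v 1F * v 3F) + c₁ * (v 0F * v 3F) + c₀ * (v 0F * v 1F) + v 2F * dot M v
      g₁ v = v 1F * dot L v - v 0F * dot M v - (v 1F + b * v 2F) * (v 3F + c₁ * v 0F)
      g₂ v = v 3F * dot L v - v 1F * dot M v + (v 1F + b * v 2F) * (c₂ * v 3F + c₀ * v 0F)

      quadrics : Vector Carrier 4 → Vector Carrier 5
      quadrics v = Q v ∷ h₁ v ∷ h₂ v ∷ g₁ v ∷ g₂ v ∷ []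

      quadrics-quadratic : ∀ k → Quadratic (λ v → quadrics v k)
      quadrics-quadratic 0F = coordinate 0F *₂ coordinate 3F -₂ coordinate 1F *₂ coordinate 1F
        -₂ coordinate 1F *₂ coordinate 2F -₂ b •₂ coordinate 2F *₂ coordinate 2F
      quadrics-quadratic 1F = coordinate 1F *₂ coordinate 3F +₂ c₂ •₂ coordinate 0F *₂ coordinate 3F
        +₂ c₁ •₂ coordinate 0F *₂ coordinate 1F +₂ c₀ •₂ coordinate 0F *₂ coordinate 0F +₂ coordinate 2F *₂ dot-is-linear L
      quadrics-quadratic 2F = coordinate 3F *₂ coordinate 3F +₂ c₂ •₂ coordinate 1F *₂ coordinate 3F
        +₂ c₁ •₂ coordinate 0F *₂ coordinate 3F +₂ c₀ •₂ coordinate 0F *₂ coordinate 1F +₂ coordinate 2F *₂ dot-is-linear M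
      quadrics-quadratic 3F = coordinate 1F *₂ dot-is-linear L -₂ coordinate 0F *₂ dot-is-linear M
        -₂ (coordinate 1F +ₗ b *ₗ coordinate 2F) *₂ (coordinate 3F +ₗ c₁ *ₗ coordinate 0F)
      quadrics-quadratic 4F = coordinate 3F *₂ dot-is-linear L -₂ coordinate 1F *₂ dot-is-linear M
        +₂ (coordinate 1F +ₗ b *ₗ coordinate 2F) *₂ (c₂ *ₗ coordinate 3F +ₗ c₀ *ₗ coordinate 0F)

      -- On the plane y = 0 the conics Q, h₁, h₂ have two linear syzygies (Hilbert–Burch);
      -- off it they give two more quadrics through the common zeros.
      syzygy₁ : ∀ v → v 2F * g₁ v ≈ v 1F * h₁ v - v 0F * h₂ v + (v 3F + c₁ * v 0F) * Q v
      syzygy₁ v = solve 10 (λ τ x y n l m b c₀ c₁ c₂ →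
        y :* (x :* l :- τ :* m :- (x :+ b :* y) :* (n :+ c₁ :* τ)) :=
        x :* (x :* n :+ c₂ :* (τ :* n) :+ c₁ :* (τ :* x) :+ c₀ :* (τ :* τ) :+ y :* l)
        :- τ :* (n :* n :+ c₂ :* (x :* n) :+ c₁ :* (τ :* n) :+ c₀ :* (τ :* x) :+ y :* m)
        :+ (n :+ c₁ :* τ) :* (τ :* n :- x :* x :- x :* y :- b :* (y :* y)))
        ≡.refl (v 0F) (v 1F) (v 2F) (v 3F) (dot L v) (dot M v) b c₀ c₁ c₂

      syzygy₂ : ∀ v → v 2F * g₂ v ≈ v 3F * h₁ v - v 1F * h₂ v - (c₂ * v 3F + c₀ * v 0F) * Q v
      syzygy₂ v = solve 10 (λ τ x y n l m b c₀ c₁ c₂ →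
        y :* (n :* l :- x :* m :+ (x :+ b :* y) :* (c₂ :* n :+ c₀ :* τ)) :=
        n :* (x :* n :+ c₂ :* (τ :* n) :+ c₁ :* (τ :* x) :+ c₀ :* (τ :* τ) :+ y :* l)
        :- x :* (n :* n :+ c₂ :* (x :* n) :+ c₁ :* (τ :* n) :+ c₀ :* (τ :* x) :+ y :* m)
        :- (c₂ :* n :+ c₀ :* τ) :* (τ :* n :- x :* x :- x :* y :- b :* (y :* y)))
        ≡.refl (v 0F) (v 1F) (v 2F) (v 3F) (dot L v) (dot M v) b c₀ c₁ c₂

      quadrics-vanish : ∀ v → v 2F ≈ 1# → Q v ≈ 0# → h₁ v ≈ 0# → h₂ v ≈ 0# → ∀ k → quadrics v k ≈ 0#
      quadrics-vanish v y≈1 Q≈0 h₁≈0 h₂≈0 = λ where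
          0F → Q≈0
          1F → h₁≈0
          2F → h₂≈0
          3F → unscale (trans (syzygy₁ v) (by₃ (solve 6 (λ x h τ k n s → x :* h :- τ :* k :+ n :* s := x :* h :+ :- τ :* k :+ n :* s)
                 ≡.refl _ _ _ _ _ _) h₁≈0 h₂≈0 Q≈0))
          4F → unscale (trans (syzygy₂ v) (by₃ (solve 6 (λ x h τ k n s → x :* h :- τ :* k :- n :* s := x :* h :+ :- τ :* k :+ :- n :* s)
                 ≡.refl _ _ _ _ _ _) h₁≈0 h₂≈0 Q≈0))
        where
        unscale : ∀ {u} → v 2F * u ≈ 0# → u ≈ 0#
        unscale = cancelˡ (λ y≈0 → 1≉0 (trans (sym y≈1) y≈0))

      module Vanishing (ε : Vector Carrier 5) (zeros : ∀ v → dot ε (quadrics v) ≈ 0#) where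

        α β γ δ η : Carrier
        α = ε 0F
        β = ε 1F
        γ = ε 2F
        δ = ε 3F
        η = ε 4F

        -- The multipliers of `h₁`, `h₂` and `Q` that arise when y times the vanishing combination
        -- is expanded with the two syzygies.
        A B ℓ : Vector Carrier 4 → Carrier
        A v = δ * v 1F + η * v 3F + β * v 2F
        B v = γ * v 2F - δ * v 0F - η * v 1F
        ℓ v = δ * (v 3F + c₁ * v 0F) - η * (c₂ * v 3F + c₀ * v 0F) + α * v 2F

        koszul : ∀ v → A v * h₁ v + B v * h₂ v + ℓ v * Q v ≈ 0#
        koszul v = by₃ (solve 17 (λ τ x y n qv h k g f α β γ δ η c₀ c₁ c₂ →
            (δ :* x :+ η :* n :+ β :* y) :* h :+ (γ :* y :- δ :* τ :- η :* x) :* k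
            :+ (δ :* (n :+ c₁ :* τ) :- η :* (c₂ :* n :+ c₀ :* τ) :+ α :* y) :* qv :=
            y :* (α :* qv :+ (β :* h :+ (γ :* k :+ (δ :* g :+ (η :* f :+ con (+ 0))))))
            :+ :- δ :* (y :* g :- (x :* h :- τ :* k :+ (n :+ c₁ :* τ) :* qv))
            :+ :- η :* (y :* f :- (n :* h :- x :* k :- (c₂ :* n :+ c₀ :* τ) :* qv)))
          ≡.refl (v 0F) (v 1F) (v 2F) (v 3F) (Q v) (h₁ v) (h₂ v) (g₁ v) (g₂ v) α β γ δ η c₀ c₁ c₂)
          (zeros v) (x≈y⇒x-y≈0 (syzygy₁ v)) (x≈y⇒x-y≈0 (syzygy₂ v))

        -- Where A = B = 0 the terms in `h₁` and `h₂` drop out. If `η` or `δ` were nonzero this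
        -- locus would contain enough points to contradict the rootlessness of the two polynomials;
        -- `η` is treated before `δ`.
        line : ∀ v → A v ≈ 0# → B v ≈ 0# → ℓ v * Q v ≈ 0#
        line v A≈0 B≈0 = by₃ (solve 5 (λ a b s h k → s := con (+ 1) :* (a :* h :+ b :* k :+ s) :+ :- h :* a :+ :- k :* b)
          ≡.refl (A v) (B v) (ℓ v * Q v) (h₁ v) (h₂ v)) (koszul v) A≈0 B≈0

        g : Carrier
        g = proj₁ (avoid (ℕ.≤-trans (s≤s (s≤s (s≤s z≤n))) 4≤q) (0# ∷ 1# ∷ []))

        g≉0 : g ≉ 0#
        g≉0 = proj₂ (avoid (ℕ.≤-trans (s≤s (s≤s (s≤s z≤n))) 4≤q) (0# ∷ 1# ∷ [])) 0F

        1-g≉0 : 1# - g ≉ 0#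
        1-g≉0 1-g≈0 = proj₂ (avoid (ℕ.≤-trans (s≤s (s≤s (s≤s z≤n))) 4≤q) (0# ∷ 1# ∷ [])) 1F (sym (x-y≈0⇒x≈y 1-g≈0))

        module _ {t} (ηt≈1 : η * t ≈ 1#) where

          1-ηt≈0 : 1# - η * t ≈ 0#
          1-ηt≈0 = x≈y⇒x-y≈0 (sym ηt≈1)

          -- Parametrises the line A = B = 0.
          u : (τ y : Carrier) → Vector Carrier 4
          u τ y = τ ∷ x ∷ y ∷ - ((δ * x + β * y) * t) ∷ []
            where
            x : Carrier
            x = (γ * y - δ * τ) * t

          ℓQ≈0 : ∀ τ y → ℓ (u τ y) * Q (u τ y) ≈ 0#
          ℓQ≈0 τ y = line (u τ y)
            (by₁ (solve 7 (λ β γ δ η t τ y → let x = (γ :* y :- δ :* τ) :* t in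
                δ :* x :+ η :* (:- ((δ :* x :+ β :* y) :* t)) :+ β :* y :=
                (δ :* x :+ β :* y) :* (con (+ 1) :- η :* t)) ≡.refl β γ δ η t τ y) 1-ηt≈0)
            (by₁ (solve 6 (λ γ δ η t τ y → γ :* y :- δ :* τ :- η :* ((γ :* y :- δ :* τ) :* t) :=
                (γ :* y :- δ :* τ) :* (con (+ 1) :- η :* t)) ≡.refl γ δ η t τ y) 1-ηt≈0)

          Q₀₁≉0 : Q (u 0# 1#) ≉ 0#
          Q₀₁≉0 Q≈0 = b-rootless (u 0# 1# 1F) (by₁ (solve 3 (λ x n b → x :* x :+ x :+ b :=
            :- con (+ 1) :* (con (+ 0) :* n :- x :* x :- x :* con (+ 1) :- b :* (con (+ 1) :* con (+ 1)))) ≡.refl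
            (u 0# 1# 1F) (u 0# 1# 3F) b) Q≈0)

          ℓ₀₁≈0 : ℓ (u 0# 1#) ≈ 0#
          ℓ₀₁≈0 = cancelˡ Q₀₁≉0 (trans (*-comm _ _) (ℓQ≈0 0# 1#))

          -- With r = - δ / η this point is (1, r, 0, r²), where ℓ takes the value - η c(r).
          ℓ₁₀≉0 : ℓ (u 1# 0#) ≉ 0#
          ℓ₁₀≉0 ℓ≈0 = *≉0 η≉0 (c-rootless (- (δ * t))) (by₂ (solve 9 (λ α β γ δ η t c₀ c₁ c₂ →
              let r = :- (δ :* t) ; x = (γ :* con (+ 0) :- δ :* con (+ 1)) :* t ; n = :- ((δ :* x :+ β :* con (+ 0)) :* t) in
              η :* (r :* r :* r :+ c₂ :* (r :* r) :+ c₁ :* r :+ c₀) :=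
              :- con (+ 1) :* (δ :* (n :+ c₁ :* con (+ 1)) :- η :* (c₂ :* n :+ c₀ :* con (+ 1)) :+ α :* con (+ 0))
              :+ (δ :* (r :* r :+ c₁)) :* (con (+ 1) :- η :* t)) ≡.refl α β γ δ η t c₀ c₁ c₂) ℓ≈0 1-ηt≈0)
            where
            η≉0 : η ≉ 0#
            η≉0 η≈0 = 1≉0 (trans (sym ηt≈1) (trans (*-congʳ η≈0) (zeroˡ t)))

          -- ℓ is linear on the line and vanishes at parameters (0, 1), so at (1, y) it has the same
          -- nonzero value as at (1, 0) and can be cancelled.
          Q₁≈0 : ∀ y → Q (u 1# y) ≈ 0#
          Q₁≈0 y = cancelˡ (λ ℓ≈0 → ℓ₁₀≉0 (by₂ (solve 10 (λ α β γ δ η t y c₀ c₁ c₂ →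
              let ℓ = λ τ y → let x = (γ :* y :- δ :* τ) :* t ; n = :- ((δ :* x :+ β :* y) :* t) in
                        δ :* (n :+ c₁ :* τ) :- η :* (c₂ :* n :+ c₀ :* τ) :+ α :* y in
              ℓ (con (+ 1)) (con (+ 0)) := con (+ 1) :* ℓ (con (+ 1)) y :+ :- y :* ℓ (con (+ 0)) (con (+ 1)))
              ≡.refl α β γ δ η t y c₀ c₁ c₂) ℓ≈0 ℓ₀₁≈0)) (ℓQ≈0 1# y)

          line-absurd : ⊥
          -- As a polynomial in y, `Q (u 1# y)` has no constant term, because (1, r, 0, r²) lies on
          -- the quadric, and its leading coefficient is `Q (u 0# 1#)`. The values 1 and `g` of y
          -- eliminate the linear term.
          line-absurd = *≉0 (*≉0 g≉0 1-g≉0) Q₀₁≉0 (by₂ (solve 6 (λ β γ δ t b g →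
              let Q = λ τ y → let x = (γ :* y :- δ :* τ) :* t ; n = :- ((δ :* x :+ β :* y) :* t) in
                        τ :* n :- x :* x :- x :* y :- b :* (y :* y) in
              g :* (con (+ 1) :- g) :* Q (con (+ 0)) (con (+ 1)) :=
              g :* Q (con (+ 1)) (con (+ 1)) :+ :- con (+ 1) :* Q (con (+ 1)) g)
              ≡.refl β γ δ t b g) (Q₁≈0 1#) (Q₁≈0 g))

        η≈0 : η ≈ 0#
        η≈0 with η ≟ 0#
        ... | yes eq  = eq
        ... | no η≉0 = ⊥-elim (line-absurd (proj₂ (inverse η≉0)))

        module _ {t} (δt≈1 : δ * t ≈ 1#) where

          1-δt≈0 : 1# - δ * t ≈ 0#
          1-δt≈0 = x≈y⇒x-y≈0 (sym δt≈1)

          δ≉0 : δ ≉ 0#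
          δ≉0 δ≈0 = 1≉0 (trans (sym δt≈1) (trans (*-congʳ δ≈0) (zeroˡ t)))

          -- With η = 0, δ nonzero and y = 1, the equations A = B = 0 fix τ and x and leave n free.
          -- ℓ vanishes at n = `ν`, so the parameter `s` of `u′` measures the distance from that
          -- zero.
          τ ν : Carrier
          τ = γ * t
          ν = - (c₁ * τ + α * t)

          u′ : Carrier → Vector Carrier 4
          u′ s = τ ∷ - (β * t) ∷ 1# ∷ ν + s ∷ []

          ℓ-u′ : ∀ s → ℓ (u′ s) ≈ 0# → δ * s ≈ 0#
          ℓ-u′ s ℓ≈0 = by₃ (solve 9 (λ α γ δ η t s c₀ c₁ c₂ →
              let τ = γ :* t ; n = :- (c₁ :* τ :+ α :* t) :+ s in
              δ :* s := con (+ 1) :* (δ :* (n :+ c₁ :* τ) :- η :* (c₂ :* n :+ c₀ :* τ) :+ α :* con (+ 1))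
              :+ (c₂ :* n :+ c₀ :* τ) :* η :+ :- α :* (con (+ 1) :- δ :* t)) ≡.refl α γ δ η t s c₀ c₁ c₂) ℓ≈0 η≈0 1-δt≈0

          Q-u′ : ∀ s → s ≉ 0# → Q (u′ s) ≈ 0#
          Q-u′ s s≉0 = cancelˡ (λ ℓ≈0 → *≉0 δ≉0 s≉0 (ℓ-u′ s ℓ≈0)) (line (u′ s)
            (by₂ (solve 5 (λ β δ η t n → δ :* (:- (β :* t)) :+ η :* n :+ β :* con (+ 1) :=
              β :* (con (+ 1) :- δ :* t) :+ n :* η) ≡.refl β δ η t (ν + s)) 1-δt≈0 η≈0)
            (by₂ (solve 5 (λ β γ δ η t → γ :* con (+ 1) :- δ :* (γ :* t) :- η :* (:- (β :* t)) :=
              γ :* (con (+ 1) :- δ :* t) :+ β :* t :* η) ≡.refl β γ δ η t) 1-δt≈0 η≈0))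

          -- Along `u′` the form `Q` is affine in s with slope τ, and it vanishes at the two values
          -- 1 and `g`.
          τ≈0 : τ ≈ 0#
          τ≈0 = cancelˡ 1-g≉0 (by₂ (solve 5 (λ τ x ν g b →
              let Q = λ s → τ :* (ν :+ s) :- x :* x :- x :* con (+ 1) :- b :* (con (+ 1) :* con (+ 1)) in
              (con (+ 1) :- g) :* τ := con (+ 1) :* Q (con (+ 1)) :+ :- con (+ 1) :* Q g)
            ≡.refl τ (- (β * t)) ν g b) (Q-u′ 1# 1≉0) (Q-u′ g g≉0))

          line′-absurd : ⊥
          line′-absurd = b-rootless (- (β * t)) (by₂ (solve 4 (λ τ x n b → x :* x :+ x :+ b :=
            :- con (+ 1) :* (τ :* n :- x :* x :- x :* con (+ 1) :- b :* (con (+ 1) :* con (+ 1))) :+ n :* τ)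
            ≡.refl τ (- (β * t)) (ν + 1#) b) (Q-u′ 1# 1≉0) τ≈0)

        δ≈0 : δ ≈ 0#
        δ≈0 with δ ≟ 0#
        ... | yes eq  = eq
        ... | no δ≉0 = ⊥-elim (line′-absurd (proj₂ (inverse δ≉0)))

        -- Once `δ` and `η` are gone, `α`, `γ` and `β` can be read off in turn at the points (0, 1,
        -- 0, 0), (0, 0, 0, 1) and (0, 1, 0, 1) of the plane y = 0.
        α≈0 : α ≈ 0#
        α≈0 = by₃ (solve 11 (λ α β γ δ η b c₀ c₁ c₂ l m → let z = con (+ 0) ; o = con (+ 1) in
            α := :- o :* (α :* (z :* z :- o :* o :- o :* z :- b :* (z :* z))
              :+ (β :* (o :* z :+ c₂ :* (z :* z) :+ c₁ :* (z :* o) :+ c₀ :* (z :* z) :+ z :* l)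
              :+ (γ :* (z :* z :+ c₂ :* (o :* z) :+ c₁ :* (z :* z) :+ c₀ :* (z :* o) :+ z :* m)
              :+ (δ :* (o :* l :- z :* m :- (o :+ b :* z) :* (z :+ c₁ :* z))
              :+ (η :* (z :* l :- o :* m :+ (o :+ b :* z) :* (c₂ :* z :+ c₀ :* z)) :+ z)))))
            :+ l :* δ :+ :- m :* η) ≡.refl α β γ δ η b c₀ c₁ c₂ (dot L v) (dot M v)) (zeros v) δ≈0 η≈0
          where
          v : Vector Carrier 4
          v = 0# ∷ 1# ∷ 0# ∷ 0# ∷ []

        γ≈0 : γ ≈ 0#
        γ≈0 = by₂ (solve 11 (λ α β γ δ η b c₀ c₁ c₂ l m → let z = con (+ 0) ; o = con (+ 1) in
            γ := o :* (α :* (z :* o :- z :* z :- z :* z :- b :* (z :* z))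
              :+ (β :* (z :* o :+ c₂ :* (z :* o) :+ c₁ :* (z :* z) :+ c₀ :* (z :* z) :+ z :* l)
              :+ (γ :* (o :* o :+ c₂ :* (z :* o) :+ c₁ :* (z :* o) :+ c₀ :* (z :* z) :+ z :* m)
              :+ (δ :* (z :* l :- z :* m :- (z :+ b :* z) :* (o :+ c₁ :* z))
              :+ (η :* (o :* l :- z :* m :+ (z :+ b :* z) :* (c₂ :* o :+ c₀ :* z)) :+ z)))))
            :+ :- l :* η) ≡.refl α β γ δ η b c₀ c₁ c₂ (dot L v) (dot M v)) (zeros v) η≈0
          where
          v : Vector Carrier 4
          v = 0# ∷ 0# ∷ 0# ∷ 1# ∷ []

        β≈0 : β ≈ 0#
        β≈0 = trans (solve 11 (λ α β γ δ η b c₀ c₁ c₂ l m → let z = con (+ 0) ; o = con (+ 1) in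
            β := o :* (α :* (z :* o :- o :* o :- o :* z :- b :* (z :* z))
              :+ (β :* (o :* o :+ c₂ :* (z :* o) :+ c₁ :* (z :* o) :+ c₀ :* (z :* z) :+ z :* l)
              :+ (γ :* (o :* o :+ c₂ :* (o :* o) :+ c₁ :* (z :* o) :+ c₀ :* (z :* o) :+ z :* m)
              :+ (δ :* (o :* l :- z :* m :- (o :+ b :* z) :* (o :+ c₁ :* z))
              :+ (η :* (o :* l :- o :* m :+ (o :+ b :* z) :* (c₂ :* o :+ c₀ :* z)) :+ z)))))
            :+ (o :* α :+ :- (o :+ c₂) :* γ :+ :- (l :- o :* (o :+ c₁ :* z)) :* δ :+ :- (l :- m :+ c₂) :* η))
            ≡.refl α β γ δ η b c₀ c₁ c₂ (dot L v) (dot M v))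
          (trans (+-cong (by₁ refl (zeros v)) (by₄ refl α≈0 γ≈0 δ≈0 η≈0)) (+-identityˡ 0#))
          where
          v : Vector Carrier 4
          v = 0# ∷ 1# ∷ 0# ∷ 1# ∷ []

        coefficients≋0 : ε ≋ 𝟎
        coefficients≋0 0F = α≈0
        coefficients≋0 1F = β≈0
        coefficients≋0 2F = γ≈0
        coefficients≋0 3F = δ≈0
        coefficients≋0 4F = η≈0

    -- Linear relations among the points and their moments

    module Family {I : Set} (T X N : I → Carrier) (T≉0 : ∀ i → T i ≉ 0#)
      (on-quadric : ∀ i → T i * N i - X i * X i - X i - b ≈ 0#)
      (distinct : ∀ {i j} → T i ≈ T j → X i ≈ X j → i ≡ j)
      where

      F₁ F₂ : (τ x n : Carrier) → Carrier
      F₁ τ x n = x * n + c₂ * (τ * n) + c₁ * (τ * x) + c₀ * (τ * τ)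
      F₂ τ x n = n * n + c₂ * (x * n) + c₁ * (τ * n) + c₀ * (τ * x)

      affine : I → AffinePoint 5
      affine i = T i ∷ X i ∷ N i ∷ F₁ (T i) (X i) (N i) ∷ F₂ (T i) (X i) (N i) ∷ []

      V : I → Vector Carrier 6
      V i = 1# ∷ affine i

      -- Projecting from the line X₀ = ⋯ = X₃ = 0 maps the points to the quadric τ n = x² + x y + b y².
      w : I → Vector Carrier 4
      w i = T i ∷ X i ∷ 1# ∷ N i ∷ []

      module Relation {n} (p : Fin n → I) (a : Vector Carrier n) (aV≋0 : combination a (V ∘ p) ≋ 𝟎) where

        aw≋0 : combination a (w ∘ p) ≋ 𝟎
        aw≋0 0F = aV≋0 1F
        aw≋0 1F = aV≋0 2F
        aw≋0 2F = aV≋0 0F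
        aw≋0 3F = aV≋0 3F

        -- Applying `l` to the relation leaves only the term at `k`. The product form of the
        -- conclusion covers both a zero coefficient and a zero value of `l`.
        annihilates-last : ∀ l k → (∀ i → i ≢ k → dot l (w (p i)) ≈ 0#) → ∀ i → a i * dot l (w (p i)) ≈ 0#
        annihilates-last l k lw≈0 i with i Fin.≟ k
        ... | no i≢k     = by₁ refl (lw≈0 i i≢k)
        ... | yes ≡.refl = begin
          a k * dot l (w (p k))            ≈⟨ dot-single a (λ i → dot l (w (p i))) k (λ i i≢k → by₁ refl (lw≈0 i i≢k)) ⟨
          dot a (λ i → dot l (w (p i)))    ≈⟨ dot-combination l a (w ∘ p) ⟨
          dot l (combination a (w ∘ p))    ≈⟨ dot-zeroʳ l aw≋0 ⟩
          0#                               ∎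

        -- The moments m₀, ..., m₄ of the Hankel matrix are the entries for τ τ, τ x, τ n, x n and n
        -- n; index `2F` belongs to the coordinate y = 1.
        moment : Fin 4 → Vector Carrier 4
        moment j = combination a (λ i → w (p i) j • w (p i))

        moment-sym : ∀ j k → moment j k ≈ moment k j
        moment-sym j k = dot-cong {a = a} (λ _ → refl) (λ i → *-comm (w (p i) j) (w (p i) k))

        dot-linear : ∀ {m} (l : Vector Carrier m) (f : Vector (Vector Carrier m) n) {g : Vector Carrier n} →
          (∀ i → g i ≈ dot l (f i)) → dot l (combination a f) ≈ dot a g
        dot-linear l f eq = trans (dot-combination l a f) (dot-cong {a = a} (λ _ → refl) (λ i → sym (eq i)))

        moment-y : ∀ k → moment 2F k ≈ 0#
        moment-y k = trans (dot-cong {a = a} (λ _ → refl) (λ i → *-identityˡ (w (p i) k))) (aw≋0 k)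

        -- On the quadric τ n and x² differ by x y + b y², whose moment is zero because of the
        -- factor y. This is what makes the matrix Hankel.
        moment-quadric : moment 1F 1F ≈ moment 0F 3F
        moment-quadric = x-y≈0⇒x≈y (by₃
          (solve 5 (λ u v s t b → u :- v :=
              con (+ 1) :* (con (+ 1) :* u :+ (con (+ 1) :* s :+ (b :* t :+ con (+ 0))) :- v)
              :+ :- con (+ 1) :* s :+ :- b :* t)
            ≡.refl (moment 1F 1F) (moment 0F 3F) (moment 2F 1F) (moment 2F 2F) b)
          (x≈y⇒x-y≈0 (dot-linear (1# ∷ 1# ∷ b ∷ [])
            (λ i → w (p i) 1F * w (p i) 1F ∷ w (p i) 2F * w (p i) 1F ∷ w (p i) 2F * w (p i) 2F ∷ [])
            (λ i → x-y≈0⇒x≈y (by₁ (solve 4 (λ τ x n b →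
                τ :* n :- (con (+ 1) :* (x :* x) :+ (con (+ 1) :* (con (+ 1) :* x) :+ (b :* (con (+ 1) :* con (+ 1)) :+ con (+ 0)))) :=
                con (+ 1) :* (τ :* n :- x :* x :- x :- b)) ≡.refl (T (p i)) (X (p i)) (N (p i)) b)
              (on-quadric (p i))))))
          (moment-y 1F) (moment-y 2F))

        -- `F₁` and `F₂` are the recurrence expressions in the products of coordinates, so the last
        -- two coordinates of the relation are exactly the two recurrences of the moments.
        recurrence₃ : moment 1F 3F + c₂ * moment 0F 3F + c₁ * moment 0F 1F + c₀ * moment 0F 0F ≈ 0#
        recurrence₃ = trans (recurrence-dot c₂ c₁ c₀ (moment 1F 3F) (moment 0F 3F) (moment 0F 1F) (moment 0F 0F))
          (trans (dot-linear (1# ∷ c₂ ∷ c₁ ∷ c₀ ∷ [])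
            (λ i → let v = w (p i) in v 1F * v 3F ∷ v 0F * v 3F ∷ v 0F * v 1F ∷ v 0F * v 0F ∷ [])
            (λ i → let v = w (p i) in recurrence-dot c₂ c₁ c₀ (v 1F * v 3F) (v 0F * v 3F) (v 0F * v 1F) (v 0F * v 0F)))
            (aV≋0 4F))

        recurrence₄ : moment 3F 3F + c₂ * moment 1F 3F + c₁ * moment 0F 3F + c₀ * moment 0F 1F ≈ 0#
        recurrence₄ = trans (recurrence-dot c₂ c₁ c₀ (moment 3F 3F) (moment 1F 3F) (moment 0F 3F) (moment 0F 1F))
          (trans (dot-linear (1# ∷ c₂ ∷ c₁ ∷ c₀ ∷ [])
            (λ i → let v = w (p i) in v 3F * v 3F ∷ v 1F * v 3F ∷ v 0F * v 3F ∷ v 0F * v 1F ∷ [])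
            (λ i → let v = w (p i) in recurrence-dot c₂ c₁ c₀ (v 3F * v 3F) (v 1F * v 3F) (v 0F * v 3F) (v 0F * v 1F)))
            (aV≋0 5F))

        annihilated : ∀ l → (∀ i → a i * dot l (w (p i)) ≈ 0#) → ∀ j → dot l (moment j) ≈ 0#
        annihilated l al≈0 j = begin
          dot l (moment j)                              ≈⟨ dot-combination l a (λ i → w (p i) j • w (p i)) ⟩
          dot a (λ i → dot l (w (p i) j • w (p i)))     ≈⟨ dot-zero a _ (λ i → by₁ (trans
              (*-congˡ (trans (dot-comm l (w (p i) j • w (p i)))
                (trans (dot-scaleˡ (w (p i) j) (w (p i)) l) (*-congˡ (dot-comm (w (p i)) l)))))
              (solve 3 (λ a w d → a :* (w :* d) := w :* (a :* d)) ≡.refl (a i) (w (p i) j) (dot l (w (p i)))))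
              (al≈0 i)) ⟩
          0#                                            ∎

        -- The row and column of y are zero, so (`l 0F`, `l 1F`, `l 3F`) is in the kernel of the
        -- Hankel matrix; if it is nonzero, `hankel-nonsingular` applies.
        moments-vanish : ∀ l → Nonzero l → (∀ i → a i * dot l (w (p i)) ≈ 0#) → ∀ j k → moment j k ≈ 0#
        moments-vanish l (r , lᵣ≉0) al≈0 = by-cases (l 0F ≟ 0#) (l 1F ≟ 0#) (l 3F ≟ 0#)
          where
          row : ∀ j {m₀ m₁ m₃} → moment j 0F ≈ m₀ → moment j 1F ≈ m₁ → moment j 3F ≈ m₃ →
            l 0F * m₀ + l 1F * m₁ + l 3F * m₃ ≈ 0#
          row j {m₀} {m₁} {m₃} eq₀ eq₁ eq₃ = begin
            l 0F * m₀ + l 1F * m₁ + l 3F * m₃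
              ≈⟨ +-cong (+-cong (*-congˡ eq₀) (*-congˡ eq₁)) (*-congˡ eq₃) ⟨
            l 0F * moment j 0F + l 1F * moment j 1F + l 3F * moment j 3F
              ≈⟨ by₂ (solve 8 (λ l₀ l₁ l₂ l₃ m₀ m₁ m₂ m₃ → l₀ :* m₀ :+ l₁ :* m₁ :+ l₃ :* m₃ :=
                   con (+ 1) :* (l₀ :* m₀ :+ (l₁ :* m₁ :+ (l₂ :* m₂ :+ (l₃ :* m₃ :+ con (+ 0))))) :+ :- l₂ :* m₂) ≡.refl
                   (l 0F) (l 1F) (l 2F) (l 3F) (moment j 0F) (moment j 1F) (moment j 2F) (moment j 3F))
                 (annihilated l al≈0 j) (trans (moment-sym j 2F) (moment-y j)) ⟩
            0# ∎

          nonsingular : ¬ (l 0F ≈ 0# × l 1F ≈ 0# × l 3F ≈ 0#) → ∀ j k → moment j k ≈ 0#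
          nonsingular l≉0 = entries
            where
            entries′ = hankel-nonsingular recurrence₃ recurrence₄
              (row 0F refl refl refl) (row 1F (moment-sym 1F 0F) moment-quadric refl)
              (row 3F (moment-sym 3F 0F) (moment-sym 3F 1F) refl) l≉0
            m₀ = proj₁ entries′
            m₁ = proj₁ (proj₂ entries′)
            m₂ = proj₁ (proj₂ (proj₂ entries′))
            m₃ = proj₁ (proj₂ (proj₂ (proj₂ entries′)))
            m₄ = proj₂ (proj₂ (proj₂ (proj₂ entries′)))

            entries : ∀ j k → moment j k ≈ 0#
            entries 0F 0F = m₀
            entries 0F 1F = m₁
            entries 0F 3F = m₂
            entries 1F 0F = trans (moment-sym 1F 0F) m₁
            entries 1F 1F = trans moment-quadric m₂
            entries 1F 3F = m₃
            entries 3F 0F = trans (moment-sym 3F 0F) m₂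
            entries 3F 1F = trans (moment-sym 3F 1F) m₃
            entries 3F 3F = m₄
            entries 2F k  = moment-y k
            entries 0F 2F = trans (moment-sym 0F 2F) (moment-y 0F)
            entries 1F 2F = trans (moment-sym 1F 2F) (moment-y 1F)
            entries 3F 2F = trans (moment-sym 3F 2F) (moment-y 3F)

          by-cases : Dec (l 0F ≈ 0#) → Dec (l 1F ≈ 0#) → Dec (l 3F ≈ 0#) → ∀ j k → moment j k ≈ 0#
          by-cases (no l₀≉0) _ _ = nonsingular (λ (l₀≈0 , _) → l₀≉0 l₀≈0)
          by-cases _ (no l₁≉0) _ = nonsingular (λ (_ , l₁≈0 , _) → l₁≉0 l₁≈0)
          by-cases _ _ (no l₃≉0) = nonsingular (λ (_ , _ , l₃≈0) → l₃≉0 l₃≈0)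
          -- Here `l` is a nonzero multiple of y, which equals 1 at every point, so the relation
          -- itself is trivial.
          by-cases (yes l₀≈0) (yes l₁≈0) (yes l₃≈0) j k = dot-zeroˡ (λ i → w (p i) j * w (p i) k) a≋0
            where
            l₂≉0 : ∀ r → l r ≉ 0# → l 2F ≉ 0#
            l₂≉0 0F l₀≉0 = contradiction l₀≈0 l₀≉0
            l₂≉0 1F l₁≉0 = contradiction l₁≈0 l₁≉0
            l₂≉0 2F l₂≉0 = l₂≉0
            l₂≉0 3F l₃≉0 = contradiction l₃≈0 l₃≉0

            a≋0 : a ≋ 𝟎
            a≋0 i = cancelˡ (l₂≉0 r lᵣ≉0) (by₄ (solve 8 (λ a l₀ l₁ l₂ l₃ τ x n → l₂ :* a :=
                con (+ 1) :* (a :* (l₀ :* τ :+ (l₁ :* x :+ (l₂ :* con (+ 1) :+ (l₃ :* n :+ con (+ 0))))))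
                :+ :- (a :* τ) :* l₀ :+ :- (a :* x) :* l₁ :+ :- (a :* n) :* l₃) ≡.refl
                (a i) (l 0F) (l 1F) (l 2F) (l 3F) (T (p i)) (X (p i)) (N (p i)))
              (al≈0 i) l₀≈0 l₁≈0 l₃≈0)

        -- The product of the linear forms α and β is a quadratic form, so its weighted sum over the
        -- points is a combination of moments; only the term at `k` survives in it.
        coefficient-vanishes : (∀ j k → moment j k ≈ 0#) → ∀ k {α β} →
          (∀ i → i ≢ k → dot α (w (p i)) ≈ 0# ⊎ dot β (w (p i)) ≈ 0#) →
          dot α (w (p k)) ≉ 0# → dot β (w (p k)) ≉ 0# → a k ≈ 0#
        coefficient-vanishes moments≈0 k {α} {β} others α≉0 β≉0 =
          cancelˡ (*≉0 α≉0 β≉0) (trans (*-comm _ (a k)) (begin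
            a k * (dot α (w (p k)) * dot β (w (p k)))                 ≈⟨ dot-single a _ k others-vanish ⟨
            dot a (λ i → dot α (w (p i)) * dot β (w (p i)))           ≈⟨ dot-linear α (λ i j → dot β (w (p i) j • w (p i))) expand ⟨
            dot α (combination a (λ i j → dot β (w (p i) j • w (p i))))  ≈⟨ dot-zeroʳ α (λ j →
                trans (sym (dot-combination β a (λ i → w (p i) j • w (p i)))) (dot-zeroʳ β (moments≈0 j))) ⟩
            0#                                                        ∎))
          where
          others-vanish : ∀ i → i ≢ k → a i * (dot α (w (p i)) * dot β (w (p i))) ≈ 0#
          others-vanish i i≢k with others i i≢k
          ... | inj₁ α≈0 = by₁ (solve 3 (λ a u v → a :* (u :* v) := a :* v :* u) ≡.refl (a i) _ _) α≈0
          ... | inj₂ β≈0 = by₁ (sym (*-assoc (a i) _ _)) β≈0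

          expand : ∀ i → dot α (w (p i)) * dot β (w (p i)) ≈ dot α (λ j → dot β (w (p i) j • w (p i)))
          expand i = begin
            dot α u * dot β u                    ≈⟨ *-comm _ _ ⟩
            dot β u * dot α u                    ≈⟨ *-congˡ (dot-comm α u) ⟩
            dot β u * dot u α                    ≈⟨ dot-scaleˡ (dot β u) u α ⟨
            dot (dot β u • u) α                  ≈⟨ dot-comm (dot β u • u) α ⟩
            dot α (dot β u • u)                  ≈⟨ dot-cong {a = α} (λ _ → refl) (λ j → begin
                dot β u * u j                      ≈⟨ *-comm _ _ ⟩
                u j * dot β u                      ≈⟨ *-congˡ (dot-comm β u) ⟩
                u j * dot u β                      ≈⟨ dot-scaleˡ (u j) u β ⟨
                dot (u j • u) β                    ≈⟨ dot-comm (u j • u) β ⟩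
                dot β (u j • u)                    ∎) ⟩
            dot α (λ j → dot β (u j • u))        ∎
            where
            u = w (p i)

      -- Planes separating the points of the elliptic quadric

      norm-anisotropic : ∀ {x y} → x * x + x * y + b * (y * y) ≈ 0# → x ≈ 0# × y ≈ 0#
      norm-anisotropic {x} {y} eq with y ≟ 0#
      ... | yes y≈0 = x≈0 (x ≟ 0#) , y≈0
        where
        x≈0 : Dec (x ≈ 0#) → x ≈ 0#
        x≈0 (yes x≈0) = x≈0
        x≈0 (no x≉0)  = cancelˡ x≉0 (by₂ (solve 3 (λ x y b → x :* x :=
          con (+ 1) :* (x :* x :+ x :* y :+ b :* (y :* y)) :+ :- (x :+ b :* y) :* y) ≡.refl x y b) eq y≈0)
      ... | no y≉0  = contradiction (by₂ (solve 4 (λ x y r b →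
            x :* r :* (x :* r) :+ x :* r :+ b :=
            r :* r :* (x :* x :+ x :* y :+ b :* (y :* y)) :+ (x :* r :+ b :* (y :* r :+ con (+ 1))) :* (con (+ 1) :- y :* r)) ≡.refl x y r b)
          eq (x≈y⇒x-y≈0 (sym (proj₂ (inverse y≉0))))) (b-rootless (x * r))
        where
        r = proj₁ (inverse y≉0)

      module _ (i j : I) where

        -- Up to a factor, real k + imag k ω = (t - tᵢ)(t̄ - t̄ⱼ), where t = (x + y ω) / τ and ω² = ω - b.
        real imag : Vector Carrier 4
        real = X i * X j + X i + b ∷ - (T i * X j + X i * T j + T i) ∷ - (X i * T j + b * T i + b * T j) ∷ T i * T j ∷ []
        imag = X j - X i ∷ T i - T j ∷ X i * T j - T i * X j ∷ 0# ∷ []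

        module _ (k : I) where

          Xᵢ Yᵢ Xⱼ Yⱼ : Carrier
          Xᵢ = X k * T i - X i * T k
          Yᵢ = T i - T k
          Xⱼ = X k * T j - X j * T k
          Yⱼ = T j - T k

          real-product : T k * dot real (w k) ≈ Xᵢ * Xⱼ + Xᵢ * Yⱼ + b * (Yᵢ * Yⱼ)
          real-product = x-y≈0⇒x≈y (by₁ (solve 8 (λ τ x n τᵢ xᵢ τⱼ xⱼ b →
            let X₁ = x :* τᵢ :- xᵢ :* τ ; Y₁ = τᵢ :- τ ; X₂ = x :* τⱼ :- xⱼ :* τ ; Y₂ = τⱼ :- τ in
            τ :* ((xᵢ :* xⱼ :+ xᵢ :+ b) :* τ :+ (:- (τᵢ :* xⱼ :+ xᵢ :* τⱼ :+ τᵢ) :* x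
              :+ (:- (xᵢ :* τⱼ :+ b :* τᵢ :+ b :* τⱼ) :* con (+ 1) :+ (τᵢ :* τⱼ :* n :+ con (+ 0)))))
            :- (X₁ :* X₂ :+ X₁ :* Y₂ :+ b :* (Y₁ :* Y₂)) :=
            τᵢ :* τⱼ :* (τ :* n :- x :* x :- x :- b)) ≡.refl (T k) (X k) (N k) (T i) (X i) (T j) (X j) b) (on-quadric k))

          imag-product : T k * dot imag (w k) ≈ Yᵢ * Xⱼ - Xᵢ * Yⱼ
          imag-product = solve 7 (λ τ x n τᵢ xᵢ τⱼ xⱼ →
            let X₁ = x :* τᵢ :- xᵢ :* τ ; Y₁ = τᵢ :- τ ; X₂ = x :* τⱼ :- xⱼ :* τ ; Y₂ = τⱼ :- τ in
            τ :* ((xⱼ :- xᵢ) :* τ :+ ((τᵢ :- τⱼ) :* x :+ ((xᵢ :* τⱼ :- τᵢ :* xⱼ) :* con (+ 1) :+ (con (+ 0) :* n :+ con (+ 0))))) :=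
            Y₁ :* X₂ :- X₁ :* Y₂) ≡.refl (T k) (X k) (N k) (T i) (X i) (T j) (X j)

      same-point : ∀ i k → Xᵢ i i k ≈ 0# → Yᵢ i i k ≈ 0# → i ≡ k
      same-point i k X≈0 Y≈0 = distinct (x-y≈0⇒x≈y Y≈0) (x-y≈0⇒x≈y (cancelˡ (T≉0 k)
        (by₂ (solve 4 (λ τ x τᵢ xᵢ → τ :* (xᵢ :- x) := :- con (+ 1) :* (x :* τᵢ :- xᵢ :* τ) :+ x :* (τᵢ :- τ)) ≡.refl
          (T k) (X k) (T i) (X i)) X≈0 Y≈0)))

      vanish-at : ∀ i j k → k ≡ i ⊎ k ≡ j → dot (real i j) (w k) ≈ 0# × dot (imag i j) (w k) ≈ 0#
      vanish-at i j k (inj₁ ≡.refl) =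
          cancelˡ (T≉0 i) (trans (real-product i j i) (solve 5 (λ τ x τⱼ xⱼ b →
            let X₁ = x :* τ :- x :* τ ; Y₁ = τ :- τ ; X₂ = x :* τⱼ :- xⱼ :* τ ; Y₂ = τⱼ :- τ in
            X₁ :* X₂ :+ X₁ :* Y₂ :+ b :* (Y₁ :* Y₂) := con (+ 0)) ≡.refl (T i) (X i) (T j) (X j) b))
        , cancelˡ (T≉0 i) (trans (imag-product i j i) (solve 4 (λ τ x τⱼ xⱼ →
            let X₁ = x :* τ :- x :* τ ; Y₁ = τ :- τ ; X₂ = x :* τⱼ :- xⱼ :* τ ; Y₂ = τⱼ :- τ in
            Y₁ :* X₂ :- X₁ :* Y₂ := con (+ 0)) ≡.refl (T i) (X i) (T j) (X j)))
      vanish-at i j k (inj₂ ≡.refl) =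
          cancelˡ (T≉0 j) (trans (real-product i j j) (solve 5 (λ τ x τᵢ xᵢ b →
            let X₁ = x :* τᵢ :- xᵢ :* τ ; Y₁ = τᵢ :- τ ; X₂ = x :* τ :- x :* τ ; Y₂ = τ :- τ in
            X₁ :* X₂ :+ X₁ :* Y₂ :+ b :* (Y₁ :* Y₂) := con (+ 0)) ≡.refl (T j) (X j) (T i) (X i) b))
        , cancelˡ (T≉0 j) (trans (imag-product i j j) (solve 4 (λ τ x τᵢ xᵢ →
            let X₁ = x :* τᵢ :- xᵢ :* τ ; Y₁ = τᵢ :- τ ; X₂ = x :* τ :- x :* τ ; Y₂ = τ :- τ in
            Y₁ :* X₂ :- X₁ :* Y₂ := con (+ 0)) ≡.refl (T j) (X j) (T i) (X i)))

      -- Both planes `real i j` and `imag i j` pass through the points i and j. If both passed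
      -- through k, then (t - tᵢ)(t̄ - t̄ⱼ) would vanish there, although its norm is the product of
      -- two nonzero norms.
      separate : ∀ i j k → i ≢ k → j ≢ k →
        ∃[ α ] (dot α (w i) ≈ 0# × dot α (w j) ≈ 0# × dot α (w k) ≉ 0#)
      separate i j k i≢k j≢k = by-cases (dot (real i j) (w k) ≟ 0#) (dot (imag i j) (w k) ≟ 0#)
        where
        at-i = vanish-at i j i (inj₁ ≡.refl)
        at-j = vanish-at i j j (inj₂ ≡.refl)

        nonzero-norm : ∀ i → i ≢ k → Xᵢ i i k * Xᵢ i i k + Xᵢ i i k * Yᵢ i i k + b * (Yᵢ i i k * Yᵢ i i k) ≉ 0#
        nonzero-norm i i≢k eq = let X≈0 , Y≈0 = norm-anisotropic eq in i≢k (same-point i k X≈0 Y≈0)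

        by-cases : Dec _ → Dec _ → _
        by-cases (no re≉0) _ = real i j , proj₁ at-i , proj₁ at-j , re≉0
        by-cases _ (no im≉0) = imag i j , proj₂ at-i , proj₂ at-j , im≉0
        by-cases (yes re≈0) (yes im≈0) = contradiction
          (by₂ (solve 5 (λ x₁ y₁ x₂ y₂ b →
              let re = x₁ :* x₂ :+ x₁ :* y₂ :+ b :* (y₁ :* y₂) ; im = y₁ :* x₂ :- x₁ :* y₂ in
              (x₁ :* x₁ :+ x₁ :* y₁ :+ b :* (y₁ :* y₁)) :* (x₂ :* x₂ :+ x₂ :* y₂ :+ b :* (y₂ :* y₂)) :=
              (re :+ im) :* re :+ b :* im :* im) ≡.refl (Xᵢ i j k) (Yᵢ i j k) (Xⱼ i j k) (Yⱼ i j k) b)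
            (trans (sym (real-product i j k)) (by₁ refl re≈0))
            (trans (sym (imag-product i j k)) (by₁ refl im≈0)))
          (*≉0 (nonzero-norm i i≢k) (nonzero-norm j j≢k))

      -- The product of two separating planes kills up to four other points.
      relation-trivial : ∀ {n} (p : Fin n → I) → Injective _≡_ _≡_ p → ∀ a → combination a (V ∘ p) ≋ 𝟎 →
        ∀ l → Nonzero l → (∀ i → a i * dot l (w (p i)) ≈ 0#) →
        ∀ k (o : Fin 4 → Fin n) → (∀ r → o r ≢ k) → (∀ i → i ≢ k → ∃[ r ] o r ≡ i) → a k ≈ 0#
      relation-trivial p p-inj a aV≋0 l l≉0 al≈0 k o o≢k others =
        let α , α₀≈0 , α₁≈0 , α≉0 = separate (p (o 0F)) (p (o 1F)) (p k) (o≢k 0F ∘ p-inj) (o≢k 1F ∘ p-inj)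
            β , β₂≈0 , β₃≈0 , β≉0 = separate (p (o 2F)) (p (o 3F)) (p k) (o≢k 2F ∘ p-inj) (o≢k 3F ∘ p-inj)
            kill = λ i i≢k → case-kill α β α₀≈0 α₁≈0 β₂≈0 β₃≈0 (others i i≢k)
        in coefficient-vanishes (moments-vanish l l≉0 al≈0) k {α} {β} kill α≉0 β≉0
        where
        open Relation p a aV≋0

        case-kill : ∀ α β {i} → dot α (w (p (o 0F))) ≈ 0# → dot α (w (p (o 1F))) ≈ 0# →
          dot β (w (p (o 2F))) ≈ 0# → dot β (w (p (o 3F))) ≈ 0# → ∃[ r ] o r ≡ i →
          dot α (w (p i)) ≈ 0# ⊎ dot β (w (p i)) ≈ 0#
        case-kill α β α₀≈0 α₁≈0 β₂≈0 β₃≈0 (0F , ≡.refl) = inj₁ α₀≈0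
        case-kill α β α₀≈0 α₁≈0 β₂≈0 β₃≈0 (1F , ≡.refl) = inj₁ α₁≈0
        case-kill α β α₀≈0 α₁≈0 β₂≈0 β₃≈0 (2F , ≡.refl) = inj₂ β₂≈0
        case-kill α β α₀≈0 α₁≈0 β₂≈0 β₃≈0 (3F , ≡.refl) = inj₂ β₃≈0

      -- The plane through the images of the three points other than `k` serves as `l`;
      -- `annihilates-last` deals with `k` itself.
      independent₄ : (p : Fin 4 → I) → Injective _≡_ _≡_ p → LinearlyIndependent (V ∘ p)
      independent₄ p p-inj a aV≋0 k =
        let l , l≉0 , lw≈0 = annihilator (ℕ.n<1+n 3) (w ∘ p ∘ punchIn k)
            lw≈0′ = λ i i≢k → ≡.subst (λ i → dot l (w (p i)) ≈ 0#) (punchIn-punchOut (i≢k ∘ ≡.sym)) (lw≈0 (punchOut (i≢k ∘ ≡.sym)))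
        in relation-trivial p p-inj a aV≋0 l l≉0 (annihilates-last l k lw≈0′) k (punchIn k ∘ twice)
             (λ r → punchInᵢ≢i k (twice r))
             (λ i i≢k → let j = punchOut (i≢k ∘ ≡.sym) in
               untwice j , ≡.trans (≡.cong (punchIn k) (twice-untwice j)) (punchIn-punchOut (i≢k ∘ ≡.sym)))
        where
        open Relation p a aV≋0

        -- `relation-trivial` asks for four other points; there are only three, so one is listed
        -- twice.
        twice : Fin 4 → Fin 3
        twice = 0F ∷ 1F ∷ 2F ∷ 2F ∷ []

        untwice : Fin 3 → Fin 4
        untwice = 0F ∷ 1F ∷ 2F ∷ []

        twice-untwice : ∀ j → twice (untwice j) ≡ j
        twice-untwice 0F = ≡.refl
        twice-untwice 1F = ≡.refl
        twice-untwice 2F = ≡.refl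

      -- Five points in a solid satisfy a nontrivial relation. If the images of the last four were
      -- dependent, one plane would contain all four, and `annihilates-last` would extend it to the
      -- first point; then `relation-trivial` kills that relation.
      general-position : (W : Vector (Vector Carrier 6) 4) (p : Fin 5 → I) → Injective _≡_ _≡_ p →
        (∀ i → InSpan W (V (p i))) → LinearlyIndependent (w ∘ p ∘ suc)
      general-position W p p-inj inW a aw≋0 k with a k ≟ 0#
      ... | yes aₖ≈0 = aₖ≈0
      ... | no aₖ≉0  =
        let l , l≉0 , lw≈0 = annihilator (ℕ.n<1+n 3) (w ∘ p ∘ suc ∘ punchIn k)
            e , (i , eᵢ≉0) , eV≋0 = span-dependent (ℕ.n<1+n 4) W (V ∘ p) inW
        in contradiction (relation-trivial p p-inj e eV≋0 l l≉0
             (Relation.annihilates-last p e eV≋0 l 0F (λ { 0F 0≢0 → contradiction ≡.refl 0≢0 ; (suc i) _ → kills l lw≈0 i }))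
             i (punchIn i) (punchInᵢ≢i i) (λ j j≢i → punchOut (j≢i ∘ ≡.sym) , punchIn-punchOut (j≢i ∘ ≡.sym))) eᵢ≉0
        where
        kills : ∀ l → (∀ j → dot l (w (p (suc (punchIn k j)))) ≈ 0#) → ∀ i → dot l (w (p (suc i))) ≈ 0#
        kills l lw≈0 i with i Fin.≟ k
        ... | no i≢k     = ≡.subst (λ i → dot l (w (p (suc i))) ≈ 0#) (punchIn-punchOut (i≢k ∘ ≡.sym)) (lw≈0 _)
        ... | yes ≡.refl = cancelˡ aₖ≉0 (begin
          a k * dot l (w (p (suc k)))             ≈⟨ dot-single a (λ i → dot l (w (p (suc i)))) k (λ i i≢k →
                by₁ refl (≡.subst (λ i → dot l (w (p (suc i))) ≈ 0#) (punchIn-punchOut (i≢k ∘ ≡.sym)) (lw≈0 _))) ⟨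
          dot a (λ i → dot l (w (p (suc i))))     ≈⟨ dot-combination l a (w ∘ p ∘ suc) ⟨
          dot l (combination a (w ∘ p ∘ suc))     ≈⟨ dot-zeroʳ l aw≋0 ⟩
          0#                                      ∎)

      -- No six points in a solid

      module SixPoints (W : Vector (Vector Carrier 6) 4) (p : Fin 6 → I) (p-inj : Injective _≡_ _≡_ p)
        (inW : ∀ i → InSpan W (V (p i))) where

        four : (σ : Fin 5 → Fin 6) → Injective _≡_ _≡_ σ → LinearlyIndependent (w ∘ p ∘ σ ∘ suc)
        four σ σ-inj = general-position W (p ∘ σ) (σ-inj ∘ p-inj) (inW ∘ σ)

        -- The leading entry is the extra point demanded by general-position.
        σ₀₁₂₃ σ₄₀₁₂ σ₅₀₁₂ σ₄₅₀₃ : Fin 5 → Fin 6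
        σ₀₁₂₃ = 4F ∷ 0F ∷ 1F ∷ 2F ∷ 3F ∷ []
        σ₄₀₁₂ = 5F ∷ 4F ∷ 0F ∷ 1F ∷ 2F ∷ []
        σ₅₀₁₂ = 4F ∷ 5F ∷ 0F ∷ 1F ∷ 2F ∷ []
        σ₄₅₀₃ = 1F ∷ 4F ∷ 5F ∷ 0F ∷ 3F ∷ []

        v : Vector (Vector Carrier 4) 4
        v = w ∘ p ∘ σ₀₁₂₃ ∘ suc

        v-independent : LinearlyIndependent v
        v-independent = four σ₀₁₂₃ (injective-by-decision σ₀₁₂₃)

        -- Adjoining `unit k` to the four generators still leaves only five conditions on six
        -- coefficients. Taking k = 5 or k = 4 separates `F₁` from `F₂`.
        functional : ∀ k → ∃[ h ] (Nonzero h × h k ≈ 0# × ∀ i → dot h (V (p i)) ≈ 0#)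
        functional k =
          let h , h≉0 , hW≈0 = annihilator (ℕ.n<1+n 5) (unit k ∷ W)
          in h , h≉0 , trans (sym (dot-unit h k)) (hW≈0 zero) , λ i → annihilates-span h {v = W} (hW≈0 ∘ suc) (inW i)

        plane : Vector Carrier 6 → Vector Carrier 4
        plane h = h 1F ∷ h 2F ∷ h 0F ∷ h 3F ∷ []

        -- A hyperplane that involves neither `F₁` nor `F₂` is a plane in the coordinates of `w`,
        -- and it would contain four independent images.
        not-plane : ∀ h → Nonzero h → (∀ i → dot h (V (p i)) ≈ 0#) → h 4F ≈ 0# → h 5F ≈ 0# → ⊥
        not-plane h (k , hₖ≉0) hV≈0 h₄≈0 h₅≈0 = hₖ≉0 (h≋0 k)
          where
          plane≋0 : plane h ≋ 𝟎
          plane≋0 = annihilates-basis {v = v} v-independent (λ r → let i = p (σ₀₁₂₃ (suc r)) in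
            by₃ (solve 11 (λ h₀ h₁ h₂ h₃ h₄ h₅ τ x n f g →
              h₁ :* τ :+ (h₂ :* x :+ (h₀ :* con (+ 1) :+ (h₃ :* n :+ con (+ 0)))) :=
              con (+ 1) :* (h₀ :* con (+ 1) :+ (h₁ :* τ :+ (h₂ :* x :+ (h₃ :* n :+ (h₄ :* f :+ (h₅ :* g :+ con (+ 0)))))))
              :+ :- f :* h₄ :+ :- g :* h₅) ≡.refl
              (h 0F) (h 1F) (h 2F) (h 3F) (h 4F) (h 5F) (T i) (X i) (N i) (V i 4F) (V i 5F))
            (hV≈0 (σ₀₁₂₃ (suc r))) h₄≈0 h₅≈0)

          h≋0 : h ≋ 𝟎
          h≋0 0F = plane≋0 2F
          h≋0 1F = plane≋0 0F
          h≋0 2F = plane≋0 1F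
          h≋0 3F = plane≋0 3F
          h≋0 4F = h₄≈0
          h≋0 5F = h₅≈0

        -- The factor `1#` is the coordinate y of `w`, so the equation is literally the vanishing of
        -- `h₁` at the points.
        normal-form₁ : ∃[ L ] ∀ i → V (p i) 4F + 1# * dot L (w (p i)) ≈ 0#
        normal-form₁ =
          let h , h≉0 , h₅≈0 , hV≈0 = functional 5F
              t , h₄t≈1 = inverse (λ h₄≈0 → not-plane h h≉0 hV≈0 h₄≈0 h₅≈0)
          in t • plane h , λ i → by₃ (solve 12 (λ h₀ h₁ h₂ h₃ h₄ h₅ τ x n f g t →
              f :+ con (+ 1) :* (t :* h₁ :* τ :+ (t :* h₂ :* x :+ (t :* h₀ :* con (+ 1) :+ (t :* h₃ :* n :+ con (+ 0))))) :=
              t :* (h₀ :* con (+ 1) :+ (h₁ :* τ :+ (h₂ :* x :+ (h₃ :* n :+ (h₄ :* f :+ (h₅ :* g :+ con (+ 0)))))))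
              :+ :- (t :* g) :* h₅ :+ f :* (con (+ 1) :- h₄ :* t)) ≡.refl
              (h 0F) (h 1F) (h 2F) (h 3F) (h 4F) (h 5F) (T (p i)) (X (p i)) (N (p i)) (V (p i) 4F) (V (p i) 5F) t)
            (hV≈0 i) h₅≈0 (x≈y⇒x-y≈0 (sym h₄t≈1))

        normal-form₂ : ∃[ M ] ∀ i → V (p i) 5F + 1# * dot M (w (p i)) ≈ 0#
        normal-form₂ =
          let h , h≉0 , h₄≈0 , hV≈0 = functional 4F
              t , h₅t≈1 = inverse (λ h₅≈0 → not-plane h h≉0 hV≈0 h₄≈0 h₅≈0)
          in t • plane h , λ i → by₃ (solve 12 (λ h₀ h₁ h₂ h₃ h₄ h₅ τ x n f g t →
              g :+ con (+ 1) :* (t :* h₁ :* τ :+ (t :* h₂ :* x :+ (t :* h₀ :* con (+ 1) :+ (t :* h₃ :* n :+ con (+ 0))))) :=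
              t :* (h₀ :* con (+ 1) :+ (h₁ :* τ :+ (h₂ :* x :+ (h₃ :* n :+ (h₄ :* f :+ (h₅ :* g :+ con (+ 0)))))))
              :+ :- (t :* f) :* h₄ :+ g :* (con (+ 1) :- h₅ :* t)) ≡.refl
              (h 0F) (h 1F) (h 2F) (h 3F) (h 4F) (h 5F) (T (p i)) (X (p i)) (N (p i)) (V (p i) 4F) (V (p i) 5F) t)
            (hV≈0 i) h₄≈0 (x≈y⇒x-y≈0 (sym h₅t≈1))

        open FiveQuadrics (proj₁ normal-form₁) (proj₁ normal-form₂)

        quadrics-at-points : ∀ i k → quadrics (w (p i)) k ≈ 0#
        quadrics-at-points i = quadrics-vanish (w (p i)) refl
          (trans (solve 4 (λ τ x n b → τ :* n :- x :* x :- x :* con (+ 1) :- b :* (con (+ 1) :* con (+ 1)) :=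
            τ :* n :- x :* x :- x :- b) ≡.refl (T (p i)) (X (p i)) (N (p i)) b) (on-quadric (p i)))
          (proj₂ normal-form₁ i) (proj₂ normal-form₂ i)

        -- Five quadrics allow four further conditions, here zeros at v₀ + v₁, v₀ + v₂, v₀ + v₃ and
        -- v₁ + v₂. With the zeros at the basis `v` only the coefficients `P` and `R` survive, and
        -- points 4 and 5 give two equations for them.
        combination-of-quadrics : ∃[ ε ] (Nonzero ε ×
          combination ε (λ k (r : Fin 4) → quadrics (nodes v (4 ↑ʳ (r ↑ˡ 2))) k) ≋ 𝟎)
        combination-of-quadrics = dependent (ℕ.n<1+n 4) (λ k (r : Fin 4) → quadrics (nodes v (4 ↑ʳ (r ↑ˡ 2))) k)

        ε : Vector Carrier 5
        ε = proj₁ combination-of-quadrics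

        G : Vector Carrier 4 → Carrier
        G x = dot ε (quadrics x)

        G-quadratic : Quadratic G
        G-quadratic = dot-quadratic ε quadrics-quadratic

        G-at-points : ∀ i → G (w (p i)) ≈ 0#
        G-at-points i = dot-zeroʳ ε (quadrics-at-points i)

        G-at-nodes : ∀ r → G (nodes v (4 ↑ʳ (r ↑ˡ 2))) ≈ 0#
        G-at-nodes = proj₂ (proj₂ combination-of-quadrics)

        P R : Carrier
        P = G (nodes v 8F)
        R = G (nodes v 9F)

        G-formula : ∀ {x} u → x ≋ combination u v → G x ≈ u 3F * (u 1F * P + u 2F * R)
        G-formula {x} u x≋ = begin
          G x                                      ≈⟨ cong-quad G-quadratic x≋ ⟩
          G (combination u v)                      ≈⟨ interpolate G-quadratic u v ⟩
          dot (weights u) (G ∘ nodes v)            ≈⟨ dot-cong {a = weights u} (λ _ → refl) values ⟩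
          dot (weights u) (0# ∷ 0# ∷ 0# ∷ 0# ∷ 0# ∷ 0# ∷ 0# ∷ 0# ∷ P ∷ R ∷ [])
            ≈⟨ solve 12 (λ u₁ u₂ u₃ w₀ w₁ w₂ w₃ w₄ w₅ w₆ P R →
                 let w₇ = u₁ :* u₂ ; z = con (+ 0) in
                 w₀ :* z :+ (w₁ :* z :+ (w₂ :* z :+ (w₃ :* z :+ (w₄ :* z :+ (w₅ :* z :+ (w₆ :* z :+ (w₇ :* z :+
                 (u₁ :* u₃ :* P :+ (u₂ :* u₃ :* R :+ z))))))))) := u₃ :* (u₁ :* P :+ u₂ :* R)) ≡.refl
                 (u 1F) (u 2F) (u 3F) (weights u 0F) (weights u 1F) (weights u 2F) (weights u 3F)
                 (weights u 4F) (weights u 5F) (weights u 6F) P R ⟩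
          u 3F * (u 1F * P + u 2F * R)             ∎
          where
          values : ∀ r → G (nodes v r) ≈ (0# ∷ 0# ∷ 0# ∷ 0# ∷ 0# ∷ 0# ∷ 0# ∷ 0# ∷ P ∷ R ∷ []) r
          values 0F = G-at-points 0F
          values 1F = G-at-points 1F
          values 2F = G-at-points 2F
          values 3F = G-at-points 3F
          values 4F = G-at-nodes 0F
          values 5F = G-at-nodes 1F
          values 6F = G-at-nodes 2F
          values 7F = G-at-nodes 3F
          values 8F = refl
          values 9F = refl

        coordinates : ∀ x → InSpan v x
        coordinates = basis-spans {v = v} v-independent

        -- Otherwise the point is coplanar with points 0, 1 and 2, against `ind`.
        last-coordinate≉0 : ∀ {i} (u : Vector Carrier 4) → LinearlyIndependent (w ∘ p ∘ (i ∷ 0F ∷ 1F ∷ 2F ∷ [])) →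
          w (p i) ≋ combination u v → u 3F ≉ 0#
        last-coordinate≉0 {i} u ind w≋ u₃≈0 = 1≉0 (ind (1# ∷ - u 0F ∷ - u 1F ∷ - u 2F ∷ []) (λ j →
          by₂ (solve 9 (λ x u₀ u₁ u₂ u₃ v₀ v₁ v₂ v₃ →
              con (+ 1) :* x :+ (:- u₀ :* v₀ :+ (:- u₁ :* v₁ :+ (:- u₂ :* v₂ :+ con (+ 0)))) :=
              con (+ 1) :* (x :- (u₀ :* v₀ :+ (u₁ :* v₁ :+ (u₂ :* v₂ :+ (u₃ :* v₃ :+ con (+ 0)))))) :+ v₃ :* u₃) ≡.refl
              (w (p i) j) (u 0F) (u 1F) (u 2F) (u 3F) (v 0F j) (v 1F j) (v 2F j) (v 3F j))
            (x≈y⇒x-y≈0 (w≋ j)) u₃≈0) 0F)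

        s t : Vector Carrier 4
        s = proj₁ (coordinates (w (p 4F)))
        t = proj₁ (coordinates (w (p 5F)))

        s-eq : ∀ j → w (p 4F) j - combination s v j ≈ 0#
        s-eq j = x≈y⇒x-y≈0 (proj₂ (coordinates (w (p 4F))) j)

        t-eq : ∀ j → w (p 5F) j - combination t v j ≈ 0#
        t-eq j = x≈y⇒x-y≈0 (proj₂ (coordinates (w (p 5F))) j)

        relation-s : s 1F * P + s 2F * R ≈ 0#
        relation-s = cancelˡ (last-coordinate≉0 s (four σ₄₀₁₂ (injective-by-decision σ₄₀₁₂)) (proj₂ (coordinates (w (p 4F)))))
          (trans (sym (G-formula s (proj₂ (coordinates (w (p 4F)))))) (G-at-points 4F))

        relation-t : t 1F * P + t 2F * R ≈ 0#
        relation-t = cancelˡ (last-coordinate≉0 t (four σ₅₀₁₂ (injective-by-decision σ₅₀₁₂)) (proj₂ (coordinates (w (p 5F)))))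
          (trans (sym (G-formula t (proj₂ (coordinates (w (p 5F)))))) (G-at-points 5F))

        -- The determinant of the two equations for `P` and `R`. Modulo points 0 and 3, the points 4
        -- and 5 have coordinates (s₁, s₂) and (t₁, t₂), so `D` is nonzero because these four points
        -- are not coplanar.
        D : Carrier
        D = s 1F * t 2F - s 2F * t 1F

        independent-4503 : LinearlyIndependent (w ∘ p ∘ (4F ∷ 5F ∷ 0F ∷ 3F ∷ []))
        independent-4503 = four σ₄₅₀₃ (injective-by-decision σ₄₅₀₃)

        D≉0 : D ≉ 0#
        D≉0 D≈0 = 1≉0 (independent-4503 (1# ∷ 0# ∷ - s 0F ∷ - s 3F ∷ []) (λ j → by₃
            (solve 10 (λ x y s₀ s₁ s₂ s₃ v₀ v₁ v₂ v₃ →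
              con (+ 1) :* x :+ (con (+ 0) :* y :+ (:- s₀ :* v₀ :+ (:- s₃ :* v₃ :+ con (+ 0)))) :=
              con (+ 1) :* (x :- (s₀ :* v₀ :+ (s₁ :* v₁ :+ (s₂ :* v₂ :+ (s₃ :* v₃ :+ con (+ 0))))))
              :+ v₁ :* s₁ :+ v₂ :* s₂) ≡.refl
              (w (p 4F) j) (w (p 5F) j) (s 0F) (s 1F) (s 2F) (s 3F) (v 0F j) (v 1F j) (v 2F j) (v 3F j))
            (s-eq j) s₁≈0 s₂≈0) 0F)
          where
          -- As D = 0, eliminating v₁ (or v₂) between points 4 and 5 eliminates v₂ (or v₁) as well.
          eliminate : ∀ k → LinearlyIndependent (w ∘ p ∘ (4F ∷ 5F ∷ 0F ∷ 3F ∷ [])) →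
            s 1F * t k - t 1F * s k ≈ 0# → s 2F * t k - t 2F * s k ≈ 0# → - s k ≈ 0#
          eliminate k ind e₁ e₂ = ind (t k ∷ - s k ∷ - (t k * s 0F - s k * t 0F) ∷ - (t k * s 3F - s k * t 3F) ∷ [])
            (λ j → by₄ (solve 16 (λ x y s₀ s₁ s₂ s₃ t₀ t₁ t₂ t₃ v₀ v₁ v₂ v₃ a c →
              c :* x :+ (:- a :* y :+ (:- (c :* s₀ :- a :* t₀) :* v₀ :+ (:- (c :* s₃ :- a :* t₃) :* v₃ :+ con (+ 0)))) :=
              c :* (x :- (s₀ :* v₀ :+ (s₁ :* v₁ :+ (s₂ :* v₂ :+ (s₃ :* v₃ :+ con (+ 0))))))
              :+ :- a :* (y :- (t₀ :* v₀ :+ (t₁ :* v₁ :+ (t₂ :* v₂ :+ (t₃ :* v₃ :+ con (+ 0))))))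
              :+ v₁ :* (s₁ :* c :- t₁ :* a) :+ v₂ :* (s₂ :* c :- t₂ :* a)) ≡.refl
              (w (p 4F) j) (w (p 5F) j) (s 0F) (s 1F) (s 2F) (s 3F) (t 0F) (t 1F) (t 2F) (t 3F)
              (v 0F j) (v 1F j) (v 2F j) (v 3F j) (s k) (t k)) (s-eq j) (t-eq j) e₁ e₂) 1F

          negate : ∀ {x} → - x ≈ 0# → x ≈ 0#
          negate {x} -x≈0 = by₁ (solve 1 (λ x → x := :- con (+ 1) :* (:- x)) ≡.refl x) -x≈0

          s₁≈0 : s 1F ≈ 0#
          s₁≈0 = negate (eliminate 1F independent-4503
            (solve 2 (λ s t → s :* t :- t :* s := con (+ 0)) ≡.refl (s 1F) (t 1F))
            (by₁ (solve 4 (λ s₁ s₂ t₁ t₂ → s₂ :* t₁ :- t₂ :* s₁ := :- con (+ 1) :* (s₁ :* t₂ :- s₂ :* t₁)) ≡.refl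
              (s 1F) (s 2F) (t 1F) (t 2F)) D≈0))

          s₂≈0 : s 2F ≈ 0#
          s₂≈0 = negate (eliminate 2F independent-4503
            (by₁ (solve 4 (λ s₁ s₂ t₁ t₂ → s₁ :* t₂ :- t₁ :* s₂ := con (+ 1) :* (s₁ :* t₂ :- s₂ :* t₁)) ≡.refl
              (s 1F) (s 2F) (t 1F) (t 2F)) D≈0)
            (solve 2 (λ s t → s :* t :- t :* s := con (+ 0)) ≡.refl (s 2F) (t 2F)))

        P≈0 : P ≈ 0#
        P≈0 = cancelˡ D≉0 (by₂ (solve 6 (λ s₁ s₂ t₁ t₂ P R → (s₁ :* t₂ :- s₂ :* t₁) :* P :=
          t₂ :* (s₁ :* P :+ s₂ :* R) :+ :- s₂ :* (t₁ :* P :+ t₂ :* R)) ≡.refl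
          (s 1F) (s 2F) (t 1F) (t 2F) P R) relation-s relation-t)

        R≈0 : R ≈ 0#
        R≈0 = cancelˡ D≉0 (by₂ (solve 6 (λ s₁ s₂ t₁ t₂ P R → (s₁ :* t₂ :- s₂ :* t₁) :* R :=
          :- t₁ :* (s₁ :* P :+ s₂ :* R) :+ s₁ :* (t₁ :* P :+ t₂ :* R)) ≡.refl
          (s 1F) (s 2F) (t 1F) (t 2F) P R) relation-s relation-t)

        G≈0 : ∀ x → G x ≈ 0#
        G≈0 x = let u , x≋ = coordinates x in trans (G-formula u x≋)
          (by₂ (solve 5 (λ u₁ u₂ u₃ P R → u₃ :* (u₁ :* P :+ u₂ :* R) := u₃ :* u₁ :* P :+ u₃ :* u₂ :* R) ≡.refl
            (u 1F) (u 2F) (u 3F) P R) P≈0 R≈0)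

        absurd : ⊥
        absurd = let k , εₖ≉0 = proj₁ (proj₂ combination-of-quadrics) in εₖ≉0 (Vanishing.coefficients≋0 ε G≈0 k)

      -- The points span the space

      module Complete (locate : ∀ τ x → τ ≉ 0# → ∃[ i ] (T i ≈ τ × X i ≈ x)) where

        module _ {u v w : Carrier} (u≉v : u ≉ v) (u≉w : u ≉ w) (v≉w : v ≉ w) where

          quadratic-zero : ∀ {a₂ a₁ a₀} → (∀ {y} → y ≈ u ⊎ y ≈ v ⊎ y ≈ w → a₂ * (y * y) + a₁ * y + a₀ ≈ 0#) →
            a₂ ≈ 0# × a₁ ≈ 0# × a₀ ≈ 0#
          quadratic-zero {a₂} {a₁} {a₀} zeros = a₂≈0 , a₁≈0 ,
            by₃ (solve 4 (λ a₂ a₁ a₀ u → a₀ := con (+ 1) :* (a₂ :* (u :* u) :+ a₁ :* u :+ a₀) :+ :- (u :* u) :* a₂ :+ :- u :* a₁)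
              ≡.refl a₂ a₁ a₀ u) at-u a₂≈0 a₁≈0
            where
            at-u : a₂ * (u * u) + a₁ * u + a₀ ≈ 0#
            at-u = zeros (inj₁ refl)

            difference : ∀ {y} → u ≉ y → a₂ * (y * y) + a₁ * y + a₀ ≈ 0# → a₂ * (u + y) + a₁ ≈ 0#
            difference {y} u≉y at-y = cancelˡ (x≉y⇒x-y≉0 u≉y) (by₂ (solve 5 (λ a₂ a₁ a₀ u y →
              (u :- y) :* (a₂ :* (u :+ y) :+ a₁) := con (+ 1) :* (a₂ :* (u :* u) :+ a₁ :* u :+ a₀)
              :+ :- con (+ 1) :* (a₂ :* (y :* y) :+ a₁ :* y :+ a₀)) ≡.refl a₂ a₁ a₀ u y) at-u at-y)

            d-v : a₂ * (u + v) + a₁ ≈ 0#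
            d-v = difference u≉v (zeros (inj₂ (inj₁ refl)))

            a₂≈0 : a₂ ≈ 0#
            a₂≈0 = cancelˡ (x≉y⇒x-y≉0 v≉w) (by₂ (solve 5 (λ a₂ a₁ u v w → (v :- w) :* a₂ :=
              con (+ 1) :* (a₂ :* (u :+ v) :+ a₁) :+ :- con (+ 1) :* (a₂ :* (u :+ w) :+ a₁)) ≡.refl a₂ a₁ u v w)
              d-v (difference u≉w (zeros (inj₂ (inj₂ refl)))))

            a₁≈0 : a₁ ≈ 0#
            a₁≈0 = by₂ (solve 4 (λ a₂ a₁ u v → a₁ := con (+ 1) :* (a₂ :* (u :+ v) :+ a₁) :+ :- (u :+ v) :* a₂) ≡.refl a₂ a₁ u v)
              d-v a₂≈0

          -- Three zeros do not make a cubic vanish, and a field of order 4 has no fourth nonzero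
          -- sample. Subtracting a₃ (y - u)(y - v)(y - w) leaves a quadratic with three zeros.
          cubic-zero : ∀ {a₃ a₂ a₁ a₀} → (∀ {y} → y ≈ u ⊎ y ≈ v ⊎ y ≈ w → a₃ * (y * y * y) + a₂ * (y * y) + a₁ * y + a₀ ≈ 0#) →
            a₂ + a₃ * (u + v + w) ≈ 0# × a₁ - a₃ * (u * v + v * w + w * u) ≈ 0#
          cubic-zero {a₃} {a₂} {a₁} {a₀} zeros =
            let e₂ , e₁ , _ = quadratic-zero {a₂ + a₃ * (u + v + w)} {a₁ - a₃ * (u * v + v * w + w * u)} {a₀ + a₃ * (u * v * w)} reduce
            in e₂ , e₁
            where
            vieta : ∀ y → y ≈ u ⊎ y ≈ v ⊎ y ≈ w → (y - u) * (y - v) * (y - w) ≈ 0#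
            vieta y (inj₁ eq)        = by₁ (solve 4 (λ y u v w → (y :- u) :* (y :- v) :* (y :- w) :=
              (y :- v) :* (y :- w) :* (y :- u)) ≡.refl y u v w) (x≈y⇒x-y≈0 eq)
            vieta y (inj₂ (inj₁ eq)) = by₁ (solve 4 (λ y u v w → (y :- u) :* (y :- v) :* (y :- w) :=
              (y :- u) :* (y :- w) :* (y :- v)) ≡.refl y u v w) (x≈y⇒x-y≈0 eq)
            vieta y (inj₂ (inj₂ eq)) = by₁ refl (x≈y⇒x-y≈0 eq)

            reduce : ∀ {y} → y ≈ u ⊎ y ≈ v ⊎ y ≈ w → (a₂ + a₃ * (u + v + w)) * (y * y) +
              (a₁ - a₃ * (u * v + v * w + w * u)) * y + (a₀ + a₃ * (u * v * w)) ≈ 0#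
            reduce {y} root = by₂ (solve 8 (λ a₃ a₂ a₁ a₀ u v w y →
              (a₂ :+ a₃ :* (u :+ v :+ w)) :* (y :* y) :+ (a₁ :- a₃ :* (u :* v :+ v :* w :+ w :* u)) :* y :+ (a₀ :+ a₃ :* (u :* v :* w)) :=
              con (+ 1) :* (a₃ :* (y :* y :* y) :+ a₂ :* (y :* y) :+ a₁ :* y :+ a₀) :+ :- a₃ :* ((y :- u) :* (y :- v) :* (y :- w)))
              ≡.refl a₃ a₂ a₁ a₀ u v w y) (zeros root) (vieta y root)

        module _ (l : Vector Carrier 6) (lV≈0 : ∀ i → dot l (V i) ≈ 0#) where

          -- For τ = 1 / y and x = ξ / y the quadric gives n = norm ξ y / y.
          norm : (ξ y : Carrier) → Carrier
          norm ξ y = ξ * ξ + ξ * y + b * (y * y)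

          -- y² times the functional at the point τ = 1 / y, x = ξ / y.
          form : (ξ y : Carrier) → Carrier
          form ξ y = l 0F * (y * y) + l 1F * y + l 2F * (ξ * y) + l 3F * (y * norm ξ y)
            + l 4F * (ξ * norm ξ y + c₂ * norm ξ y + c₁ * ξ + c₀)
            + l 5F * (norm ξ y * norm ξ y + c₂ * (ξ * norm ξ y) + c₁ * norm ξ y + c₀ * ξ)

          form-zero : ∀ ξ {y} → y ≉ 0# → form ξ y ≈ 0#
          form-zero ξ {y} y≉0 = by₂ (solve 12 (λ l₀ l₁ l₂ l₃ l₄ l₅ ξ y r n f g → let o = con (+ 1) in
              l₀ :* (y :* y) :+ l₁ :* y :+ l₂ :* (ξ :* y) :+ l₃ :* (y :* n) :+ l₄ :* f :+ l₅ :* g :=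
              y :* y :* (l₀ :* o :+ (l₁ :* r :+ (l₂ :* (ξ :* r) :+ (l₃ :* (n :* r)
                :+ (l₄ :* (r :* r :* f) :+ (l₅ :* (r :* r :* g) :+ con (+ 0)))))))
              :+ ((l₁ :+ l₂ :* ξ :+ l₃ :* n) :* y :+ (l₄ :* f :+ l₅ :* g) :* (o :+ y :* r)) :* (o :- y :* r))
              ≡.refl (l 0F) (l 1F) (l 2F) (l 3F) (l 4F) (l 5F) ξ y r (norm ξ y) f g)
            (trans (dot-cong {a = l} (λ _ → refl) coords≈) (lV≈0 i)) 1-yr≈0
            where
            r f g : Carrier
            r = proj₁ (inverse y≉0)
            f = ξ * norm ξ y + c₂ * norm ξ y + c₁ * ξ + c₀
            g = norm ξ y * norm ξ y + c₂ * (ξ * norm ξ y) + c₁ * norm ξ y + c₀ * ξ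

            1-yr≈0 : 1# - y * r ≈ 0#
            1-yr≈0 = x≈y⇒x-y≈0 (sym (proj₂ (inverse y≉0)))

            r≉0 : r ≉ 0#
            r≉0 r≈0 = 1≉0 (trans (sym (proj₂ (inverse y≉0))) (by₁ refl r≈0))

            i : I
            i = proj₁ (locate r (ξ * r) r≉0)

            T≈ : T i ≈ r
            T≈ = proj₁ (proj₂ (locate r (ξ * r) r≉0))

            X≈ : X i ≈ ξ * r
            X≈ = proj₂ (proj₂ (locate r (ξ * r) r≉0))

            N≈ : N i ≈ norm ξ y * r
            N≈ = x-y≈0⇒x≈y (cancelˡ (T≉0 i) (by₄ (solve 7 (λ t x n ξ y r b → let o = con (+ 1) in
                t :* (n :- (ξ :* ξ :+ ξ :* y :+ b :* (y :* y)) :* r) :=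
                o :* (t :* n :- x :* x :- x :- b)
                :+ :- ((ξ :* ξ :+ ξ :* y :+ b :* (y :* y)) :* r) :* (t :- r)
                :+ (x :+ ξ :* r :+ o) :* (x :- ξ :* r)
                :+ (ξ :* r :+ b :* (o :+ y :* r)) :* (o :- y :* r)) ≡.refl (T i) (X i) (N i) ξ y r b)
              (on-quadric i) (x≈y⇒x-y≈0 T≈) (x≈y⇒x-y≈0 X≈) 1-yr≈0))

            coords≈ : (1# ∷ r ∷ ξ * r ∷ norm ξ y * r ∷ r * r * f ∷ r * r * g ∷ []) ≋ V i
            coords≈ 0F = refl
            coords≈ 1F = sym T≈
            coords≈ 2F = sym X≈
            coords≈ 3F = sym N≈
            coords≈ 4F = sym (trans (+-cong (+-cong (+-cong (*-cong X≈ N≈) (*-congˡ (*-cong T≈ N≈)))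
              (*-congˡ (*-cong T≈ X≈))) (*-congˡ (*-cong T≈ T≈)))
              (solve 6 (λ ξ n r c₂ c₁ c₀ → ξ :* r :* (n :* r) :+ c₂ :* (r :* (n :* r)) :+ c₁ :* (r :* (ξ :* r)) :+ c₀ :* (r :* r) :=
                r :* r :* (ξ :* n :+ c₂ :* n :+ c₁ :* ξ :+ c₀)) ≡.refl ξ (norm ξ y) r c₂ c₁ c₀))
            coords≈ 5F = sym (trans (+-cong (+-cong (+-cong (*-cong N≈ N≈) (*-congˡ (*-cong X≈ N≈)))
              (*-congˡ (*-cong T≈ N≈))) (*-congˡ (*-cong T≈ X≈)))
              (solve 6 (λ ξ n r c₂ c₁ c₀ → n :* r :* (n :* r) :+ c₂ :* (ξ :* r :* (n :* r)) :+ c₁ :* (r :* (n :* r)) :+ c₀ :* (r :* (ξ :* r)) :=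
                r :* r :* (n :* n :+ c₂ :* (ξ :* n) :+ c₁ :* n :+ c₀ :* ξ)) ≡.refl ξ (norm ξ y) r c₂ c₁ c₀))

          module _ {u v w′ : Carrier} (u≉0 : u ≉ 0#) (v≉0 : v ≉ 0#) (w≉0 : w′ ≉ 0#)
            (u≉v : u ≉ v) (u≉w : u ≉ w′) (v≉w : v ≉ w′) where

            sample≉0 : ∀ {y} → y ≈ u ⊎ y ≈ v ⊎ y ≈ w′ → y ≉ 0#
            sample≉0 (inj₁ y≈u) y≈0        = u≉0 (trans (sym y≈u) y≈0)
            sample≉0 (inj₂ (inj₁ y≈v)) y≈0 = v≉0 (trans (sym y≈v) y≈0)
            sample≉0 (inj₂ (inj₂ y≈w)) y≈0 = w≉0 (trans (sym y≈w) y≈0)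

            e₁ e₂ : Carrier
            e₁ = u + v + w′
            e₂ = u * v + v * w′ + w′ * u

            -- Coefficients of (form ξ y - form 0 y) / ξ as a cubic in ξ with leading coefficient
            -- `l 5F`. The quartic `form` is also zero at ξ = 0, and using this lowers the degree to
            -- one that three nonzero samples control.
            A B C : Carrier → Carrier
            A y = l 5F * (y + y + c₂) + l 4F
            B y = l 5F * ((1# + (b + b)) * (y * y) + c₂ * y + c₁) + l 4F * (y + c₂) + l 3F * y
            C y = l 5F * ((b + b) * (y * y * y) + c₂ * (b * (y * y)) + c₁ * y + c₀) + l 4F * (b * (y * y) + c₂ * y + c₁)
              + l 3F * (y * y) + l 2F * y

            cubic : ∀ {ξ y} → ξ ≉ 0# → y ≉ 0# → l 5F * (ξ * ξ * ξ) + A y * (ξ * ξ) + B y * ξ + C y ≈ 0#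
            cubic {ξ} {y} ξ≉0 y≉0 = cancelˡ ξ≉0 (by₂ (solve 12 (λ l₀ l₁ l₂ l₃ l₄ l₅ ξ y b c₀ c₁ c₂ →
                let o = con (+ 1)
                    A = l₅ :* (y :+ y :+ c₂) :+ l₄
                    B = l₅ :* ((o :+ (b :+ b)) :* (y :* y) :+ c₂ :* y :+ c₁) :+ l₄ :* (y :+ c₂) :+ l₃ :* y
                    C = l₅ :* ((b :+ b) :* (y :* y :* y) :+ c₂ :* (b :* (y :* y)) :+ c₁ :* y :+ c₀) :+ l₄ :* (b :* (y :* y) :+ c₂ :* y :+ c₁)
                        :+ l₃ :* (y :* y) :+ l₂ :* y
                    n = ξ :* ξ :+ ξ :* y :+ b :* (y :* y)
                    z = con (+ 0)
                    m = z :* z :+ z :* y :+ b :* (y :* y)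
                in ξ :* (l₅ :* (ξ :* ξ :* ξ) :+ A :* (ξ :* ξ) :+ B :* ξ :+ C) :=
                o :* (l₀ :* (y :* y) :+ l₁ :* y :+ l₂ :* (ξ :* y) :+ l₃ :* (y :* n)
                  :+ l₄ :* (ξ :* n :+ c₂ :* n :+ c₁ :* ξ :+ c₀) :+ l₅ :* (n :* n :+ c₂ :* (ξ :* n) :+ c₁ :* n :+ c₀ :* ξ))
                :+ :- o :* (l₀ :* (y :* y) :+ l₁ :* y :+ l₂ :* (z :* y) :+ l₃ :* (y :* m)
                  :+ l₄ :* (z :* m :+ c₂ :* m :+ c₁ :* z :+ c₀) :+ l₅ :* (m :* m :+ c₂ :* (z :* m) :+ c₁ :* m :+ c₀ :* z)))
                ≡.refl (l 0F) (l 1F) (l 2F) (l 3F) (l 4F) (l 5F) ξ y b c₀ c₁ c₂)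
              (form-zero ξ y≉0) (form-zero 0# y≉0))

            A-B : ∀ {y} → y ≈ u ⊎ y ≈ v ⊎ y ≈ w′ → A y + l 5F * e₁ ≈ 0# × B y - l 5F * e₂ ≈ 0#
            A-B {y} root = cubic-zero u≉v u≉w v≉w {l 5F} {A y} {B y} {C y} (λ root′ → cubic (sample≉0 root′) (sample≉0 root))

            A-coefficients : 0# ≈ 0# × l 5F + l 5F ≈ 0# × l 5F * c₂ + l 4F + l 5F * e₁ ≈ 0#
            A-coefficients = quadratic-zero u≉v u≉w v≉w (λ {y} root → trans
              (solve 5 (λ l₅ l₄ c₂ e₁ y → con (+ 0) :* (y :* y) :+ (l₅ :+ l₅) :* y :+ (l₅ :* c₂ :+ l₄ :+ l₅ :* e₁) :=
                l₅ :* (y :+ y :+ c₂) :+ l₄ :+ l₅ :* e₁) ≡.refl (l 5F) (l 4F) c₂ e₁ y) (proj₁ (A-B root)))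

            B-coefficients : l 5F * (1# + (b + b)) ≈ 0# × l 5F * c₂ + l 4F + l 3F ≈ 0# ×
              l 5F * c₁ + l 4F * c₂ - l 5F * e₂ ≈ 0#
            B-coefficients = quadratic-zero u≉v u≉w v≉w (λ {y} root → trans
              (solve 8 (λ l₅ l₄ l₃ c₂ c₁ e₂ b y →
                l₅ :* (con (+ 1) :+ (b :+ b)) :* (y :* y) :+ (l₅ :* c₂ :+ l₄ :+ l₃) :* y :+ (l₅ :* c₁ :+ l₄ :* c₂ :- l₅ :* e₂) :=
                l₅ :* ((con (+ 1) :+ (b :+ b)) :* (y :* y) :+ c₂ :* y :+ c₁) :+ l₄ :* (y :+ c₂) :+ l₃ :* y :- l₅ :* e₂)
                ≡.refl (l 5F) (l 4F) (l 3F) c₂ c₁ e₂ b y) (proj₂ (A-B root)))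

            -- The conditions 2 l₅ = 0 and (1 + 2 b) l₅ = 0 together settle every characteristic.
            l₅≈0 : l 5F ≈ 0#
            l₅≈0 = by₂ (solve 2 (λ l b → l := con (+ 1) :* (l :* (con (+ 1) :+ (b :+ b))) :+ :- b :* (l :+ l)) ≡.refl (l 5F) b)
              (proj₁ B-coefficients) (proj₁ (proj₂ A-coefficients))

            l₄≈0 : l 4F ≈ 0#
            l₄≈0 = by₂ (solve 4 (λ l₅ l₄ c₂ e₁ → l₄ := con (+ 1) :* (l₅ :* c₂ :+ l₄ :+ l₅ :* e₁) :+ :- (c₂ :+ e₁) :* l₅)
              ≡.refl (l 5F) (l 4F) c₂ e₁) (proj₂ (proj₂ A-coefficients)) l₅≈0

            l₃≈0 : l 3F ≈ 0#
            l₃≈0 = by₃ (solve 4 (λ l₅ l₄ l₃ c₂ → l₃ := con (+ 1) :* (l₅ :* c₂ :+ l₄ :+ l₃) :+ :- c₂ :* l₅ :+ :- con (+ 1) :* l₄)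
              ≡.refl (l 5F) (l 4F) (l 3F) c₂) (proj₁ (proj₂ B-coefficients)) l₅≈0 l₄≈0

            l₂≈0 : l 2F ≈ 0#
            l₂≈0 = by₄ (solve 8 (λ l₂ l₃ l₄ l₅ b c₀ c₁ c₂ →
                let o = con (+ 1)
                    y = o
                    ξ = o
                    A = l₅ :* (y :+ y :+ c₂) :+ l₄
                    B = l₅ :* ((o :+ (b :+ b)) :* (y :* y) :+ c₂ :* y :+ c₁) :+ l₄ :* (y :+ c₂) :+ l₃ :* y
                    C = l₅ :* ((b :+ b) :* (y :* y :* y) :+ c₂ :* (b :* (y :* y)) :+ c₁ :* y :+ c₀) :+ l₄ :* (b :* (y :* y) :+ c₂ :* y :+ c₁)
                        :+ l₃ :* (y :* y) :+ l₂ :* y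
                in l₂ := o :* (l₅ :* (ξ :* ξ :* ξ) :+ A :* (ξ :* ξ) :+ B :* ξ :+ C)
                :+ :- (con (+ 4) :+ c₂ :+ c₂ :+ c₁ :+ c₁ :+ (con (+ 4) :* b) :+ c₂ :* b :+ c₀) :* l₅
                :+ :- (con (+ 2) :+ c₂ :+ c₂ :+ b :+ c₁) :* l₄ :+ :- con (+ 2) :* l₃) ≡.refl (l 2F) (l 3F) (l 4F) (l 5F) b c₀ c₁ c₂)
              (cubic 1≉0 1≉0) l₅≈0 l₄≈0 l₃≈0

            constant-coefficients : l 0F ≈ 0# × l 1F ≈ 0# × 0# ≈ 0#
            constant-coefficients = quadratic-zero u≉v u≉w v≉w (λ {y} root → by₄ (solve 10 (λ l₀ l₁ l₂ l₃ l₄ l₅ y n f g →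
                l₀ :* (y :* y) :+ l₁ :* y :+ con (+ 0) :=
                con (+ 1) :* (l₀ :* (y :* y) :+ l₁ :* y :+ l₂ :* (con (+ 0) :* y) :+ l₃ :* (y :* n) :+ l₄ :* f :+ l₅ :* g)
                :+ :- (y :* n) :* l₃ :+ :- f :* l₄ :+ :- g :* l₅) ≡.refl
                (l 0F) (l 1F) (l 2F) (l 3F) (l 4F) (l 5F) y (norm 0# y) _ _)
              (form-zero 0# (sample≉0 root)) l₃≈0 l₄≈0 l₅≈0)

            vanishes : l ≋ 𝟎
            vanishes 0F = proj₁ constant-coefficients
            vanishes 1F = proj₁ (proj₂ constant-coefficients)
            vanishes 2F = l₂≈0
            vanishes 3F = l₃≈0
            vanishes 4F = l₄≈0
            vanishes 5F = l₅≈0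

        -- The three distinct nonzero samples 1, v and w exist because `4 ≤ q`.
        functional≋0 : ∀ l → (∀ i → dot l (V i) ≈ 0#) → l ≋ 𝟎
        functional≋0 l lV≈0 =
          let v , v-new = avoid (ℕ.≤-trans (s≤s (s≤s (s≤s z≤n))) 4≤q) (0# ∷ 1# ∷ [])
              w , w-new = avoid 4≤q (0# ∷ 1# ∷ v ∷ [])
          in vanishes l lV≈0 1≉0 (v-new 0F) (w-new 0F) (v-new 1F ∘ sym) (w-new 1F ∘ sym) (w-new 2F ∘ sym)

  -- The choice of the two polynomials
  module Parameters where

    -1≉0 : - 1# ≉ 0#
    -1≉0 -1≈0 = 1≉0 (by₁ (solve 0 (con (+ 1) := :- con (+ 1) :* :- con (+ 1)) ≡.refl) -1≈0)

    -- The map x ↦ - (x² + x) takes the value 0 at both 0 and -1, so it misses some b. Unlike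
    -- squaring, it has such a collision in characteristic 2 as well.
    irreducible-quadratic : ∃[ b ] ∀ x → x * x + x + b ≉ 0#
    irreducible-quadratic =
      let b , missed = missedValue (λ x → - (x * x + x)) (λ x≈y → -‿cong (+-cong (*-cong x≈y x≈y) x≈y))
                         -1≉0 (solve 0 (let m = :- con (+ 1) ; z = con (+ 0) in
                           :- (m :* m :+ m) := :- (z :* z :+ z)) ≡.refl)
      in b , λ x eq → missed x (x-y≈0⇒x≈y (by₁ (solve 2 (λ x b → :- (x :* x :+ x) :- b :=
           :- con (+ 1) :* (x :* x :+ x :+ b)) ≡.refl x b) eq))

    module Choice (b : Carrier) (b-rootless : ∀ x → x * x + x + b ≉ 0#) where

      b≉0 : b ≉ 0#
      b≉0 b≈0 = b-rootless 0# (by₁ (solve 1 (λ b → con (+ 0) :* con (+ 0) :+ con (+ 0) :+ b := con (+ 1) :* b) ≡.refl b) b≈0)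

      -- X g h = 0 and Y g h = 0 are the conditions 1 + d = 0 and κ = 0 for d = b / (g h).
      X Y : Carrier → Carrier → Carrier
      X g h = g * h + b
      Y g h = g * h + b * (g + h - g * h)

      record GoodPair : Set (c ⊔ ℓ₁) where
        field
          g h : Carrier
          g≉0 : g ≉ 0#
          g≉1 : g ≉ 1#
          h≉0 : h ≉ 0#
          h≉1 : h ≉ 1#
          g≉h : g ≉ h
          X≉0 : X g h ≉ 0#
          Y≉0 : Y g h ≉ 0#

      X-comm : ∀ {g h} → X g h ≈ 0# → X h g ≈ 0#
      X-comm = trans (+-congʳ (*-comm _ _))

      Y-comm : ∀ {g h} → Y g h ≈ 0# → Y h g ≈ 0#
      Y-comm {g} {h} = trans (solve 3 (λ g h b → h :* g :+ b :* (h :+ g :- h :* g) := g :* h :+ b :* (g :+ h :- g :* h)) ≡.refl g h b)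

      X-unique : ∀ {g h k} → g ≉ 0# → X g h ≈ 0# → X g k ≈ 0# → h ≈ k
      X-unique {g} {h} {k} g≉0 Xh Xk = x-y≈0⇒x≈y (cancelˡ g≉0 (by₂ (solve 4 (λ g h k b →
        g :* (h :- k) := con (+ 1) :* (g :* h :+ b) :+ :- con (+ 1) :* (g :* k :+ b)) ≡.refl g h k b) Xh Xk))

      Y-unique : ∀ {g h k} → g ≉ 0# → Y g h ≈ 0# → Y g k ≈ 0# → h ≈ k
      Y-unique {g} {h} {k} g≉0 Yh Yk = x-y≈0⇒x≈y (cancelˡ slope≉0 (by₂ (solve 4 (λ g h k b →
          (g :+ b :- b :* g) :* (h :- k) := con (+ 1) :* (g :* h :+ b :* (g :+ h :- g :* h))
          :+ :- con (+ 1) :* (g :* k :+ b :* (g :+ k :- g :* k))) ≡.refl g h k b) Yh Yk))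
        where
        slope≉0 : g + b - b * g ≉ 0#
        -- If the coefficient of h vanished, `Y g h` would reduce to b g.
        slope≉0 slope≈0 = *≉0 b≉0 g≉0 (by₂ (solve 3 (λ g h b → b :* g :=
          con (+ 1) :* (g :* h :+ b :* (g :+ h :- g :* h)) :+ :- h :* (g :+ b :- b :* g)) ≡.refl g h b) Yh slope≈0)

      module Three {g h k} (g≉0 : g ≉ 0#) (g≉1 : g ≉ 1#) (h≉0 : h ≉ 0#) (h≉1 : h ≉ 1#) (k≉0 : k ≉ 0#) (k≉1 : k ≉ 1#)
        (g≉h : g ≉ h) (g≉k : g ≉ k) (h≉k : h ≉ k) where

        pair-gh : X g h ≉ 0# → Y g h ≉ 0# → GoodPair
        pair-gh X≉0 Y≉0 = record { g = g ; h = h ; g≉0 = g≉0 ; g≉1 = g≉1 ; h≉0 = h≉0 ; h≉1 = h≉1 ; g≉h = g≉h ; X≉0 = X≉0 ; Y≉0 = Y≉0 }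

        pair-gk : X g k ≉ 0# → Y g k ≉ 0# → GoodPair
        pair-gk X≉0 Y≉0 = record { g = g ; h = k ; g≉0 = g≉0 ; g≉1 = g≉1 ; h≉0 = k≉0 ; h≉1 = k≉1 ; g≉h = g≉k ; X≉0 = X≉0 ; Y≉0 = Y≉0 }

        pair-hk : X h k ≉ 0# → Y h k ≉ 0# → GoodPair
        pair-hk X≉0 Y≉0 = record { g = h ; h = k ; g≉0 = h≉0 ; g≉1 = h≉1 ; h≉0 = k≉0 ; h≉1 = k≉1 ; g≉h = h≉k ; X≉0 = X≉0 ; Y≉0 = Y≉0 }

        good : GoodPair
        good = by-cases (X g h ≟ 0#) (Y g h ≟ 0#) (X g k ≟ 0#) (Y g k ≟ 0#)
          where
          by-cases : Dec (X g h ≈ 0#) → Dec (Y g h ≈ 0#) → Dec (X g k ≈ 0#) → Dec (Y g k ≈ 0#) → GoodPair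
          by-cases (no ¬X) (no ¬Y) _ _          = pair-gh ¬X ¬Y
          by-cases _ _ (no ¬X) (no ¬Y)          = pair-gk ¬X ¬Y
          by-cases (yes Xgh) _ (yes Xgk) _      = contradiction (X-unique g≉0 Xgh Xgk) h≉k
          by-cases _ (yes Ygh) _ (yes Ygk)      = contradiction (Y-unique g≉0 Ygh Ygk) h≉k
          -- One equation holds for (g, h) and the other for (g, k). Either of them holding for (h,
          -- k) too would make two of the three elements equal.
          by-cases (yes Xgh) _ _ (yes Ygk)      = pair-hk
            (λ Xhk → g≉k (X-unique h≉0 (X-comm Xgh) Xhk)) (λ Yhk → g≉h (Y-unique k≉0 (Y-comm Ygk) (Y-comm Yhk)))
          by-cases _ (yes Ygh) (yes Xgk) _      = pair-hk
            (λ Xhk → g≉h (X-unique k≉0 (X-comm Xgk) (X-comm Xhk))) (λ Yhk → g≉k (Y-unique h≉0 (Y-comm Ygh) Yhk))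

      successor : ∀ {g h} → g ≉ 0# → g ≉ h → g * h ≈ 1# →
        (∀ x → ¬ (x ≉ 0# × x ≉ 1# × x ≉ g × x ≉ h)) → g + 1# ≈ h
      successor {g} {h} g≉0 g≉h gh≈1 cover with g + 1# ≟ h
      ... | yes eq = eq
      ... | no g+1≉h = ⊥-elim (cover (g + 1#)
        ( (λ g+1≈0 → g≉h (x-y≈0⇒x≈y (by₂ (solve 2 (λ g h → g :- h :=
            (con (+ 1) :- h) :* (g :+ con (+ 1)) :+ con (+ 1) :* (g :* h :- con (+ 1))) ≡.refl g h) g+1≈0 (x≈y⇒x-y≈0 gh≈1))))
        , (λ g+1≈1 → g≉0 (by₁ (solve 1 (λ g → g := con (+ 1) :* (g :+ con (+ 1) :- con (+ 1))) ≡.refl g) (x≈y⇒x-y≈0 g+1≈1)))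
        , (λ g+1≈g → 1≉0 (by₁ (solve 1 (λ g → con (+ 1) := con (+ 1) :* (g :+ con (+ 1) :- g)) ≡.refl g) (x≈y⇒x-y≈0 g+1≈g)))
        , g+1≉h))

      module Four {g h} (g≉0 : g ≉ 0#) (g≉1 : g ≉ 1#) (h≉0 : h ≉ 0#) (h≉1 : h ≉ 1#) (g≉h : g ≉ h)
        (cover : ∀ x → ¬ (x ≉ 0# × x ≉ 1# × x ≉ g × x ≉ h)) where

        gh≈1 : g * h ≈ 1#
        gh≈1 with g * h ≟ 1#
        ... | yes eq = eq
        ... | no gh≉1 = ⊥-elim (cover (g * h) (*≉0 g≉0 h≉0 , gh≉1 ,
          (λ gh≈g → h≉1 (x-y≈0⇒x≈y (cancelˡ g≉0 (by₁ (solve 2 (λ g h → g :* (h :- con (+ 1)) := con (+ 1) :* (g :* h :- g)) ≡.refl g h)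
            (x≈y⇒x-y≈0 gh≈g))))) ,
          (λ gh≈h → g≉1 (x-y≈0⇒x≈y (cancelˡ h≉0 (by₁ (solve 2 (λ g h → h :* (g :- con (+ 1)) := con (+ 1) :* (g :* h :- h)) ≡.refl g h)
            (x≈y⇒x-y≈0 gh≈h)))))))

        g+1≈h : g + 1# ≈ h
        g+1≈h = successor g≉0 g≉h gh≈1 cover

        h+1≈g : h + 1# ≈ g
        h+1≈g = successor h≉0 (g≉h ∘ sym) (trans (*-comm h g) gh≈1)
          (λ x (x≉0 , x≉1 , x≉h , x≉g) → cover x (x≉0 , x≉1 , x≉g , x≉h))

        -- The field is {0, 1, g, h}, with g h = 1, g + 1 = h and h + 1 = g. So `X` becomes g² + g +
        -- b and `Y` becomes 1.
        good : GoodPair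
        good = record
          { g = g ; h = h ; g≉0 = g≉0 ; g≉1 = g≉1 ; h≉0 = h≉0 ; h≉1 = h≉1 ; g≉h = g≉h
          ; X≉0 = λ X≈0 → b-rootless g (by₂ (solve 3 (λ g h b → g :* g :+ g :+ b :=
              con (+ 1) :* (g :* h :+ b) :+ g :* (g :+ con (+ 1) :- h)) ≡.refl g h b) X≈0 (x≈y⇒x-y≈0 g+1≈h))
          ; Y≉0 = λ Y≈0 → 1≉0 (by₄ (solve 3 (λ g h b → let o = con (+ 1) in
              o := o :* (g :* h :+ b :* (g :+ h :- g :* h)) :+ (b :- o) :* (g :* h :- o)
              :+ :- (b :* h) :* (g :+ o :- h) :+ (b :- b :* h) :* (h :+ o :- g)) ≡.refl g h b)
              Y≈0 (x≈y⇒x-y≈0 gh≈1) (x≈y⇒x-y≈0 g+1≈h) (x≈y⇒x-y≈0 h+1≈g))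
          }

      -- With three elements outside {0, 1}, each of X = 0 and Y = 0 excludes at most one pair;
      -- with only two, K has order 4, and the equations are excluded by the rootless quadratic.
      good-pair : GoodPair
      good-pair =
        let g , g-new = avoid (ℕ.≤-trans (s≤s (s≤s (s≤s z≤n))) 4≤q) (0# ∷ 1# ∷ [])
            h , h-new = avoid 4≤q (0# ∷ 1# ∷ g ∷ [])
        in by-order g h (g-new 0F) (g-new 1F) (h-new 0F) (h-new 1F) (h-new 2F ∘ sym)
             (Fin.any? (λ i → let x = element i in ¬? (x ≟ 0#) ×-dec ¬? (x ≟ 1#) ×-dec ¬? (x ≟ g) ×-dec ¬? (x ≟ h)))
        where
        by-order : ∀ g h → g ≉ 0# → g ≉ 1# → h ≉ 0# → h ≉ 1# → g ≉ h →
          Dec (∃[ i ] (element i ≉ 0# × element i ≉ 1# × element i ≉ g × element i ≉ h)) → GoodPair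
        by-order g h g≉0 g≉1 h≉0 h≉1 g≉h (yes (i , k≉0 , k≉1 , k≉g , k≉h)) =
          Three.good g≉0 g≉1 h≉0 h≉1 k≉0 k≉1 g≉h (k≉g ∘ sym) (k≉h ∘ sym)
        by-order g h g≉0 g≉1 h≉0 h≉1 g≉h (no none) =
          Four.good g≉0 g≉1 h≉0 h≉1 g≉h (λ x (x≉0 , x≉1 , x≉g , x≉h) → let e = element-code x in
            none (code x , x≉0 ∘ trans (sym e) , x≉1 ∘ trans (sym e) , x≉g ∘ trans (sym e) , x≉h ∘ trans (sym e)))

      open GoodPair good-pair public

      -- With b = d g h the coordinates n of the five special points become polynomials in d, g and
      -- h.
      d : Carrier
      d = b * proj₁ (inverse (*≉0 g≉0 h≉0))

      dgh≈b : d * g * h ≈ b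
      dgh≈b = x-y≈0⇒x≈y (by₁ (solve 4 (λ g h b r → b :* r :* g :* h :- b := :- b :* (con (+ 1) :- g :* h :* r))
        ≡.refl g h b _) (x≈y⇒x-y≈0 (sym (proj₂ (inverse (*≉0 g≉0 h≉0))))))

      d≉0 : d ≉ 0#
      d≉0 d≈0 = b≉0 (trans (sym dgh≈b) (by₁ (solve 3 (λ d g h → d :* g :* h := g :* h :* d) ≡.refl d g h) d≈0))

      1+d≉0 : 1# + d ≉ 0#
      1+d≉0 1+d≈0 = X≉0 (by₂ (solve 4 (λ d g h b → g :* h :+ b :=
        g :* h :* (con (+ 1) :+ d) :+ :- con (+ 1) :* (d :* g :* h :- b)) ≡.refl d g h b) 1+d≈0 (x≈y⇒x-y≈0 dgh≈b))

      -- Fitted to the moment of n² for the five special points, see `moment-nn`.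
      κ : Carrier
      κ = 1# + d * (g + h - g * h)

      κ≉0 : κ ≉ 0#
      κ≉0 κ≈0 = Y≉0 (by₂ (solve 4 (λ d g h b → g :* h :+ b :* (g :+ h :- g :* h) :=
        g :* h :* (con (+ 1) :+ d :* (g :+ h :- g :* h)) :+ :- (g :+ h :- g :* h) :* (d :* g :* h :- b)) ≡.refl d g h b)
        κ≈0 (x≈y⇒x-y≈0 dgh≈b))

      D : Carrier → Carrier
      D x = (x + 1#) * (x + d)

      D-cong : ∀ {x y} → x ≈ y → D x ≈ D y
      D-cong x≈y = *-cong (+-congʳ x≈y) (+-congʳ x≈y)

      -- The default `0#` at the zeros of `D` is deliberate: it produces the collision used in
      -- `missed`.
      ratio′ : ∀ x → Dec (D x ≈ 0#) → Carrier
      ratio′ x (yes _)    = 0#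
      ratio′ x (no Dx≉0) = - (x * D x + κ * x) * proj₁ (inverse Dx≉0)

      -- The value k at which the pencil x D(x) + κ x + k D(x) has the root x, when D(x) ≠ 0.
      ratio : Carrier → Carrier
      ratio x = ratio′ (element (code x)) (D (element (code x)) ≟ 0#)

      ratio-zero : ∀ x → D x ≈ 0# → ratio x ≈ 0#
      ratio-zero x Dx≈0 = go (D (element (code x)) ≟ 0#)
        where
        go : ∀ dec → ratio′ (element (code x)) dec ≈ 0#
        go (yes _)    = refl
        go (no D≉0) = contradiction (trans (D-cong (element-code x)) Dx≈0) D≉0

      ratio-root : ∀ x → D x ≉ 0# → ratio x * D x + (x * D x + κ * x) ≈ 0#
      ratio-root x Dx≉0 = trans (sym (+-cong (*-congˡ (D-cong (element-code x)))
          (+-cong (*-cong (element-code x) (D-cong (element-code x))) (*-congˡ (element-code x)))))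
          (go (D (element (code x)) ≟ 0#))
        where
        y = element (code x)
        go : ∀ dec → ratio′ y dec * D y + (y * D y + κ * y) ≈ 0#
        go (yes D≈0) = contradiction (trans (sym (D-cong (element-code x))) D≈0) Dx≉0
        go (no D≉0)  = by₁ (solve 4 (λ y D κ r → :- (y :* D :+ κ :* y) :* r :* D :+ (y :* D :+ κ :* y) :=
          (y :* D :+ κ :* y) :* (con (+ 1) :- D :* r)) ≡.refl y (D y) κ _) (x≈y⇒x-y≈0 (sym (proj₂ (inverse D≉0))))

      D0≉0 : D 0# ≉ 0#
      D0≉0 D≈0 = d≉0 (by₁ (solve 1 (λ d → d := con (+ 1) :* ((con (+ 0) :+ con (+ 1)) :* (con (+ 0) :+ d))) ≡.refl d) D≈0)

      -- `ratio` is zero at -1 by the default and at 0 by the formula. It sees x only through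
      -- `code x`, so it respects equality in the field.
      missed : ∃[ k ] ∀ x → ratio x ≉ k
      missed = missedValue ratio (λ x≈y → reflexive (≡.cong (λ i → ratio′ (element i) (D (element i) ≟ 0#)) (code-cong x≈y))) -1≉0
        (trans (ratio-zero (- 1#) (solve 1 (λ d → (:- con (+ 1) :+ con (+ 1)) :* (:- con (+ 1) :+ d) := con (+ 0)) ≡.refl d))
          (sym (cancelˡ D0≉0 (by₁ (solve 3 (λ D κ r → D :* r := con (+ 1) :* (r :* D :+ (con (+ 0) :* D :+ κ :* con (+ 0))))
            ≡.refl (D 0#) κ (ratio 0#)) (ratio-root 0# D0≉0)))))

      k : Carrier
      k = proj₁ missed

      -- A root x with D(x) nonzero would have ratio k. Where D(x) = 0 the pencil reduces to κ x, so
      -- x = 0, but D(0) = d is nonzero.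
      c-rootless : ∀ x → x * x * x + (1# + d + k) * (x * x) + (d + κ + k * (1# + d)) * x + k * d ≉ 0#
      c-rootless x c≈0 = go (D x ≟ 0#)
        where
        factored : x * D x + κ * x + k * D x ≈ 0#
        factored = by₁ (solve 4 (λ x d κ k → let D = (x :+ con (+ 1)) :* (x :+ d) in
          x :* D :+ κ :* x :+ k :* D := con (+ 1) :* (x :* x :* x :+ (con (+ 1) :+ d :+ k) :* (x :* x)
          :+ (d :+ κ :+ k :* (con (+ 1) :+ d)) :* x :+ k :* d)) ≡.refl x d κ k) c≈0

        go : Dec (D x ≈ 0#) → ⊥
        go (no D≉0)  = proj₂ missed x (x-y≈0⇒x≈y (cancelˡ D≉0 (by₂ (solve 5 (λ x D κ k r → D :* (r :- k) :=
          con (+ 1) :* (r :* D :+ (x :* D :+ κ :* x)) :+ :- con (+ 1) :* (x :* D :+ κ :* x :+ k :* D))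
          ≡.refl x (D x) κ k (ratio x)) (ratio-root x D≉0) factored)))
        go (yes D≈0) = D0≉0 (trans (D-cong (sym x≈0)) D≈0)
          where
          x≈0 : x ≈ 0#
          x≈0 = cancelˡ κ≉0 (by₂ (solve 4 (λ x D κ k → κ :* x := con (+ 1) :* (x :* D :+ κ :* x :+ k :* D) :+ :- (x :+ k) :* D)
            ≡.refl x (D x) κ k) factored D≈0)

  -- From the four incidence properties to the theorem
  module Assemble
    {N : ℕ} (5+[1+q]<N : 5 ℕ.+ suc q < N) (e : Fin N → AffinePoint 5) (e-injective : ∀ {i j} → e i ≋ e j → i ≡ j)
    (total : ∀ l → (∀ i → dot l (1# ∷ e i) ≈ 0#) → l ≋ 𝟎)
    (four-independent : (p : Fin 4 → Fin N) → Injective _≡_ _≡_ p → LinearlyIndependent (λ k → 1# ∷ e (p k)))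
    (no-six : (W : Vector (Vector Carrier 6) 4) (p : Fin 6 → Fin N) → Injective _≡_ _≡_ p →
      ¬ (∀ k → InSpan W (1# ∷ e (p k))))
    (p : Fin 5 → Fin N) (p-injective : Injective _≡_ _≡_ p)
    (p₀-in-span : InSpan (λ k → 1# ∷ e (p (suc k))) (1# ∷ e (p 0F)))
    where

    V : Fin N → Vector Carrier 6
    V i = 1# ∷ e i

    𝒳 : Pred (AffinePoint 5) ℓ₁
    𝒳 x = ∃[ i ] x ≋ e i

    respects : 𝒳 Respects _≋_
    respects x≋y (i , x≋e) = i , λ j → trans (sym (x≋y j)) (x≋e j)

    has-size : Counting.HasSize _≋_ N 𝒳
    has-size = e , e-injective , (λ i → i , λ _ → refl) , λ _ x∈𝒳 → x∈𝒳

    open Counting (_≈ₚ_ {5}) using (AtLeast; AtMost)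

    #0⇒≉0 : ∀ {x} → x # 0# → x ≉ 0#
    #0⇒≉0 x#0 x≈0 = proj₂ (tight _ _) x≈0 x#0

    -- Points of `inPG 𝒳` are only proportional to the vectors `V i`. Rescaling turns counting
    -- points of a subspace into counting indices.
    indices : ∀ {m s} (U : Subspace 5 s) → AtLeast m (inPG 𝒳 ∩ ⟦ U ⟧) →
      ∃[ ι ] (Injective {A = Fin m} _≡_ _≡_ ι × ∀ k → InSpan (Subspace.basis U) (V (ι k)))
    indices {m} U (f , f-inj , f∈) = ι , ι-injective , ι-in-span
      where
      ι : Fin m → Fin N
      ι k = let (_ , (i , _) , _) , _ = f∈ k in i

      scale : ∀ k → ∃[ a ] (a ≉ 0# × coords (f k) ≋ a • V (ι k))
      scale k = let (x , (i , x≋e) , (a , a#0 , eq)) , _ = f∈ k in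
        a , #0⇒≉0 a#0 , λ j → trans (eq j) (*-congˡ (homogeneous x≋e j))
        where
        homogeneous : ∀ {x y : AffinePoint 5} → x ≋ y → (1# ∷ x) ≋ (1# ∷ y)
        homogeneous x≋y zero    = refl
        homogeneous x≋y (suc j) = x≋y j

      ι-injective : Injective _≡_ _≡_ ι
      ι-injective {k} {l} ιk≡ιl =
        let a , a≉0 , a-eq = scale k
            b , b≉0 , b-eq = scale l
            r , br≈1 = inverse b≉0
            r≉0 = λ r≈0 → 1≉0 (trans (sym br≈1) (by₁ refl r≈0))
        in f-inj (a * r , ≉0⇒#0 (*≉0 a≉0 r≉0) , λ j → begin
          coords (f k) j               ≈⟨ a-eq j ⟩
          a * V (ι k) j                ≡⟨ ≡.cong (λ i → a * V i j) ιk≡ιl ⟩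
          a * V (ι l) j                ≈⟨ x-y≈0⇒x≈y (by₁ (solve 4 (λ a b r v → a :* v :- a :* r :* (b :* v) :=
                                            a :* v :* (con (+ 1) :- b :* r)) ≡.refl a b r (V (ι l) j)) (x≈y⇒x-y≈0 (sym br≈1))) ⟩
          a * r * (b * V (ι l) j)      ≈⟨ *-congˡ (b-eq j) ⟨
          a * r * coords (f l) j       ∎)

      ι-in-span : ∀ k → InSpan (Subspace.basis U) (V (ι k))
      ι-in-span k =
        let a , a≉0 , a-eq = scale k
            r , ar≈1 = inverse a≉0
            _ , (t , t-eq) = f∈ k
        in r • t , λ j → begin
          V (ι k) j                    ≈⟨ x-y≈0⇒x≈y (by₁ (solve 3 (λ a r v → v :- r :* (a :* v) :=
                                            v :* (con (+ 1) :- a :* r)) ≡.refl a r (V (ι k) j)) (x≈y⇒x-y≈0 (sym ar≈1))) ⟩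
          r * (a * V (ι k) j)          ≈⟨ *-congˡ (a-eq j) ⟨
          r * coords (f k) j           ≈⟨ *-congˡ (t-eq j) ⟩
          r * dot t (λ i → Subspace.basis U i j)    ≈⟨ dot-scaleˡ r t (λ i → Subspace.basis U i j) ⟨
          dot (r • t) (λ i → Subspace.basis U i j)  ∎

    at-least : ∀ {m s} (U : Subspace 5 s) (ι : Fin m → Fin N) → Injective _≡_ _≡_ ι →
      (∀ k → InSpan (Subspace.basis U) (V (ι k))) → AtLeast m (inPG 𝒳 ∩ ⟦ U ⟧)
    at-least U ι ι-inj ι∈ = (λ k → embed (e (ι k))) , inj ,
      λ k → (e (ι k) , (ι k , λ _ → refl) , (1# , 1#0 , λ j → sym (*-identityˡ _))) , ι∈ k
      where
      inj : Injective _≡_ _≈ₚ_ (λ k → embed (e (ι k)))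
      -- Both leading coordinates are 1, so the proportionality factor is 1.
      inj (a , _ , eq) = ι-inj (e-injective (λ j → trans (eq (suc j))
        (trans (*-congʳ (trans (sym (*-identityʳ a)) (sym (eq zero)))) (*-identityˡ _))))

    inject≤-∘ : ∀ {m n} (m≤n : m ≤ n) {ι : Fin n → Fin N} → Injective _≡_ _≡_ ι → Injective _≡_ _≡_ (ι ∘ λ k → inject≤ k m≤n)
    inject≤-∘ m≤n ι-inj eq = Fin.inject≤-injective m≤n m≤n _ _ (ι-inj eq)

    plane-bound : (U : Subspace 5 2) → AtMost 3 (inPG 𝒳 ∩ ⟦ U ⟧)
    plane-bound U m many = ℕ.≮⇒≥ λ 4≤m →
      let ι , ι-inj , ι∈ = indices U many
          a , (k , aₖ≉0) , eq = span-dependent (ℕ.n<1+n 3) (Subspace.basis U) (λ k → V (ι (inject≤ k 4≤m))) (λ k → ι∈ _)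
      in aₖ≉0 (four-independent (λ k → ι (inject≤ k 4≤m)) (inject≤-∘ 4≤m ι-inj) a eq k)

    solid-bound : (U : Subspace 5 3) → AtMost 5 (inPG 𝒳 ∩ ⟦ U ⟧)
    solid-bound U m many = ℕ.≮⇒≥ λ 6≤m →
      let ι , ι-inj , ι∈ = indices U many
      in no-six (Subspace.basis U) (λ k → ι (inject≤ k 6≤m)) (inject≤-∘ 6≤m ι-inj) (λ k → ι∈ _)

    in-span-self : ∀ {m n} (v : Vector (Vector Carrier n) m) k → InSpan v (v k)
    in-span-self v k = unit k , λ j → sym (trans (dot-comm (unit k) (λ i → v i j)) (dot-unit (λ i → v i j) k))

    in-span-∷ : ∀ {m n} {v : Vector (Vector Carrier n) m} {x} y → InSpan v x → InSpan (y ∷ v) x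
    in-span-∷ {v = v} {x} y (a , eq) = 0# ∷ a , λ j → trans (eq j)
      (solve 2 (λ s y → s := con (+ 0) :* y :+ s) ≡.refl (combination a v j) (y j))

    B : Vector (Vector Carrier 6) 4
    B = V ∘ p ∘ suc

    B-independent : LinearlyIndependent B
    B-independent = four-independent (p ∘ suc) (Fin.suc-injective ∘ p-injective)

    p-in-span : ∀ k → InSpan B (V (p k))
    p-in-span zero    = p₀-in-span
    p-in-span (suc k) = in-span-self B k

    ∷-injective : ∀ {m} {ι : Fin m → Fin N} {j} → Injective _≡_ _≡_ ι → (∀ k → ι k ≢ j) → Injective _≡_ _≡_ (j ∷ ι)
    ∷-injective ι-inj new {zero}  {zero}  eq = ≡.refl
    ∷-injective ι-inj new {zero}  {suc l} eq = contradiction (≡.sym eq) (new l)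
    ∷-injective ι-inj new {suc k} {zero}  eq = contradiction eq (new k)
    ∷-injective ι-inj new {suc k} {suc l} eq = ≡.cong suc (ι-inj eq)

    -- The solid spanned by `B` already contains the five points `p k`, so `j` would be a sixth.
    outside : ∀ {j} → (∀ k → p k ≢ j) → ¬ InSpan B (V j)
    outside {j} new j∈ = no-six B (j ∷ p) (∷-injective p-injective new) λ where
      zero    → j∈
      (suc k) → p-in-span k

    solid : Subspace 5 3
    solid = record { basis = B ; independent = B-independent }

    -- Two more points complete `B` to a basis. The first two coordinates in this frame are
    -- coordinates modulo the solid, and their ratio names the hyperplane through the solid.
    extended : ∃[ i₁ ] ∃[ i₂ ] LinearlyIndependent (V ∘ (i₂ ∷ i₁ ∷ p ∘ suc))
    extended =
      let i₁ , ind₅ = extend-independent V total (ℕ.m≤m+n 5 1) (p ∘ suc) B-independent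
          i₂ , ind₆ = extend-independent V total (ℕ.n<1+n 5) (i₁ ∷ p ∘ suc) ind₅
      in i₁ , i₂ , ind₆

    frame : Fin 6 → Fin N
    frame = proj₁ (proj₂ extended) ∷ proj₁ extended ∷ p ∘ suc

    frame-spans : ∀ x → InSpan (V ∘ frame) x
    frame-spans = basis-spans {v = V ∘ frame} (proj₂ (proj₂ extended))

    spans : Spans (inPG 𝒳)
    spans P = 6 , (λ k → embed (e (frame k))) ,
      (λ k → e (frame k) , (frame k , λ _ → refl) , (1# , 1#0 , λ j → sym (*-identityˡ _))) , frame-spans (coords P)

    -- The q + 1 values are the points of a projective line; `zero` is the point with a₀ = 0.
    slope : ∀ {a₀} → Carrier → Dec (a₀ ≈ 0#) → Fin (suc q)
    slope a₁ (yes _)   = zero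
    slope a₁ (no a₀≉0) = suc (code (a₁ * proj₁ (inverse a₀≉0)))

    proportional : ∀ {a₀ a₁ b₀ b₁} (da : Dec (a₀ ≈ 0#)) (db : Dec (b₀ ≈ 0#)) → ¬ (b₀ ≈ 0# × b₁ ≈ 0#) →
      slope a₁ da ≡ slope b₁ db → ∃[ s ] (a₀ - s * b₀ ≈ 0# × a₁ - s * b₁ ≈ 0#)
    proportional {a₀} {a₁} {b₀} {b₁} (yes a₀≈0) (yes b₀≈0) b≉0 _ =
      let r , b₁r≈1 = inverse (λ b₁≈0 → b≉0 (b₀≈0 , b₁≈0)) in a₁ * r
      , by₂ (solve 4 (λ a₀ a₁ b₀ r → a₀ :- a₁ :* r :* b₀ := con (+ 1) :* a₀ :+ :- (a₁ :* r) :* b₀) ≡.refl a₀ a₁ b₀ r) a₀≈0 b₀≈0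
      , by₁ (solve 3 (λ a₁ b₁ r → a₁ :- a₁ :* r :* b₁ := a₁ :* (con (+ 1) :- b₁ :* r)) ≡.refl a₁ b₁ r) (x≈y⇒x-y≈0 (sym b₁r≈1))
    proportional {a₀} {a₁} {b₀} {b₁} (no a₀≉0) (no b₀≉0) _ eq =
      let ra , a₀ra≈1 = inverse a₀≉0
          rb , b₀rb≈1 = inverse b₀≉0
      in a₀ * rb
      , by₁ (solve 3 (λ a₀ b₀ r → a₀ :- a₀ :* r :* b₀ := a₀ :* (con (+ 1) :- b₀ :* r)) ≡.refl a₀ b₀ rb) (x≈y⇒x-y≈0 (sym b₀rb≈1))
      , by₂ (solve 5 (λ a₀ a₁ b₁ ra rb → a₁ :- a₀ :* rb :* b₁ :=
          a₁ :* (con (+ 1) :- a₀ :* ra) :+ a₀ :* (a₁ :* ra :- b₁ :* rb)) ≡.refl a₀ a₁ b₁ ra rb)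
        (x≈y⇒x-y≈0 (sym a₀ra≈1)) (x≈y⇒x-y≈0 (code-injective (Fin.suc-injective eq)))

    u : Fin N → Vector Carrier 6
    u j = proj₁ (frame-spans (V j))

    V-u : ∀ j → V j ≋ combination (u j) (V ∘ frame)
    V-u j = proj₂ (frame-spans (V j))

    not-in-solid : ∀ {j} → (∀ k → p k ≢ j) → ¬ (u j 0F ≈ 0# × u j 1F ≈ 0#)
    not-in-solid {j} new (u₀≈0 , u₁≈0) = outside new (tail (tail (u j)) , λ r → trans (V-u j r)
      (x-y≈0⇒x≈y (by₂ (solve 5 (λ u₀ u₁ x y s → u₀ :* x :+ (u₁ :* y :+ s) :- s := x :* u₀ :+ y :* u₁) ≡.refl
        (u j 0F) (u j 1F) (V (frame 0F) r) (V (frame 1F) r) (combination (tail (tail (u j))) B r)) u₀≈0 u₁≈0)))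

    -- Each of the five dependent points has a class of its own, so a collision involves two other
    -- points in one hyperplane through the solid.
    class′ : ∀ j → Dec (∃[ k ] p k ≡ j) → Fin 5 ⊎ Fin (suc q)
    class′ j (yes (k , _)) = inj₁ k
    class′ j (no _)        = inj₂ (slope (u j 1F) (u j 0F ≟ 0#))

    hit? : ∀ j → Dec (∃[ k ] p k ≡ j)
    hit? j = Fin.any? (λ k → p k Fin.≟ j)

    class : Fin N → Fin (5 ℕ.+ suc q)
    class j = join 5 (suc q) (class′ j (hit? j))

    Aligned : Fin N → Fin N → Set (c ⊔ ℓ₁)
    Aligned i j = (∀ k → p k ≢ i) × (∀ k → p k ≢ j) × ∃[ s ] (u i 0F - s * u j 0F ≈ 0# × u i 1F - s * u j 1F ≈ 0#)

    aligned : ∀ {i j} → i ≢ j → (di : Dec (∃[ k ] p k ≡ i)) (dj : Dec (∃[ k ] p k ≡ j)) →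
      class′ i di ≡ class′ j dj → Aligned i j
    aligned i≢j (yes (k , pk≡i)) (yes (l , pl≡j)) eq =
      contradiction (≡.trans (≡.sym pk≡i) (≡.trans (≡.cong p (inj₁-injective eq)) pl≡j)) i≢j
    aligned {i} {j} i≢j (no i∉) (no j∉) eq = (λ k pk≡i → i∉ (k , pk≡i)) , new-j ,
      proportional (u i 0F ≟ 0#) (u j 0F ≟ 0#) (not-in-solid new-j) (inj₂-injective eq)
      where
      new-j : ∀ k → p k ≢ j
      new-j k pk≡j = j∉ (k , pk≡j)

    aligned-pair : ∃[ i ] ∃[ j ] (i ≢ j × Aligned i j)
    aligned-pair =
      let i , j , i<j , eq = Fin.pigeonhole 5+[1+q]<N class
          i≢j = Fin.<⇒≢ i<j
      in i , j , i≢j , aligned i≢j (hit? i) (hit? j) (≡.trans (≡.sym (Fin.splitAt-join 5 (suc q) (class′ i (hit? i))))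
           (≡.trans (≡.cong (splitAt 5) eq) (Fin.splitAt-join 5 (suc q) (class′ j (hit? j)))))

    hyperplane-attains : Σ[ U ∈ Subspace 5 4 ] AtLeast 7 (inPG 𝒳 ∩ ⟦ U ⟧)
    hyperplane-attains =
      let i , j , i≢j , i-new , j-new , s , e₀ , e₁ = aligned-pair
          U = record { basis = V j ∷ B ; independent = independent-∷ (V j) B B-independent (outside j-new) }
      in U , at-least U (i ∷ j ∷ p) (∷-injective (∷-injective p-injective j-new) (first-new i≢j i-new))
           (λ where
             -- The coordinates outside the solid cancel in V i - s V j, so this difference is a
             -- combination of `B`.
             zero          → s ∷ (λ k → u i (suc (suc k)) - s * u j (suc (suc k))) , λ r → difference i j s e₀ e₁ r
             (suc zero)    → in-span-self (V j ∷ B) zero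
             (suc (suc k)) → in-span-∷ {v = B} (V j) (p-in-span k))
      where
      first-new : ∀ {i j} → i ≢ j → (∀ k → p k ≢ i) → ∀ k → (j ∷ p) k ≢ i
      first-new i≢j i-new zero    = i≢j ∘ ≡.sym
      first-new i≢j i-new (suc k) = i-new k

      difference : ∀ i j s → u i 0F - s * u j 0F ≈ 0# → u i 1F - s * u j 1F ≈ 0# → ∀ r →
        V i r ≈ s * V j r + dot (λ k → u i (suc (suc k)) - s * u j (suc (suc k))) (λ k → B k r)
      difference i j s e₀ e₁ r = x-y≈0⇒x≈y (begin
        V i r - (s * V j r + dot (λ k → uᵢ k - s * uⱼ k) (λ k → B k r))
          ≈⟨ +-cong (V-u i r) (-‿cong (+-cong (*-congˡ (V-u j r)) (trans (dot-subˡ uᵢ (s • uⱼ) (λ k → B k r))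
               (+-congˡ (-‿cong (dot-scaleˡ s uⱼ (λ k → B k r))))))) ⟩
        combination (u i) (V ∘ frame) r - (s * combination (u j) (V ∘ frame) r + (dot uᵢ (λ k → B k r) - s * dot uⱼ (λ k → B k r)))
          ≈⟨ by₂ (solve 9 (λ a₀ a₁ b₀ b₁ x y S S′ s → a₀ :* x :+ (a₁ :* y :+ S) :- (s :* (b₀ :* x :+ (b₁ :* y :+ S′)) :+ (S :- s :* S′)) :=
               x :* (a₀ :- s :* b₀) :+ y :* (a₁ :- s :* b₁)) ≡.refl (u i 0F) (u i 1F) (u j 0F) (u j 1F)
               (V (frame 0F) r) (V (frame 1F) r) (dot uᵢ (λ k → B k r)) (dot uⱼ (λ k → B k r)) s) e₀ e₁ ⟩
        0# ∎)
        where
        uᵢ uⱼ : Vector Carrier 4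
        uᵢ = tail (tail (u i))
        uⱼ = tail (tail (u j))

    is-4-general : IsGeneral 4 (inPG 𝒳)
    is-4-general = record
      { atMost  = plane-bound
      ; spans   = spans
      ; attains = solid , at-least solid p p-injective p-in-span
      }

    is-⟨5,3⟩-set : Is⟨ 5 , 3 ⟩-Set (inPG 𝒳)
    is-⟨5,3⟩-set = record
      { atMost  = solid-bound
      ; spans   = spans
      ; attains = hyperplane-attains
      }

    conclusion : Σ[ 𝒳 ∈ Pred (AffinePoint 5) ℓ₁ ]
      (𝒳 Respects _≋_ × Counting.HasSize _≋_ N 𝒳 × IsGeneral 4 (inPG 𝒳) × Is⟨ 5 , 3 ⟩-Set (inPG 𝒳))
    conclusion = 𝒳 , respects , has-size , is-4-general , is-⟨5,3⟩-set

  -- Five dependent points and the resulting set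

  module Construction (b : Carrier) (b-rootless : ∀ x → x * x + x + b ≉ 0#)
    (d g h k : Carrier) (dgh≈b : d * g * h ≈ b) (d≉0 : d ≉ 0#) (1+d≉0 : 1# + d ≉ 0#)
    (g≉0 : g ≉ 0#) (g≉1 : g ≉ 1#) (h≉0 : h ≉ 0#) (h≉1 : h ≉ 1#) (g≉h : g ≉ h)
    (c-rootless : ∀ x → x * x * x + (1# + d + k) * (x * x)
                        + (d + (1# + d * (g + h - g * h)) + k * (1# + d)) * x + k * d ≉ 0#)
    where

    open PairsOff (pairs-off (code 0#))

    I : Set
    I = Fin (q ^ 2 ∸ q)

    T X N : I → Carrier
    T i = element (first i)
    X i = element (second i)

    T≉0 : ∀ i → T i ≉ 0#
    T≉0 i T≈0 = first≢ i (≡.trans (≡.sym (code-element (first i))) (code-cong T≈0))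

    N i = (X i * X i + X i + b) * proj₁ (inverse (T≉0 i))

    on-quadric : ∀ i → T i * N i - X i * X i - X i - b ≈ 0#
    on-quadric i = by₁ (solve 4 (λ t x b r → t :* ((x :* x :+ x :+ b) :* r) :- x :* x :- x :- b :=
      :- (x :* x :+ x :+ b) :* (con (+ 1) :- t :* r)) ≡.refl (T i) (X i) b _)
      (x≈y⇒x-y≈0 (sym (proj₂ (inverse (T≉0 i)))))

    distinct : ∀ {i j} → T i ≈ T j → X i ≈ X j → i ≡ j
    distinct T≈ X≈ = pairs-injective (element-injective T≈) (element-injective X≈)

    locate : ∀ τ x → τ ≉ 0# → ∃[ i ] (T i ≈ τ × X i ≈ x)
    locate τ x τ≉0 =
      let i , first≡ , second≡ = pairs-complete (code τ) (code x) (τ≉0 ∘ code-injective)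
      in i , trans (reflexive (≡.cong element first≡)) (element-code τ)
           , trans (reflexive (≡.cong element second≡)) (element-code x)

    κ c₀ c₁ c₂ : Carrier
    κ = 1# + d * (g + h - g * h)
    c₀ = k * d
    c₁ = d + κ + k * (1# + d)
    c₂ = 1# + d + k

    open Surface b b-rootless c₀ c₁ c₂ c-rootless
    open Family T X N T≉0 on-quadric distinct

    -- Three points have x = 0 and three have τ = 1, with one in common. So τ x = x at all five,
    -- which makes the moment of τ x zero.
    τ x n : Fin 5 → Carrier
    τ = 1# ∷ 1# ∷ g ∷ h ∷ 1# ∷ []
    x = - (1# + d) ∷ 0# ∷ 0# ∷ 0# ∷ - 1# ∷ []
    n = d * d + d + d * g * h ∷ d * g * h ∷ d * h ∷ d * g ∷ d * g * h ∷ []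

    τ≉0 : ∀ i → τ i ≉ 0#
    τ≉0 0F = 1≉0
    τ≉0 1F = 1≉0
    τ≉0 2F = g≉0
    τ≉0 3F = h≉0
    τ≉0 4F = 1≉0

    τn : ∀ i → τ i * n i ≈ x i * x i + x i + d * g * h
    τn 0F = solve 3 (λ d g h → let o = con (+ 1) in o :* (d :* d :+ d :+ d :* g :* h) :=
      (:- (o :+ d)) :* (:- (o :+ d)) :+ :- (o :+ d) :+ d :* g :* h) ≡.refl d g h
    τn 1F = solve 3 (λ d g h → con (+ 1) :* (d :* g :* h) := con (+ 0) :* con (+ 0) :+ con (+ 0) :+ d :* g :* h) ≡.refl d g h
    τn 2F = solve 3 (λ d g h → g :* (d :* h) := con (+ 0) :* con (+ 0) :+ con (+ 0) :+ d :* g :* h) ≡.refl d g h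
    τn 3F = solve 3 (λ d g h → h :* (d :* g) := con (+ 0) :* con (+ 0) :+ con (+ 0) :+ d :* g :* h) ≡.refl d g h
    τn 4F = solve 3 (λ d g h → con (+ 1) :* (d :* g :* h) := :- con (+ 1) :* :- con (+ 1) :+ :- con (+ 1) :+ d :* g :* h) ≡.refl d g h

    p : Fin 5 → I
    p i = proj₁ (locate (τ i) (x i) (τ≉0 i))

    T-p : ∀ i → T (p i) ≈ τ i
    T-p i = proj₁ (proj₂ (locate (τ i) (x i) (τ≉0 i)))

    X-p : ∀ i → X (p i) ≈ x i
    X-p i = proj₂ (proj₂ (locate (τ i) (x i) (τ≉0 i)))

    N-p : ∀ i → N (p i) ≈ n i
    N-p i = x-y≈0⇒x≈y (cancelˡ (τ≉0 i) (begin
      τ i * (N (p i) - n i)                 ≈⟨ solve 3 (λ t N n → t :* (N :- n) := t :* N :- t :* n) ≡.refl (τ i) (N (p i)) (n i) ⟩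
      τ i * N (p i) - τ i * n i             ≈⟨ +-cong (*-congʳ (sym (T-p i))) (-‿cong (trans (τn i)
          (+-cong (+-cong (*-cong (sym (X-p i)) (sym (X-p i))) (sym (X-p i))) dgh≈b))) ⟩
      T (p i) * N (p i) - (X (p i) * X (p i) + X (p i) + b)
        ≈⟨ solve 4 (λ t n x b → t :* n :- (x :* x :+ x :+ b) := t :* n :- x :* x :- x :- b) ≡.refl _ _ _ _ ⟩
      T (p i) * N (p i) - X (p i) * X (p i) - X (p i) - b   ≈⟨ on-quadric (p i) ⟩
      0#                                    ∎))

    p-injective : Injective _≡_ _≡_ p
    p-injective {i} {j} eq = targets-distinct i j
      (trans (sym (T-p i)) (trans (reflexive (≡.cong T eq)) (T-p j)))
      (trans (sym (X-p i)) (trans (reflexive (≡.cong X eq)) (X-p j)))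
      where
      1≉g : 1# ≉ g
      1≉g = g≉1 ∘ sym

      1≉h : 1# ≉ h
      1≉h = h≉1 ∘ sym

      0≉-1 : 0# ≉ - 1#
      0≉-1 0≈-1 = 1≉0 (by₁ (solve 0 (con (+ 1) := con (+ 1) :* (con (+ 0) :- :- con (+ 1))) ≡.refl) (x≈y⇒x-y≈0 0≈-1))

      -1-d≉0 : - (1# + d) ≉ 0#
      -1-d≉0 eq = 1+d≉0 (by₁ (solve 1 (λ d → con (+ 1) :+ d := :- con (+ 1) :* :- (con (+ 1) :+ d)) ≡.refl d) eq)

      -1-d≉-1 : - (1# + d) ≉ - 1#
      -1-d≉-1 eq = d≉0 (by₁ (solve 1 (λ d → d := :- con (+ 1) :* (:- (con (+ 1) :+ d) :- (:- con (+ 1)))) ≡.refl d)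
        (x≈y⇒x-y≈0 eq))

      targets-distinct : ∀ i j → τ i ≈ τ j → x i ≈ x j → i ≡ j
      targets-distinct 0F 0F _ _  = ≡.refl
      targets-distinct 1F 1F _ _  = ≡.refl
      targets-distinct 2F 2F _ _  = ≡.refl
      targets-distinct 3F 3F _ _  = ≡.refl
      targets-distinct 4F 4F _ _  = ≡.refl
      targets-distinct 0F 1F _ e  = contradiction e -1-d≉0
      targets-distinct 0F 2F e _  = contradiction e 1≉g
      targets-distinct 0F 3F e _  = contradiction e 1≉h
      targets-distinct 0F 4F _ e  = contradiction e -1-d≉-1
      targets-distinct 1F 2F e _  = contradiction e 1≉g
      targets-distinct 1F 3F e _  = contradiction e 1≉h
      targets-distinct 1F 4F _ e  = contradiction e 0≉-1
      targets-distinct 2F 3F e _  = contradiction e g≉h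
      targets-distinct 2F 4F e _  = contradiction (sym e) 1≉g
      targets-distinct 3F 4F e _  = contradiction (sym e) 1≉h
      targets-distinct 1F 0F _ e  = contradiction (sym e) -1-d≉0
      targets-distinct 2F 0F e _  = contradiction (sym e) 1≉g
      targets-distinct 3F 0F e _  = contradiction (sym e) 1≉h
      targets-distinct 4F 0F _ e  = contradiction (sym e) -1-d≉-1
      targets-distinct 2F 1F e _  = contradiction (sym e) 1≉g
      targets-distinct 3F 1F e _  = contradiction (sym e) 1≉h
      targets-distinct 4F 1F _ e  = contradiction (sym e) 0≉-1
      targets-distinct 3F 2F e _  = contradiction (sym e) g≉h
      targets-distinct 4F 2F e _  = contradiction e 1≉g
      targets-distinct 4F 3F e _  = contradiction e 1≉h

    V′ : Fin 5 → Vector Carrier 6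
    V′ i = 1# ∷ τ i ∷ x i ∷ n i ∷ F₁ (τ i) (x i) (n i) ∷ F₂ (τ i) (x i) (n i) ∷ []

    V-p : ∀ i → V (p i) ≋ V′ i
    V-p i 0F = refl
    V-p i 1F = T-p i
    V-p i 2F = X-p i
    V-p i 3F = N-p i
    V-p i 4F = +-cong (+-cong (+-cong (*-cong (X-p i) (N-p i)) (*-congˡ (*-cong (T-p i) (N-p i))))
      (*-congˡ (*-cong (T-p i) (X-p i)))) (*-congˡ (*-cong (T-p i) (T-p i)))
    V-p i 5F = +-cong (+-cong (+-cong (*-cong (N-p i) (N-p i)) (*-congˡ (*-cong (X-p i) (N-p i))))
      (*-congˡ (*-cong (T-p i) (N-p i)))) (*-congˡ (*-cong (T-p i) (X-p i)))

    -- With these weights the moments satisfy the recurrence of every cubic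
    -- x (x + 1) (x + d) + κ x + k (x + 1) (x + d) of a pencil.
    a : Vector Carrier 5
    a = (1# - g) * (1# - h) * (h - g) ∷ (h - g) * (d * (1# - g) * (1# - h) - (1# + d)) ∷
        (h - 1#) * (1# + d) ∷ (1# - g) * (1# + d) ∷ - ((1# + d) * (1# - g) * (1# - h) * (h - g)) ∷ []

    -- A syntactic copy of the weights and points, with sums unrolled as `dot` computes them down to
    -- the final `z`, so that each moment is one identity for `solve`.
    module Symbolic (d g h : Expr) where

      o z : Expr
      o = con (+ 1)
      z = con (+ 0)

      a₀ s′ : Expr
      a₀ = (o :- g) :* (o :- h) :* (h :- g)
      s′ = (o :+ d) :* a₀

      Tuple : Set
      Tuple = Vector Expr 5

      dot-a : Tuple → Expr
      dot-a u = a₀ :* u 0F :+ ((h :- g) :* (d :* (o :- g) :* (o :- h) :- (o :+ d)) :* u 1F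
        :+ ((h :- o) :* (o :+ d) :* u 2F :+ ((o :- g) :* (o :+ d) :* u 3F
        :+ (:- ((o :+ d) :* (o :- g) :* (o :- h) :* (h :- g)) :* u 4F :+ z))))

      one τ′ x′ n′ : Tuple
      one _ = o
      τ′ = o ∷ o ∷ g ∷ h ∷ o ∷ []
      x′ = :- (o :+ d) ∷ z ∷ z ∷ z ∷ :- o ∷ []
      n′ = d :* d :+ d :+ d :* g :* h ∷ d :* g :* h ∷ d :* h ∷ d :* g ∷ d :* g :* h ∷ []

      moment″ : Tuple → Tuple → Expr
      moment″ u v = dot-a (λ i → u i :* v i)

    moment′ : (u v : Vector Carrier 5) → Carrier
    moment′ u v = dot a (λ i → u i * v i)

    -- All moments are multiples of `s`, so the recurrences can be checked with `s` as a free
    -- variable.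
    s : Carrier
    s = (1# + d) * a 0F

    moment-ττ : moment′ τ τ ≈ - s
    moment-ττ = solve 3 (λ d g h → let open Symbolic d g h in moment″ τ′ τ′ := :- s′) ≡.refl d g h

    moment-τx : moment′ τ x ≈ 0#
    moment-τx = solve 3 (λ d g h → let open Symbolic d g h in moment″ τ′ x′ := z) ≡.refl d g h

    moment-τn : moment′ τ n ≈ d * s
    moment-τn = solve 3 (λ d g h → let open Symbolic d g h in moment″ τ′ n′ := d :* s′) ≡.refl d g h

    moment-xn : moment′ x n ≈ - (d * (1# + d) * s)
    moment-xn = solve 3 (λ d g h → let open Symbolic d g h in moment″ x′ n′ := :- (d :* (o :+ d) :* s′)) ≡.refl d g h

    moment-nn : moment′ n n ≈ d * ((1# + d) * (1# + d) - d - κ) * s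
    moment-nn = solve 3 (λ d g h → let open Symbolic d g h in
      moment″ n′ n′ := d :* ((o :+ d) :* (o :+ d) :- d :- (o :+ d :* (g :+ h :- g :* h))) :* s′) ≡.refl d g h

    vanishing-form : ∀ m₃ m₂ m₁ m₀ (f₃ f₂ f₁ f₀ : Vector Carrier 5) →
      dot a f₃ ≈ m₃ → dot a f₂ ≈ m₂ → dot a f₁ ≈ m₁ → dot a f₀ ≈ m₀ →
      m₃ + c₂ * m₂ + c₁ * m₁ + c₀ * m₀ ≈ 0# →
      dot a (λ i → f₃ i + c₂ * f₂ i + c₁ * f₁ i + c₀ * f₀ i) ≈ 0#
    vanishing-form m₃ m₂ m₁ m₀ f₃ f₂ f₁ f₀ e₃ e₂ e₁ e₀ rec = begin
      dot a (λ i → f₃ i + c₂ * f₂ i + c₁ * f₁ i + c₀ * f₀ i)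
        ≈⟨ dot-cong {a = a} (λ _ → refl) (λ i → recurrence-dot c₂ c₁ c₀ (f₃ i) (f₂ i) (f₁ i) (f₀ i)) ⟩
      dot a (λ i → dot l (f i))
        ≈⟨ dot-combination l a f ⟨
      dot l (combination a f)
        ≈⟨ dot-cong {a = l} {v = combination a f} {w = m₃ ∷ m₂ ∷ m₁ ∷ m₀ ∷ []} (λ _ → refl) (λ { 0F → e₃ ; 1F → e₂ ; 2F → e₁ ; 3F → e₀ }) ⟩
      dot l (m₃ ∷ m₂ ∷ m₁ ∷ m₀ ∷ [])
        ≈⟨ recurrence-dot c₂ c₁ c₀ m₃ m₂ m₁ m₀ ⟨
      m₃ + c₂ * m₂ + c₁ * m₁ + c₀ * m₀
        ≈⟨ rec ⟩
      0# ∎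
      where
      l : Vector Carrier 4
      l = 1# ∷ c₂ ∷ c₁ ∷ c₀ ∷ []

      f : Vector (Vector Carrier 4) 5
      f i = f₃ i ∷ f₂ i ∷ f₁ i ∷ f₀ i ∷ []

    relation : combination a V′ ≋ 𝟎
    relation 0F = solve 3 (λ d g h → let open Symbolic d g h in dot-a one := z) ≡.refl d g h
    relation 1F = solve 3 (λ d g h → let open Symbolic d g h in dot-a τ′ := z) ≡.refl d g h
    relation 2F = solve 3 (λ d g h → let open Symbolic d g h in dot-a x′ := z) ≡.refl d g h
    relation 3F = solve 3 (λ d g h → let open Symbolic d g h in dot-a n′ := z) ≡.refl d g h
    relation 4F = vanishing-form _ _ _ _ (λ i → x i * n i) (λ i → τ i * n i) (λ i → τ i * x i) (λ i → τ i * τ i)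
      moment-xn moment-τn moment-τx moment-ττ
      (solve 4 (λ d κ k s → let o = con (+ 1) in
        :- (d :* (o :+ d) :* s) :+ (o :+ d :+ k) :* (d :* s) :+ (d :+ κ :+ k :* (o :+ d)) :* con (+ 0)
        :+ k :* d :* (:- s) := con (+ 0)) ≡.refl d κ k s)
    relation 5F = vanishing-form _ _ _ _ (λ i → n i * n i) (λ i → x i * n i) (λ i → τ i * n i) (λ i → τ i * x i)
      moment-nn moment-xn moment-τn moment-τx
      (solve 4 (λ d κ k s → let o = con (+ 1) in
        d :* ((o :+ d) :* (o :+ d) :- d :- κ) :* s :+ (o :+ d :+ k) :* (:- (d :* (o :+ d) :* s))
        :+ (d :+ κ :+ k :* (o :+ d)) :* (d :* s) :+ k :* d :* con (+ 0) := con (+ 0)) ≡.refl d κ k s)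

    in-span : InSpan (V ∘ p ∘ suc) (V (p 0F))
    in-span = isolate a (V (p 0F)) (V ∘ p ∘ suc)
      (λ j → trans (combination-cong {a = a} {a} {V (p 0F) ∷ V ∘ p ∘ suc} {V′} (λ _ → refl)
        (λ where 0F → V-p 0F ; (suc i) → V-p (suc i)) j) (relation j))
      -- The leading weight is (1 - g)(1 - h)(h - g), nonzero because 1, g and h are distinct.
      (*≉0 (*≉0 (x≉y⇒x-y≉0 (g≉1 ∘ sym)) (x≉y⇒x-y≉0 (h≉1 ∘ sym)))
        (x≉y⇒x-y≉0 (g≉h ∘ sym)))

    affine-injective : ∀ {i j} → affine i ≋ affine j → i ≡ j
    affine-injective eq = distinct (eq 0F) (eq 1F)

    conclusion : Σ[ 𝒳 ∈ Pred (AffinePoint 5) ℓ₁ ]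
      (𝒳 Respects _≋_ × Counting.HasSize _≋_ (q ^ 2 ∸ q) 𝒳 × IsGeneral 4 (inPG 𝒳) × Is⟨ 5 , 3 ⟩-Set (inPG 𝒳))
    conclusion = Assemble.conclusion (enough-points 4≤q) affine affine-injective (Complete.functional≋0 locate)
      independent₄ SixPoints.absurd p p-injective in-span

mainTheorem12 : ∀ {c ℓ₁ ℓ₂} (q : ℕ) → IsPrimePower q → 4 ≤ q →
    (GF[q] : HeytingField c ℓ₁ ℓ₂) → let open Geometry GF[q] in HasOrder q →
    Σ[ 𝒳 ∈ Pred (AffinePoint 5) ℓ₁ ]
    (𝒳 Respects _≋_ ×
    Counting.HasSize _≋_ (q ^ 2 ∸ q) 𝒳 ×
    IsGeneral 4 (inPG 𝒳) ×
    Is⟨ 5 , 3 ⟩-Set (inPG 𝒳))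
mainTheorem12 q _ 4≤q GF[q] order = Construction.conclusion b b-rootless d g h k dgh≈b d≉0 1+d≉0
  g≉0 g≉1 h≉0 h≉1 g≉h c-rootless
  where
  open FiniteField GF[q] 4≤q order using (module Parameters; module Construction)
  open Parameters using (irreducible-quadratic; module Choice)

  b = proj₁ irreducible-quadratic
  b-rootless = proj₂ irreducible-quadratic

  open Choice b b-rootless
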